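{- For any semisimple MV-algebra $A$, $[0,1]_{\mathbb Q}\otimes A$ is (up to isomorphism) the divisible hull $A^d$ of $A$.
   Context: An MV-algebra is a structure $(A,\oplus,{}^*,0)$ such that $(A,\oplus,0)$ is an Abelian monoid, $(x^*)^*=x$, $(x^*\oplus y)^*\oplus y=(y^*\oplus x)^*\oplus x$ and $0^*\oplus x=0^*$; put $1=0^*$, $x\odot y=(x^*\oplus y^*)^*$, $x\vee y=(x\odot y^*)\oplus y$, $x\wedge y=(x\oplus y^*)\odot y$. The partial sum $x+y$ is defined iff $x\odot y=0$, and then $x+y=x\oplus y$. An MV-algebra is semisimple if the intersection $Rad$ of its maximal ideals is $\{0\}$; equivalently, it embeds in the MV-algebra $C(X)$ of continuous functions $X\to[0,1]$ (pointwise operations $x\oplus y=\min\{x+y,1\}$, $x^*=1-x$) for some compact Hausdorff space $X$. $[0,1]_{\mathbb Q}=[0,1]\cap\mathbb Q$ with $x\oplus y=\min\{x+y,1\}$, $x^*=1-x$. Divisible hull: if $A$ is semisimple and $A\subseteq C(X)$ with $X$ compact Hausdorff, then $A^d=\{a\in C(X)\mid a=\frac{a_1}{n}+\dots+\frac{a_n}{n}\text{ for some } n\in\mathbb N,\ n\ge1,\text{ and } a_1,\dots,a_n\in A\}$. Tensor product: a bimorphism $\beta:A\times B\to C$ of MV-algebras is a map with $\beta(1,1)=1$ that preserves $\vee,\wedge$ and (whenever defined) the partial sum $+$ in each argument separately. $A\otimes_{MV}B$ is the MV-algebra with a universal bimorphism from $A\times B$: every bimorphism $A\times B\to C$ factors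 uniquely through it by an MV-homomorphism. For semisimple $A,B$, $A\otimes B=(A\otimes_{MV}B)/Rad(A\otimes_{MV}B)$; it has the same universal property with respect to semisimple $C$. -}

module Defs where

open import Algebra.Core using (Op₁; Op₂)
open import Algebra.Structures using (IsCommutativeMonoid)
open import Data.Integer.Base as ℤ using ()
import Data.Integer.Properties as ℤₚ
open import Data.List.Base using (List)
open import Data.List.Relation.Unary.Any using (Any)
open import Data.Nat.Base as ℕ using (ℕ; zero; suc)
import Data.Nat.Properties as ℕₚ
open import Data.Product.Base using (Σ; ∃; _×_; _,_; proj₁; proj₂)
open import Data.Rational.Base as Rat using (ℚ; 0ℚ; 1ℚ; ½; ∣_∣; _⊓_)
import Data.Rational.Properties as ℚₚ
open import Data.Rational.Solver using (module +-*-Solver)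
import Data.Rational.Unnormalised.Base as ℚᵘ
import Data.Rational.Unnormalised.Properties as ℚᵘₚ
open import Data.Sum.Base using (inj₁; inj₂)
open import Data.Unit.Polymorphic.Base using (⊤)
open import Data.Vec.Base as Vec using (Vec; []; _∷_; foldr′; replicate; _++_)
open import Data.Vec.Relation.Binary.Pointwise.Inductive using (Pointwise; []; _∷_; ++⁺)
open import Function.Base using (_$_)
open import Function.Bundles using (Func)
open import Function.Definitions using (Congruent; Injective; Bijective)
open import Level using (Level; _⊔_; Lift; lift; lower; 0ℓ) renaming (suc to lsuc)
open import Relation.Binary.Bundles using (Setoid)
open import Relation.Binary.Core using (Rel)
open import Relation.Binary.Definitions using (_Respects_)
open import Relation.Binary.PropositionalEquality
  using (_≡_; refl; sym; trans; cong; cong₂; subst; subst₂; module ≡-Reasoning)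
import Relation.Binary.Reasoning.Setoid as ≈-Reasoning
open import Relation.Binary.Structures using (IsEquivalence)
open import Relation.Nullary.Negation using (¬_)
open import Relation.Unary using (Pred; _∈_; _⊆_; _≐_; _∩_; ⋃; Empty)

record MVAlgebra (c ℓ : Level) : Set (lsuc (c ⊔ ℓ)) where
  infix  4 _≈_ _≤_
  infixl 6 _⊕_ _∨_
  infixl 7 _⊙_ _∧_
  infix  8 _⋆
  field
    Carrier : Set c
    _≈_     : Rel Carrier ℓ
    _⊕_     : Op₂ Carrier
    _⋆      : Op₁ Carrier
    0#      : Carrier

  1# : Carrier
  1# = 0# ⋆

  field
    ⊕-isCommutativeMonoid : IsCommutativeMonoid _≈_ _⊕_ 0#
    ⋆-cong                : ∀ {x y} → x ≈ y → x ⋆ ≈ y ⋆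
    ⋆-involutive          : ∀ x → x ⋆ ⋆ ≈ x
    łukasiewicz           : ∀ x y → (x ⋆ ⊕ y) ⋆ ⊕ y ≈ (y ⋆ ⊕ x) ⋆ ⊕ x
    ⊕-zeroˡ               : ∀ x → 1# ⊕ x ≈ 1#

  open IsCommutativeMonoid ⊕-isCommutativeMonoid public
    using (isEquivalence; setoid; reflexive)
    renaming ( refl to ≈-refl; sym to ≈-sym; trans to ≈-trans
             ; ∙-cong to ⊕-cong; assoc to ⊕-assoc; comm to ⊕-comm
             ; identityˡ to ⊕-identityˡ; identityʳ to ⊕-identityʳ )

  _⊙_ : Op₂ Carrier
  x ⊙ y = (x ⋆ ⊕ y ⋆) ⋆

  _∨_ : Op₂ Carrier
  x ∨ y = (x ⊙ y ⋆) ⊕ y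

  _∧_ : Op₂ Carrier
  x ∧ y = (x ⊕ y ⋆) ⊙ y

  _≤_ : Rel Carrier ℓ
  x ≤ y = x ⋆ ⊕ y ≈ 1#

  ⨁ : ∀ {n} → Vec Carrier n → Carrier
  ⨁ = foldr′ _⊕_ 0#

module MVProperties {c ℓ : Level} (A : MVAlgebra c ℓ) where
  open MVAlgebra A
  open ≈-Reasoning setoid

  ⊕-zeroʳ : ∀ x → x ⊕ 1# ≈ 1#
  ⊕-zeroʳ x = ≈-trans (⊕-comm x 1#) (⊕-zeroˡ x)

  ⊙-cong : ∀ {x x′ y y′} → x ≈ x′ → y ≈ y′ → x ⊙ y ≈ x′ ⊙ y′
  ⊙-cong p q = ⋆-cong (⊕-cong (⋆-cong p) (⋆-cong q))

  ⊙-comm : ∀ x y → x ⊙ y ≈ y ⊙ x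
  ⊙-comm x y = ⋆-cong (⊕-comm (x ⋆) (y ⋆))

  ⋆-⊕-inverse : ∀ x → x ⋆ ⊕ x ≈ 1#
  ⋆-⊕-inverse x = begin
    x ⋆ ⊕ x              ≈⟨ ⊕-cong (⋆-cong (⊕-identityˡ x)) ≈-refl ⟨
    (0# ⊕ x) ⋆ ⊕ x       ≈⟨ ⊕-cong (⋆-cong (⊕-cong (⋆-involutive 0#) ≈-refl)) ≈-refl ⟨
    (1# ⋆ ⊕ x) ⋆ ⊕ x     ≈⟨ łukasiewicz x 1# ⟨
    (x ⋆ ⊕ 1#) ⋆ ⊕ 1#    ≈⟨ ⊕-zeroʳ _ ⟩
    1#                   ∎

  ≤-reflexive : ∀ {x y} → x ≈ y → x ≤ y
  ≤-reflexive {x} {y} p = ≈-trans (⊕-cong (⋆-cong p) ≈-refl) (⋆-⊕-inverse y)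

  ≤-resp : ∀ {x x′ y y′} → x ≈ x′ → y ≈ y′ → x ≤ y → x′ ≤ y′
  ≤-resp p q r = ≈-trans (≈-sym (⊕-cong (⋆-cong p) q)) r

  x≤x⊕y : ∀ x y → x ≤ x ⊕ y
  x≤x⊕y x y = begin
    x ⋆ ⊕ (x ⊕ y)   ≈⟨ ⊕-assoc _ _ _ ⟨
    (x ⋆ ⊕ x) ⊕ y   ≈⟨ ⊕-cong (⋆-⊕-inverse x) ≈-refl ⟩
    1# ⊕ y          ≈⟨ ⊕-zeroˡ y ⟩
    1#              ∎

  ≤⇒⊕ : ∀ {x y} → x ≤ y → ∃ λ z → y ≈ x ⊕ z
  ≤⇒⊕ {x} {y} p = (y ⋆ ⊕ x) ⋆ , (begin
    y                    ≈⟨ ⊕-identityˡ y ⟨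
    0# ⊕ y               ≈⟨ ⊕-cong (⋆-involutive 0#) ≈-refl ⟨
    1# ⋆ ⊕ y             ≈⟨ ⊕-cong (⋆-cong p) ≈-refl ⟨
    (x ⋆ ⊕ y) ⋆ ⊕ y      ≈⟨ łukasiewicz x y ⟩
    (y ⋆ ⊕ x) ⋆ ⊕ x      ≈⟨ ⊕-comm _ _ ⟩
    x ⊕ (y ⋆ ⊕ x) ⋆      ∎)

  ≤-trans : ∀ {x y z} → x ≤ y → y ≤ z → x ≤ z
  ≤-trans {x} p q with ≤⇒⊕ p | ≤⇒⊕ q
  ... | u , e | v , f = ≤-resp ≈-refl
    (≈-sym (≈-trans f (≈-trans (⊕-cong e ≈-refl) (⊕-assoc _ _ _)))) (x≤x⊕y x (u ⊕ v))

  ⊕-monoʳ : ∀ w {x y} → x ≤ y → w ⊕ x ≤ w ⊕ y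
  ⊕-monoʳ w {x} p with ≤⇒⊕ p
  ... | u , e = ≤-resp ≈-refl
    (≈-sym (≈-trans (⊕-cong ≈-refl e) (≈-sym (⊕-assoc _ _ _)))) (x≤x⊕y (w ⊕ x) u)

  ⊕-monoˡ : ∀ w {x y} → x ≤ y → x ⊕ w ≤ y ⊕ w
  ⊕-monoˡ w p = ≤-resp (⊕-comm _ _) (⊕-comm _ _) (⊕-monoʳ w p)

  ⊙-⋆-residual : ∀ {x y z} → x ≤ y ⊕ z → x ⊙ y ⋆ ≤ z
  ⊙-⋆-residual {x} {y} {z} p = begin
    (x ⋆ ⊕ y ⋆ ⋆) ⋆ ⋆ ⊕ z   ≈⟨ ⊕-cong (⋆-involutive _) ≈-refl ⟩
    (x ⋆ ⊕ y ⋆ ⋆) ⊕ z       ≈⟨ ⊕-cong (⊕-cong ≈-refl (⋆-involutive y)) ≈-refl ⟩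
    (x ⋆ ⊕ y) ⊕ z           ≈⟨ ⊕-assoc _ _ _ ⟩
    x ⋆ ⊕ (y ⊕ z)           ≈⟨ p ⟩
    1#                      ∎

  ⊙-⋆-residual⁻ : ∀ {x y z} → x ⊙ y ⋆ ≤ z → x ≤ y ⊕ z
  ⊙-⋆-residual⁻ {x} {y} {z} p = begin
    x ⋆ ⊕ (y ⊕ z)           ≈⟨ ⊕-assoc _ _ _ ⟨
    (x ⋆ ⊕ y) ⊕ z           ≈⟨ ⊕-cong (⊕-cong ≈-refl (⋆-involutive y)) ≈-refl ⟨
    (x ⋆ ⊕ y ⋆ ⋆) ⊕ z       ≈⟨ ⊕-cong (⋆-involutive _) ≈-refl ⟨
    (x ⋆ ⊕ y ⋆ ⋆) ⋆ ⋆ ⊕ z   ≈⟨ p ⟩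
    1#                      ∎

  x≤y⊕[x⊙y⋆] : ∀ x y → x ≤ y ⊕ x ⊙ y ⋆
  x≤y⊕[x⊙y⋆] x y = ⊙-⋆-residual⁻ (≤-reflexive ≈-refl)

  ⊙-⋆-triangle : ∀ x y z → x ⊙ z ⋆ ≤ (y ⊙ z ⋆) ⊕ (x ⊙ y ⋆)
  ⊙-⋆-triangle x y z = ⊙-⋆-residual
    (≤-trans (x≤y⊕[x⊙y⋆] x y)
             (≤-resp ≈-refl (⊕-assoc _ _ _) (⊕-monoˡ (x ⊙ y ⋆) (x≤y⊕[x⊙y⋆] y z))))

  ⊙-⋆-⊕ : ∀ x y x′ y′ → (x ⊕ y) ⊙ (x′ ⊕ y′) ⋆ ≤ (x ⊙ x′ ⋆) ⊕ (y ⊙ y′ ⋆)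
  ⊙-⋆-⊕ x y x′ y′ = ⊙-⋆-residual
    (≤-trans (⊕-monoˡ y (x≤y⊕[x⊙y⋆] x x′))
    (≤-trans (⊕-monoʳ (x′ ⊕ d) (x≤y⊕[x⊙y⋆] y y′))
             (≤-reflexive (begin
               (x′ ⊕ d) ⊕ (y′ ⊕ e)   ≈⟨ ⊕-assoc _ _ _ ⟩
               x′ ⊕ (d ⊕ (y′ ⊕ e))   ≈⟨ ⊕-cong ≈-refl (⊕-assoc _ _ _) ⟨
               x′ ⊕ ((d ⊕ y′) ⊕ e)   ≈⟨ ⊕-cong ≈-refl (⊕-cong (⊕-comm _ _) ≈-refl) ⟩
               x′ ⊕ ((y′ ⊕ d) ⊕ e)   ≈⟨ ⊕-cong ≈-refl (⊕-assoc _ _ _) ⟩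
               x′ ⊕ (y′ ⊕ (d ⊕ e))   ≈⟨ ⊕-assoc _ _ _ ⟨
               (x′ ⊕ y′) ⊕ (d ⊕ e)   ∎))))
    where
    d = x ⊙ x′ ⋆
    e = y ⊙ y′ ⋆

  ⊙-⋆-⋆ : ∀ x y → x ⋆ ⊙ y ⋆ ⋆ ≈ y ⊙ x ⋆
  ⊙-⋆-⋆ x y = ≈-trans (⊙-cong ≈-refl (⋆-involutive y)) (⊙-comm _ _)

  -- As reals, x + v = (x ⊕ v) + (x ⊙ v): the overflow x ⊙ v is passed on to
  -- the next entry, so the real sum grows by v, capped at the length n.
  carry : ∀ {n} → Vec Carrier n → Carrier → Vec Carrier n
  carry []       v = []
  carry (x ∷ xs) v = x ⊕ v ∷ carry xs (x ⊙ v)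

  carries : ∀ {m n} → Vec Carrier m → Vec Carrier n → Vec Carrier m
  carries xs []       = xs
  carries xs (v ∷ vs) = carries (carry xs v) vs

  ⊙-⋆-inverse : ∀ {x y} → x ≈ y → x ⊙ y ⋆ ≈ 0#
  ⊙-⋆-inverse {x} {y} p = begin
    (x ⋆ ⊕ y ⋆ ⋆) ⋆   ≈⟨ ⋆-cong (⊕-cong (⋆-cong p) (⋆-involutive y)) ⟩
    (y ⋆ ⊕ y) ⋆       ≈⟨ ⋆-cong (⋆-⊕-inverse y) ⟩
    0# ⋆ ⋆            ≈⟨ ⋆-involutive 0# ⟩
    0#                ∎

record IsMVHomomorphism {a ℓ₁ b ℓ₂ : Level} (A : MVAlgebra a ℓ₁) (B : MVAlgebra b ℓ₂)
    (f : MVAlgebra.Carrier A → MVAlgebra.Carrier B) : Set (a ⊔ ℓ₁ ⊔ ℓ₂) where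
  private
    module A = MVAlgebra A
    module B = MVAlgebra B
  field
    f-cong : Congruent A._≈_ B._≈_ f
    0-homo : f A.0# B.≈ B.0#
    ⊕-homo : ∀ x y → f (x A.⊕ y) B.≈ f x B.⊕ f y
    ⋆-homo : ∀ x → f (x A.⋆) B.≈ f x B.⋆

infix 1 _⟶_ _↪_ _≅_

record _⟶_ {a ℓ₁ b ℓ₂ : Level} (A : MVAlgebra a ℓ₁) (B : MVAlgebra b ℓ₂) :
    Set (a ⊔ ℓ₁ ⊔ b ⊔ ℓ₂) where
  field
    to             : MVAlgebra.Carrier A → MVAlgebra.Carrier B
    isHomomorphism : IsMVHomomorphism A B to
  open IsMVHomomorphism isHomomorphism public

record _↪_ {a ℓ₁ b ℓ₂ : Level} (A : MVAlgebra a ℓ₁) (B : MVAlgebra b ℓ₂) :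
    Set (a ⊔ ℓ₁ ⊔ b ⊔ ℓ₂) where
  field
    hom       : A ⟶ B
    injective : Injective (MVAlgebra._≈_ A) (MVAlgebra._≈_ B) (_⟶_.to hom)
  open _⟶_ hom public

record _≅_ {a ℓ₁ b ℓ₂ : Level} (A : MVAlgebra a ℓ₁) (B : MVAlgebra b ℓ₂) :
    Set (a ⊔ ℓ₁ ⊔ b ⊔ ℓ₂) where
  field
    hom       : A ⟶ B
    bijective : Bijective (MVAlgebra._≈_ A) (MVAlgebra._≈_ B) (_⟶_.to hom)
  open _⟶_ hom public

record IsIdeal {c ℓ p : Level} (A : MVAlgebra c ℓ) (J : Pred (MVAlgebra.Carrier A) p) :
    Set (c ⊔ ℓ ⊔ p) where
  open MVAlgebra A
  field
    0∈       : 0# ∈ J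
    ⊕-closed : ∀ {x y} → x ∈ J → y ∈ J → x ⊕ y ∈ J
    ≤-closed : ∀ {x y} → x ≤ y → y ∈ J → x ∈ J

record IsMaximalIdeal {c ℓ p : Level} (A : MVAlgebra c ℓ) (M : Pred (MVAlgebra.Carrier A) p) :
    Set (c ⊔ ℓ ⊔ lsuc p) where
  open MVAlgebra A
  field
    isIdeal : IsIdeal A M
    proper  : ¬ (1# ∈ M)
    maximal : (J : Pred Carrier p) → IsIdeal A J → ¬ (1# ∈ J) → M ⊆ J → J ⊆ M
  open IsIdeal isIdeal public

-- Subsets are predicates at level c ⊔ ℓ, the least level at which the
-- subsets first-order definable over A live.
Rad : ∀ {c ℓ : Level} (A : MVAlgebra c ℓ) → Pred (MVAlgebra.Carrier A) (lsuc (c ⊔ ℓ))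
Rad {c} {ℓ} A x = (M : Pred (MVAlgebra.Carrier A) (c ⊔ ℓ)) → IsMaximalIdeal A M → x ∈ M

Rad-isIdeal : ∀ {c ℓ : Level} (A : MVAlgebra c ℓ) → IsIdeal A (Rad A)
Rad-isIdeal A = record
  { 0∈       = λ M m → IsMaximalIdeal.0∈ m
  ; ⊕-closed = λ p q M m → IsMaximalIdeal.⊕-closed m (p M m) (q M m)
  ; ≤-closed = λ x≤y q M m → IsMaximalIdeal.≤-closed m x≤y (q M m)
  }

Semisimple : ∀ {c ℓ : Level} → MVAlgebra c ℓ → Set (lsuc (c ⊔ ℓ))
Semisimple A = ∀ x → x ∈ Rad A → x ≈ 0#
  where open MVAlgebra A

Quotient : ∀ {c ℓ p : Level} (A : MVAlgebra c ℓ) (J : Pred (MVAlgebra.Carrier A) p) →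
           IsIdeal A J → MVAlgebra c p
Quotient {p = p} A J isIdeal = record
  { Carrier = Carrier
  ; _≈_     = _≈ᴶ_
  ; _⊕_     = _⊕_
  ; _⋆      = _⋆
  ; 0#      = 0#
  ; ⊕-isCommutativeMonoid = record
    { isMonoid = record
      { isSemigroup = record
        { isMagma = record
          { isEquivalence = record
            { refl  = incl ≈-refl
            ; sym   = λ (p , q) → q , p
            ; trans = λ (p , q) (p′ , q′) →
                ≤-closed (⊙-⋆-triangle _ _ _) (⊕-closed p′ p) ,
                ≤-closed (⊙-⋆-triangle _ _ _) (⊕-closed q q′)
            }
          ; ∙-cong = λ (p , q) (p′ , q′) →
              ≤-closed (⊙-⋆-⊕ _ _ _ _) (⊕-closed p p′) ,
              ≤-closed (⊙-⋆-⊕ _ _ _ _) (⊕-closed q q′)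
          }
        ; assoc = λ x y z → incl (⊕-assoc x y z)
        }
      ; identity = (λ x → incl (⊕-identityˡ x)) , (λ x → incl (⊕-identityʳ x))
      }
    ; comm = λ x y → incl (⊕-comm x y)
    }
  ; ⋆-cong       = λ (p , q) → ≤-closed (≤-reflexive (⊙-⋆-⋆ _ _)) q
                             , ≤-closed (≤-reflexive (⊙-⋆-⋆ _ _)) p
  ; ⋆-involutive = λ x → incl (⋆-involutive x)
  ; łukasiewicz  = λ x y → incl (łukasiewicz x y)
  ; ⊕-zeroˡ      = λ x → incl (⊕-zeroˡ x)
  }
  where
  open MVAlgebra A
  open MVProperties A
  open IsIdeal isIdeal

  _≈ᴶ_ : Rel Carrier p
  x ≈ᴶ y = (x ⊙ y ⋆) ∈ J × (y ⊙ x ⋆) ∈ J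

  incl : ∀ {x y} → x ≈ y → x ≈ᴶ y
  incl e = ≤-closed (≤-reflexive (⊙-⋆-inverse e)) 0∈
         , ≤-closed (≤-reflexive (⊙-⋆-inverse (≈-sym e))) 0∈

record IsBimorphism {a ℓ₁ b ℓ₂ c ℓ₃ : Level}
    (A : MVAlgebra a ℓ₁) (B : MVAlgebra b ℓ₂) (C : MVAlgebra c ℓ₃)
    (β : MVAlgebra.Carrier A → MVAlgebra.Carrier B → MVAlgebra.Carrier C) :
    Set (a ⊔ ℓ₁ ⊔ b ⊔ ℓ₂ ⊔ ℓ₃) where
  private
    module A = MVAlgebra A
    module B = MVAlgebra B
    module C = MVAlgebra C
  field
    β-cong  : ∀ {x x′ y y′} → x A.≈ x′ → y B.≈ y′ → β x y C.≈ β x′ y′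
    β-1     : β A.1# B.1# C.≈ C.1#
    ∨-homoˡ : ∀ x x′ y → β (x A.∨ x′) y C.≈ β x y C.∨ β x′ y
    ∨-homoʳ : ∀ x y y′ → β x (y B.∨ y′) C.≈ β x y C.∨ β x y′
    ∧-homoˡ : ∀ x x′ y → β (x A.∧ x′) y C.≈ β x y C.∧ β x′ y
    ∧-homoʳ : ∀ x y y′ → β x (y B.∧ y′) C.≈ β x y C.∧ β x y′
    +-defˡ  : ∀ {x x′} y → x A.⊙ x′ A.≈ A.0# → β x y C.⊙ β x′ y C.≈ C.0#
    +-homoˡ : ∀ {x x′} y → x A.⊙ x′ A.≈ A.0# → β (x A.⊕ x′) y C.≈ β x y C.⊕ β x′ y
    +-defʳ  : ∀ x {y y′} → y B.⊙ y′ B.≈ B.0# → β x y C.⊙ β x y′ C.≈ C.0#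
    +-homoʳ : ∀ x {y y′} → y B.⊙ y′ B.≈ B.0# → β x (y B.⊕ y′) C.≈ β x y C.⊕ β x y′

-- The MV-algebra presented by generators ⟨ x , y ⟩ and the relations
-- making ⟨_,_⟩ a bimorphism; Universal proves its universal property.
module Tensor {a ℓ₁ b ℓ₂ : Level} (A : MVAlgebra a ℓ₁) (B : MVAlgebra b ℓ₂) where
  private
    module A = MVAlgebra A
    module B = MVAlgebra B

  infixl 6 _∔_
  infix  8 _⁎

  data Term : Set (a ⊔ b) where
    ⟨_,_⟩ : A.Carrier → B.Carrier → Term
    _∔_   : Op₂ Term
    _⁎    : Op₁ Term
    𝟎     : Term

  private
    _⊙ᵗ_ _∨ᵗ_ _∧ᵗ_ : Op₂ Term
    s ⊙ᵗ t = (s ⁎ ∔ t ⁎) ⁎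
    s ∨ᵗ t = (s ⊙ᵗ (t ⁎)) ∔ t
    s ∧ᵗ t = (s ∔ t ⁎) ⊙ᵗ t

  infix 4 _∼_

  data _∼_ : Rel Term (a ⊔ ℓ₁ ⊔ b ⊔ ℓ₂) where
    ∼-refl  : ∀ {s} → s ∼ s
    ∼-sym   : ∀ {s t} → s ∼ t → t ∼ s
    ∼-trans : ∀ {s t u} → s ∼ t → t ∼ u → s ∼ u
    ∔-cong  : ∀ {s s′ t t′} → s ∼ s′ → t ∼ t′ → s ∔ t ∼ s′ ∔ t′
    ⁎-cong  : ∀ {s t} → s ∼ t → s ⁎ ∼ t ⁎

    ∔-assoc      : ∀ s t u → (s ∔ t) ∔ u ∼ s ∔ (t ∔ u)
    ∔-comm       : ∀ s t → s ∔ t ∼ t ∔ s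
    ∔-identityˡ  : ∀ s → 𝟎 ∔ s ∼ s
    ⁎-involutive : ∀ s → s ⁎ ⁎ ∼ s
    ∔-łukasiewicz : ∀ s t → (s ⁎ ∔ t) ⁎ ∔ t ∼ (t ⁎ ∔ s) ⁎ ∔ s
    ∔-zeroˡ      : ∀ s → 𝟎 ⁎ ∔ s ∼ 𝟎 ⁎

    ⟨⟩-cong    : ∀ {x x′ y y′} → x A.≈ x′ → y B.≈ y′ → ⟨ x , y ⟩ ∼ ⟨ x′ , y′ ⟩
    ⟨⟩-1       : ⟨ A.1# , B.1# ⟩ ∼ 𝟎 ⁎
    ⟨⟩-∨-homoˡ : ∀ x x′ y → ⟨ x A.∨ x′ , y ⟩ ∼ ⟨ x , y ⟩ ∨ᵗ ⟨ x′ , y ⟩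
    ⟨⟩-∨-homoʳ : ∀ x y y′ → ⟨ x , y B.∨ y′ ⟩ ∼ ⟨ x , y ⟩ ∨ᵗ ⟨ x , y′ ⟩
    ⟨⟩-∧-homoˡ : ∀ x x′ y → ⟨ x A.∧ x′ , y ⟩ ∼ ⟨ x , y ⟩ ∧ᵗ ⟨ x′ , y ⟩
    ⟨⟩-∧-homoʳ : ∀ x y y′ → ⟨ x , y B.∧ y′ ⟩ ∼ ⟨ x , y ⟩ ∧ᵗ ⟨ x , y′ ⟩
    ⟨⟩-+-defˡ  : ∀ {x x′} y → x A.⊙ x′ A.≈ A.0# → ⟨ x , y ⟩ ⊙ᵗ ⟨ x′ , y ⟩ ∼ 𝟎
    ⟨⟩-+-homoˡ : ∀ {x x′} y → x A.⊙ x′ A.≈ A.0# → ⟨ x A.⊕ x′ , y ⟩ ∼ ⟨ x , y ⟩ ∔ ⟨ x′ , y ⟩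
    ⟨⟩-+-defʳ  : ∀ x {y y′} → y B.⊙ y′ B.≈ B.0# → ⟨ x , y ⟩ ⊙ᵗ ⟨ x , y′ ⟩ ∼ 𝟎
    ⟨⟩-+-homoʳ : ∀ x {y y′} → y B.⊙ y′ B.≈ B.0# → ⟨ x , y B.⊕ y′ ⟩ ∼ ⟨ x , y ⟩ ∔ ⟨ x , y′ ⟩

  algebra : MVAlgebra (a ⊔ b) (a ⊔ ℓ₁ ⊔ b ⊔ ℓ₂)
  algebra = record
    { Carrier = Term
    ; _≈_     = _∼_
    ; _⊕_     = _∔_
    ; _⋆      = _⁎
    ; 0#      = 𝟎
    ; ⊕-isCommutativeMonoid = record
      { isMonoid = record
        { isSemigroup = record
          { isMagma = record
            { isEquivalence = record { refl = ∼-refl ; sym = ∼-sym ; trans = ∼-trans }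
            ; ∙-cong = ∔-cong
            }
          ; assoc = ∔-assoc
          }
        ; identity = ∔-identityˡ , λ s → ∼-trans (∔-comm s 𝟎) (∔-identityˡ s)
        }
      ; comm = ∔-comm
      }
    ; ⋆-cong       = ⁎-cong
    ; ⋆-involutive = ⁎-involutive
    ; łukasiewicz  = ∔-łukasiewicz
    ; ⊕-zeroˡ      = ∔-zeroˡ
    }

  isBimorphism : IsBimorphism A B algebra ⟨_,_⟩
  isBimorphism = record
    { β-cong  = ⟨⟩-cong
    ; β-1     = ⟨⟩-1
    ; ∨-homoˡ = ⟨⟩-∨-homoˡ
    ; ∨-homoʳ = ⟨⟩-∨-homoʳ
    ; ∧-homoˡ = ⟨⟩-∧-homoˡ
    ; ∧-homoʳ = ⟨⟩-∧-homoʳ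
    ; +-defˡ  = ⟨⟩-+-defˡ
    ; +-homoˡ = ⟨⟩-+-homoˡ
    ; +-defʳ  = ⟨⟩-+-defʳ
    ; +-homoʳ = ⟨⟩-+-homoʳ
    }

  module Universal {c ℓ₃ : Level} (C : MVAlgebra c ℓ₃)
      {β : A.Carrier → B.Carrier → MVAlgebra.Carrier C} (bi : IsBimorphism A B C β) where
    open MVAlgebra C
    open IsBimorphism bi

    lift-to : Term → Carrier
    lift-to ⟨ x , y ⟩ = β x y
    lift-to (s ∔ t)   = lift-to s ⊕ lift-to t
    lift-to (s ⁎)     = lift-to s ⋆
    lift-to 𝟎         = 0#

    lift-cong : ∀ {s t} → s ∼ t → lift-to s ≈ lift-to t
    lift-cong ∼-refl                 = ≈-refl
    lift-cong (∼-sym p)              = ≈-sym (lift-cong p)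
    lift-cong (∼-trans p q)          = ≈-trans (lift-cong p) (lift-cong q)
    lift-cong (∔-cong p q)           = ⊕-cong (lift-cong p) (lift-cong q)
    lift-cong (⁎-cong p)             = ⋆-cong (lift-cong p)
    lift-cong (∔-assoc _ _ _)        = ⊕-assoc _ _ _
    lift-cong (∔-comm _ _)           = ⊕-comm _ _
    lift-cong (∔-identityˡ _)        = ⊕-identityˡ _
    lift-cong (⁎-involutive _)       = ⋆-involutive _
    lift-cong (∔-łukasiewicz _ _)    = łukasiewicz _ _
    lift-cong (∔-zeroˡ _)            = ⊕-zeroˡ _
    lift-cong (⟨⟩-cong p q)          = β-cong p q
    lift-cong ⟨⟩-1                   = β-1
    lift-cong (⟨⟩-∨-homoˡ _ _ _)     = ∨-homoˡ _ _ _
    lift-cong (⟨⟩-∨-homoʳ _ _ _)     = ∨-homoʳ _ _ _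
    lift-cong (⟨⟩-∧-homoˡ _ _ _)     = ∧-homoˡ _ _ _
    lift-cong (⟨⟩-∧-homoʳ _ _ _)     = ∧-homoʳ _ _ _
    lift-cong (⟨⟩-+-defˡ y p)        = +-defˡ y p
    lift-cong (⟨⟩-+-homoˡ y p)       = +-homoˡ y p
    lift-cong (⟨⟩-+-defʳ x p)        = +-defʳ x p
    lift-cong (⟨⟩-+-homoʳ x p)       = +-homoʳ x p

    factor : algebra ⟶ C
    factor = record
      { to = lift-to
      ; isHomomorphism = record
        { f-cong = lift-cong
        ; 0-homo = ≈-refl
        ; ⊕-homo = λ _ _ → ≈-refl
        ; ⋆-homo = λ _ → ≈-refl
        }
      }

    factor-commutes : ∀ x y → _⟶_.to factor ⟨ x , y ⟩ ≈ β x y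
    factor-commutes _ _ = ≈-refl

    factor-unique : (h : algebra ⟶ C) → (∀ x y → _⟶_.to h ⟨ x , y ⟩ ≈ β x y) →
                    ∀ t → _⟶_.to h t ≈ _⟶_.to factor t
    factor-unique h e ⟨ x , y ⟩ = e x y
    factor-unique h e (s ∔ t)   =
      ≈-trans (_⟶_.⊕-homo h s t) (⊕-cong (factor-unique h e s) (factor-unique h e t))
    factor-unique h e (s ⁎)     =
      ≈-trans (_⟶_.⋆-homo h s) (⋆-cong (factor-unique h e s))
    factor-unique h e 𝟎         = _⟶_.0-homo h

infixl 7 _⊗MV_ _⊗_

_⊗MV_ : ∀ {a ℓ₁ b ℓ₂ : Level} → MVAlgebra a ℓ₁ → MVAlgebra b ℓ₂ →
        MVAlgebra (a ⊔ b) (a ⊔ ℓ₁ ⊔ b ⊔ ℓ₂)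
A ⊗MV B = Tensor.algebra A B

_⊗_ : ∀ {a ℓ₁ b ℓ₂ : Level} → MVAlgebra a ℓ₁ → MVAlgebra b ℓ₂ →
      MVAlgebra (a ⊔ b) (lsuc (a ⊔ ℓ₁ ⊔ b ⊔ ℓ₂))
A ⊗ B = Quotient (A ⊗MV B) (Rad (A ⊗MV B)) (Rad-isIdeal (A ⊗MV B))

module ℚ-Lemmas where
  open Rat using (_+_; _*_; _-_; -_; _≤_; _<_; NonNegative; nonNegative; Positive; positive)
  open ℚₚ
  open +-*-Solver

  dist : ℚ → ℚ → ℚ
  dist p q = ∣ p - q ∣

  p≤∣p∣ : ∀ p → p ≤ ∣ p ∣
  p≤∣p∣ p with ≤-total 0ℚ p
  ... | inj₁ 0≤p = ≤-reflexive (sym (0≤p⇒∣p∣≡p 0≤p))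
  ... | inj₂ p≤0 = ≤-trans p≤0 (0≤∣p∣ p)

  p-q+q≡p : ∀ p q → p - q + q ≡ p
  p-q+q≡p = solve 2 (λ p q → p :+ :- q :+ q := p) refl

  p≤q+r⇒p-q≤r : ∀ {p q r} → p ≤ q + r → p - q ≤ r
  p≤q+r⇒p-q≤r {p} {q} {r} h = subst (p - q ≤_)
    (solve 2 (λ q r → q :+ r :+ :- q := r) refl q r) (+-monoˡ-≤ (- q) h)

  dist-comm : ∀ p q → dist p q ≡ dist q p
  dist-comm p q = trans (sym (∣-p∣≡∣p∣ (p - q)))
    (cong ∣_∣ (solve 2 (λ p q → :- (p :+ :- q) := q :+ :- p) refl p q))

  dist-refl : ∀ p → dist p p ≡ 0ℚ
  dist-refl p = cong ∣_∣ (+-inverseʳ p)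

  dist-triangle : ∀ p q r → dist p r ≤ dist p q + dist q r
  dist-triangle p q r = subst (λ s → ∣ s ∣ ≤ dist p q + dist q r)
    (solve 3 (λ p q r → (p :+ :- q) :+ (q :+ :- r) := p :+ :- r) refl p q r)
    (∣p+q∣≤∣p∣+∣q∣ (p - q) (q - r))

  dist-upper : ∀ p q → p ≤ q + dist p q
  dist-upper p q = subst (_≤ q + dist p q)
    (solve 2 (λ p q → q :+ (p :+ :- q) := p) refl p q)
    (+-monoʳ-≤ q (p≤∣p∣ (p - q)))

  dist-intro : ∀ {p q r} → p ≤ q + r → q ≤ p + r → dist p q ≤ r
  dist-intro {p} {q} {r} h k with ∣p∣≡p∨∣p∣≡-p (p - q)
  ... | inj₁ e = subst (_≤ r) (sym e) (p≤q+r⇒p-q≤r h)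
  ... | inj₂ e = subst (_≤ r)
    (sym (trans e (solve 2 (λ p q → :- (p :+ :- q) := q :+ :- p) refl p q))) (p≤q+r⇒p-q≤r k)

  ⊓-≤-+ : ∀ {p q r} → 0ℚ ≤ r → p ≤ q + r → p ⊓ 1ℚ ≤ q ⊓ 1ℚ + r
  ⊓-≤-+ {p} {q} {r} 0≤r h with ≤-total q 1ℚ
  ... | inj₁ q≤1 = ≤-trans (p⊓q≤p p 1ℚ) (subst (λ s → p ≤ s + r) (sym (p≤q⇒p⊓q≡p q≤1)) h)
  ... | inj₂ 1≤q = ≤-trans (p⊓q≤q p 1ℚ) (subst (λ s → 1ℚ ≤ s + r) (sym (p≥q⇒p⊓q≡q 1≤q))
                     (subst (_≤ 1ℚ + r) (+-identityʳ 1ℚ) (+-monoʳ-≤ 1ℚ 0≤r)))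

  dist-⊓ : ∀ p q → dist (p ⊓ 1ℚ) (q ⊓ 1ℚ) ≤ dist p q
  dist-⊓ p q = dist-intro
    (⊓-≤-+ {p} {q} (0≤∣p∣ (p - q)) (dist-upper p q))
    (⊓-≤-+ {q} {p} (0≤∣p∣ (p - q)) (subst (λ s → q ≤ p + s) (dist-comm q p) (dist-upper q p)))

  dist-+ : ∀ p q p′ q′ → dist (p + q) (p′ + q′) ≤ dist p p′ + dist q q′
  dist-+ p q p′ q′ = subst (λ s → ∣ s ∣ ≤ dist p p′ + dist q q′)
    (solve 4 (λ p q p′ q′ → (p :+ :- p′) :+ (q :+ :- q′) := (p :+ q) :+ :- (p′ :+ q′)) refl p q p′ q′)
    (∣p+q∣≤∣p∣+∣q∣ (p - p′) (q - q′))

  dist-1- : ∀ p q → dist (1ℚ - p) (1ℚ - q) ≡ dist p q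
  dist-1- p q = trans
    (cong ∣_∣ (solve 3 (λ o p q → (o :+ :- p) :+ :- (o :+ :- q) := q :+ :- p) refl 1ℚ p q))
    (dist-comm q p)

  dist-* : ∀ p q r → 0ℚ ≤ r → r ≤ 1ℚ → dist (p * r) (q * r) ≤ dist p q
  dist-* p q r 0≤r r≤1 = begin
    ∣ p * r - q * r ∣  ≡⟨ cong ∣_∣ (solve 3 (λ p q r → p :* r :+ :- (q :* r) := (p :+ :- q) :* r) refl p q r) ⟩
    ∣ (p - q) * r ∣    ≡⟨ ∣p*q∣≡∣p∣*∣q∣ (p - q) r ⟩
    dist p q * ∣ r ∣   ≡⟨ cong (dist p q *_) (0≤p⇒∣p∣≡p 0≤r) ⟩
    dist p q * r       ≤⟨ *-monoˡ-≤-nonNeg (dist p q) {{nonNegative (0≤∣p∣ (p - q))}} r≤1 ⟩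
    dist p q * 1ℚ      ≡⟨ *-identityʳ (dist p q) ⟩
    dist p q           ∎
    where open ≤-Reasoning

  ½*-pos : ∀ {ε} → 0ℚ < ε → 0ℚ < ½ * ε
  ½*-pos {ε} 0<ε = subst (_< ½ * ε) (*-zeroʳ ½) (*-monoʳ-<-pos ½ 0<ε)

  ½*+½* : ∀ ε → ½ * ε + ½ * ε ≡ ε
  ½*+½* ε = trans (sym (*-distribʳ-+ ε ½ ½)) (*-identityˡ ε)

  0≤+ : ∀ {p q} → 0ℚ ≤ p → 0ℚ ≤ q → 0ℚ ≤ p + q
  0≤+ {p} {q} h k = subst (_≤ p + q) (+-identityʳ 0ℚ) (+-mono-≤ h k)

  ⊓-absorb-+ : ∀ {p} q b → 0ℚ ≤ p → (p + q ⊓ b) ⊓ b ≡ (p + q) ⊓ b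
  ⊓-absorb-+ {p} q b 0≤p with ≤-total q b
  ... | inj₁ q≤b = cong (λ s → (p + s) ⊓ b) (p≤q⇒p⊓q≡p q≤b)
  ... | inj₂ b≤q = trans (cong (λ s → (p + s) ⊓ b) (p≥q⇒p⊓q≡q b≤q))
                     (trans (p≥q⇒p⊓q≡q b≤p+b) (sym (p≥q⇒p⊓q≡q (≤-trans b≤p+b (+-monoʳ-≤ p b≤q)))))
    where
    b≤p+b : b ≤ p + b
    b≤p+b = subst (_≤ p + b) (+-identityˡ b) (+-monoˡ-≤ b 0≤p)

  fromℕ : ℕ → ℚ
  fromℕ zero    = 0ℚ
  fromℕ (suc n) = 1ℚ + fromℕ n

  0≤fromℕ : ∀ n → 0ℚ ≤ fromℕ n
  0≤fromℕ zero    = ≤-refl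
  0≤fromℕ (suc n) = 0≤+ (nonNegative⁻¹ 1ℚ) (0≤fromℕ n)

  fromℕ-+ : ∀ m n → fromℕ (m ℕ.+ n) ≡ fromℕ m + fromℕ n
  fromℕ-+ zero    n = sym (+-identityˡ (fromℕ n))
  fromℕ-+ (suc m) n = trans (cong (1ℚ +_) (fromℕ-+ m n)) (sym (+-assoc 1ℚ (fromℕ m) (fromℕ n)))

  fromℕ-* : ∀ m n → fromℕ (m ℕ.* n) ≡ fromℕ m * fromℕ n
  fromℕ-* zero    n = sym (*-zeroˡ (fromℕ n))
  fromℕ-* (suc m) n = trans (fromℕ-+ n (m ℕ.* n)) (trans (cong (fromℕ n +_) (fromℕ-* m n))
    (trans (cong (_+ fromℕ m * fromℕ n) (sym (*-identityˡ (fromℕ n))))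
           (sym (*-distribʳ-+ (fromℕ n) 1ℚ (fromℕ m)))))

  1/1+ : ℕ → ℚ
  1/1+ m = ℤ.+ 1 Rat./ suc m

  private
    toℚᵘ-fromℕ : ∀ n → Rat.toℚᵘ (fromℕ n) ℚᵘ.≃ ℚᵘ.mkℚᵘ (ℤ.+ n) 0
    toℚᵘ-fromℕ zero    = ℚᵘₚ.≃-refl
    toℚᵘ-fromℕ (suc n) = ℚᵘₚ.≃-trans (toℚᵘ-homo-+ 1ℚ (fromℕ n))
      (ℚᵘₚ.≃-trans (ℚᵘₚ.+-congʳ (Rat.toℚᵘ 1ℚ) (toℚᵘ-fromℕ n))
        (ℚᵘ.*≡* (cong (ℤ._* ℤ.+ 1) (cong (λ k → ℤ.+ 1 ℤ.+ k) (ℤₚ.*-identityʳ (ℤ.+ n))))))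

    toℚᵘ-1/1+ : ∀ m → Rat.toℚᵘ (1/1+ m) ℚᵘ.≃ ℚᵘ.mkℚᵘ (ℤ.+ 1) m
    toℚᵘ-1/1+ m = toℚᵘ-fromℚᵘ (ℚᵘ.mkℚᵘ (ℤ.+ 1) m)

  fromℕ*1/1+ : ∀ m → fromℕ (suc m) * 1/1+ m ≡ 1ℚ
  fromℕ*1/1+ m = toℚᵘ-injective (ℚᵘₚ.≃-trans (toℚᵘ-homo-* (fromℕ (suc m)) (1/1+ m))
    (ℚᵘₚ.≃-trans (ℚᵘₚ.*-cong (toℚᵘ-fromℕ (suc m)) (toℚᵘ-1/1+ m))
      (ℚᵘ.*≡* (trans (ℤₚ.*-identityʳ _) (trans (ℤₚ.*-identityʳ (ℤ.+ suc m))
        (trans (cong (λ k → ℤ.+ suc k) (sym (ℕₚ.+-identityʳ m))) (sym (ℤₚ.*-identityˡ _))))))))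

  0≤1/1+ : ∀ m → 0ℚ ≤ 1/1+ m
  0≤1/1+ m = nonNegative⁻¹ (1/1+ m) {{normalize-nonNeg 1 (suc m)}}

  1/1+≤1 : ∀ m → 1/1+ m ≤ 1ℚ
  1/1+≤1 m = subst₂ _≤_ (*-identityˡ (1/1+ m)) (fromℕ*1/1+ m)
    (*-monoʳ-≤-nonNeg (1/1+ m) {{normalize-nonNeg 1 (suc m)}}
      (subst (_≤ 1ℚ + fromℕ m) (+-identityʳ 1ℚ) (+-monoʳ-≤ 1ℚ (0≤fromℕ m))))

record UnitIntervalℚ : Set where
  no-eta-equality
  constructor _,[_,_]
  field
    val : ℚ
    0≤val : 0ℚ Rat.≤ val
    val≤1 : val Rat.≤ 1ℚ

open UnitIntervalℚ public using (val; 0≤val; val≤1)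

module UnitIntervalℚ-Operations where
  open Rat using (_+_; _*_; _-_; -_; _≤_; _<_)
  open ℚₚ using
    ( ≤-refl; ≤-reflexive; ≤-trans; ≤-total; nonNegative⁻¹
    ; +-comm; +-assoc; +-identityˡ; +-identityʳ; +-inverseʳ; +-monoˡ-≤; +-monoʳ-≤
    ; *-zeroˡ; *-identityʳ; *-monoˡ-≤-nonNeg; *-monoʳ-≤-nonNeg
    ; ⊓-glb; p⊓q≤q; p≤q⇒p⊓q≡p; p≥q⇒p⊓q≡q )
  open ℚ-Lemmas
  open +-*-Solver

  infixl 6 _⊕_
  infix  8 _⋆

  _⊕_ : Op₂ UnitIntervalℚ
  val   (x ⊕ y) = (val x + val y) ⊓ 1ℚ
  0≤val (x ⊕ y) = ⊓-glb (0≤+ (0≤val x) (0≤val y)) (nonNegative⁻¹ 1ℚ)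
  val≤1 (x ⊕ y) = p⊓q≤q (val x + val y) 1ℚ

  _⋆ : Op₁ UnitIntervalℚ
  val   (x ⋆) = 1ℚ - val x
  0≤val (x ⋆) = subst (_≤ 1ℚ - val x) (+-inverseʳ (val x)) (+-monoˡ-≤ (- val x) (val≤1 x))
  val≤1 (x ⋆) = p≤q+r⇒p-q≤r {1ℚ} {val x} {1ℚ} (subst (_≤ val x + 1ℚ) (+-identityˡ 1ℚ) (+-monoˡ-≤ 1ℚ (0≤val x)))

  0# : UnitIntervalℚ
  0# = 0ℚ ,[ ≤-refl , nonNegative⁻¹ 1ℚ ]

  _/1+_ : UnitIntervalℚ → ℕ → UnitIntervalℚ
  val   (x /1+ m) = val x * 1/1+ m
  0≤val (x /1+ m) = subst (_≤ val x * 1/1+ m) (*-zeroˡ (1/1+ m))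
                      (*-monoʳ-≤-nonNeg (1/1+ m) {{Rat.nonNegative (0≤1/1+ m)}} (0≤val x))
  val≤1 (x /1+ m) = ≤-trans (*-monoˡ-≤-nonNeg (val x) {{Rat.nonNegative (0≤val x)}} (1/1+≤1 m))
                      (subst (_≤ 1ℚ) (sym (*-identityʳ (val x))) (val≤1 x))

  infix 4 _≈_

  record _≈_ (x y : UnitIntervalℚ) : Set where
    constructor val-≡
    field ≈⇒val-≡ : val x ≡ val y

  open _≈_ public

  ⊕-assoc : ∀ x y z → val ((x ⊕ y) ⊕ z) ≡ val (x ⊕ (y ⊕ z))
  ⊕-assoc x y z = begin
    ((p + q) ⊓ 1ℚ + r) ⊓ 1ℚ   ≡⟨ cong (_⊓ 1ℚ) (+-comm ((p + q) ⊓ 1ℚ) r) ⟩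
    (r + (p + q) ⊓ 1ℚ) ⊓ 1ℚ   ≡⟨ ⊓-absorb-+ (p + q) 1ℚ (0≤val z) ⟩
    (r + (p + q)) ⊓ 1ℚ        ≡⟨ cong (_⊓ 1ℚ) (trans (+-comm r (p + q)) (+-assoc p q r)) ⟩
    (p + (q + r)) ⊓ 1ℚ        ≡⟨ ⊓-absorb-+ (q + r) 1ℚ (0≤val x) ⟨
    (p + (q + r) ⊓ 1ℚ) ⊓ 1ℚ   ∎
    where
    open ≡-Reasoning
    p = val x
    q = val y
    r = val z

  ⊕-comm : ∀ x y → val (x ⊕ y) ≡ val (y ⊕ x)
  ⊕-comm x y = cong (_⊓ 1ℚ) (+-comm (val x) (val y))

  ⊕-identityˡ : ∀ x → val (0# ⊕ x) ≡ val x
  ⊕-identityˡ x = trans (cong (_⊓ 1ℚ) (+-identityˡ (val x))) (p≤q⇒p⊓q≡p (val≤1 x))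

  val-∨-≤ : ∀ x y → val x ≤ val y → val ((x ⋆ ⊕ y) ⋆ ⊕ y) ≡ val y
  val-∨-≤ x y x≤y = trans (cong (λ s → (1ℚ - s + val y) ⊓ 1ℚ) (p≥q⇒p⊓q≡q 1≤1-x+y))
                          (⊕-identityˡ y)
    where
    1≤1-x+y : 1ℚ ≤ 1ℚ - val x + val y
    1≤1-x+y = subst (_≤ 1ℚ - val x + val y) (p-q+q≡p 1ℚ (val x)) (+-monoʳ-≤ (1ℚ - val x) x≤y)

  val-∨-≥ : ∀ x y → val y ≤ val x → val ((x ⋆ ⊕ y) ⋆ ⊕ y) ≡ val x
  val-∨-≥ x y y≤x = trans (cong (λ s → (1ℚ - s + val y) ⊓ 1ℚ) (p≤q⇒p⊓q≡p 1-x+y≤1))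
    (trans (cong (_⊓ 1ℚ) (solve 3 (λ o x y → o :+ :- (o :+ :- x :+ y) :+ y := x) refl 1ℚ (val x) (val y)))
           (p≤q⇒p⊓q≡p (val≤1 x)))
    where
    1-x+y≤1 : 1ℚ - val x + val y ≤ 1ℚ
    1-x+y≤1 = subst (1ℚ - val x + val y ≤_) (p-q+q≡p 1ℚ (val x)) (+-monoʳ-≤ (1ℚ - val x) y≤x)

  łukasiewicz : ∀ x y → val ((x ⋆ ⊕ y) ⋆ ⊕ y) ≡ val ((y ⋆ ⊕ x) ⋆ ⊕ x)
  łukasiewicz x y with ≤-total (val x) (val y)
  ... | inj₁ x≤y = trans (val-∨-≤ x y x≤y) (sym (val-∨-≥ y x x≤y))
  ... | inj₂ y≤x = trans (val-∨-≥ x y y≤x) (sym (val-∨-≤ y x y≤x))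

  ⋆-involutive : ∀ x → val (x ⋆ ⋆) ≡ val x
  ⋆-involutive x = solve 2 (λ o x → o :+ :- (o :+ :- x) := x) refl 1ℚ (val x)

  ⊕-zeroˡ : ∀ x → val (0# ⋆ ⊕ x) ≡ 1ℚ
  ⊕-zeroˡ x = p≥q⇒p⊓q≡q (subst (_≤ 1ℚ + val x) (+-identityʳ 1ℚ) (+-monoʳ-≤ 1ℚ (0≤val x)))

  distQ : UnitIntervalℚ → UnitIntervalℚ → ℚ
  distQ x y = dist (val x) (val y)

  ⊕-nonexpansive : ∀ x y x′ y′ → distQ (x ⊕ y) (x′ ⊕ y′) ≤ distQ x x′ + distQ y y′
  ⊕-nonexpansive x y x′ y′ =
    ≤-trans (dist-⊓ (val x + val y) (val x′ + val y′)) (dist-+ (val x) (val y) (val x′) (val y′))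

  ⋆-nonexpansive : ∀ x y → distQ (x ⋆) (y ⋆) ≤ distQ x y
  ⋆-nonexpansive x y = ≤-reflexive (dist-1- (val x) (val y))

  /1+-nonexpansive : ∀ m x y → distQ (x /1+ m) (y /1+ m) ≤ distQ x y
  /1+-nonexpansive m x y = dist-* (val x) (val y) (1/1+ m) (0≤1/1+ m) (1/1+≤1 m)

[0,1]ℚ : MVAlgebra 0ℓ 0ℓ
[0,1]ℚ = record
  { Carrier = UnitIntervalℚ
  ; _≈_     = _≈_
  ; _⊕_     = _⊕_
  ; _⋆      = _⋆
  ; 0#      = 0#
  ; ⊕-isCommutativeMonoid = record
    { isMonoid = record
      { isSemigroup = record
        { isMagma = record
          { isEquivalence = record
            { refl  = val-≡ refl
            ; sym   = λ (val-≡ e) → val-≡ (sym e)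
            ; trans = λ (val-≡ e) (val-≡ e′) → val-≡ (trans e e′)
            }
          ; ∙-cong = λ (val-≡ e) (val-≡ e′) → val-≡ (cong₂ (λ p q → (p Rat.+ q) ⊓ 1ℚ) e e′)
          }
        ; assoc = λ x y z → val-≡ (⊕-assoc x y z)
        }
      ; identity = (λ x → val-≡ (⊕-identityˡ x))
                 , (λ x → val-≡ (trans (⊕-comm x 0#) (⊕-identityˡ x)))
      }
    ; comm = λ x y → val-≡ (⊕-comm x y)
    }
  ; ⋆-cong       = λ (val-≡ e) → val-≡ (cong (λ p → 1ℚ Rat.- p) e)
  ; ⋆-involutive = λ x → val-≡ (⋆-involutive x)
  ; łukasiewicz  = λ x y → val-≡ (łukasiewicz x y)
  ; ⊕-zeroˡ      = λ x → val-≡ (⊕-zeroˡ x)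
  }
  where open UnitIntervalℚ-Operations

-- Reals in [0,1] as Cauchy sequences in [0,1] ∩ ℚ, identified when their
-- difference tends to zero.

Eventually : Pred ℕ 0ℓ → Set
Eventually P = ∃ λ N → ∀ n → N ℕ.≤ n → P n

Eventually-zip : {P Q R : Pred ℕ 0ℓ} → (∀ n → P n → Q n → R n) →
                 Eventually P → Eventually Q → Eventually R
Eventually-zip f (M , p) (N , q) = M ℕ.⊔ N , λ n le →
  f n (p n (ℕₚ.≤-trans (ℕₚ.m≤m⊔n M N) le)) (q n (ℕₚ.≤-trans (ℕₚ.m≤n⊔m M N) le))

open UnitIntervalℚ-Operations using (distQ)

record UnitInterval : Set where
  no-eta-equality
  field
    seq    : ℕ → UnitIntervalℚ
    cauchy : ∀ ε → 0ℚ Rat.< ε →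
             ∃ λ N → ∀ m n → N ℕ.≤ m → N ℕ.≤ n → distQ (seq m) (seq n) Rat.< ε

open UnitInterval public using (seq; cauchy)

module UnitInterval-Operations where
  open Rat using (_+_; _-_; -_; _≤_; _<_)
  open ℚₚ using (≤-trans; ≤-<-trans; +-mono-<; +-mono-≤; +-monoˡ-<; +-inverseʳ)
  open ℚ-Lemmas
  module Q = UnitIntervalℚ-Operations

  infix  4 _≈_
  infixl 6 _⊕_
  infix  8 _⋆

  record _≈_ (r s : UnitInterval) : Set where
    constructor null
    field difference-null : ∀ ε → 0ℚ < ε → Eventually λ n → distQ (seq r n) (seq s n) < ε

  open _≈_ public

  -- Dist< r s ε says that ∣ r - s ∣ < ε as real numbers: a termwise strict
  -- bound would only give ∣ r - s ∣ ≤ ε in the limit.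
  record Dist< (r s : UnitInterval) (ε : ℚ) : Set where
    constructor dist<
    field
      bound   : ℚ
      bound<ε : bound < ε
      ≤bound  : Eventually λ n → distQ (seq r n) (seq s n) ≤ bound

  IsOpen : ∀ {p : Level} → Pred UnitInterval p → Set p
  IsOpen V = ∀ r → r ∈ V → ∃ λ ε → 0ℚ < ε × (∀ s → Dist< r s ε → s ∈ V)

  ≈-isEquivalence : IsEquivalence _≈_
  ≈-isEquivalence = record
    { refl  = λ {r} → null λ ε 0<ε → 0 , λ n _ → subst (_< ε) (sym (dist-refl (val (seq r n)))) 0<ε
    ; sym   = λ {r} {s} (null p) → null λ ε 0<ε → proj₁ (p ε 0<ε) , λ n le →
        subst (_< ε) (dist-comm (val (seq r n)) (val (seq s n))) (proj₂ (p ε 0<ε) n le)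
    ; trans = λ {r} {s} {t} (null p) (null q) → null λ ε 0<ε → Eventually-zip
        (λ n a b → ≤-<-trans (dist-triangle (val (seq r n)) (val (seq s n)) (val (seq t n)))
                     (subst (_ <_) (½*+½* ε) (+-mono-< a b)))
        (p (½ Rat.* ε) (½*-pos 0<ε)) (q (½ Rat.* ε) (½*-pos 0<ε))
    }

  setoid : Setoid 0ℓ 0ℓ
  setoid = record { isEquivalence = ≈-isEquivalence }

  termwise : ∀ r s → (∀ n → val (seq r n) ≡ val (seq s n)) → r ≈ s
  termwise r s e = null λ ε 0<ε → 0 , λ n _ →
    subst (_< ε) (trans (sym (dist-refl (val (seq r n)))) (cong (dist (val (seq r n))) (e n))) 0<ε

  Dist<-refl : ∀ r {ε} → 0ℚ < ε → Dist< r r ε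
  Dist<-refl r 0<ε = dist< 0ℚ 0<ε $ 0 , λ n _ → ℚₚ.≤-reflexive (dist-refl (val (seq r n)))

  ball-isOpen : ∀ r ε → IsOpen (λ s → Dist< r s ε)
  ball-isOpen r ε s (dist< δ δ<ε ev) = ε - δ , 0<ε-δ , λ t (dist< δ′ δ′<ε-δ ev′) →
      dist< (δ + δ′) (subst (δ + δ′ <_) δ+[ε-δ]≡ε (ℚₚ.+-monoʳ-< δ δ′<ε-δ)) $
      Eventually-zip
        (λ n a b → ≤-trans (dist-triangle (val (seq r n)) (val (seq s n)) (val (seq t n))) (+-mono-≤ a b))
        ev ev′
    where
    open +-*-Solver
    0<ε-δ : 0ℚ < ε - δ
    0<ε-δ = subst (_< ε - δ) (+-inverseʳ δ) (+-monoˡ-< (- δ) δ<ε)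
    δ+[ε-δ]≡ε : δ + (ε - δ) ≡ ε
    δ+[ε-δ]≡ε = solve 2 (λ δ ε → δ :+ (ε :+ :- δ) := ε) refl δ ε

  module Nonexpansive₁ (h : Op₁ UnitIntervalℚ)
      (h-nonexp : ∀ x y → distQ (h x) (h y) ≤ distQ x y) where

    map₁ : Op₁ UnitInterval
    seq    (map₁ r) n     = h (seq r n)
    cauchy (map₁ r) ε 0<ε = proj₁ (cauchy r ε 0<ε) , λ m n m≥ n≥ →
      ≤-<-trans (h-nonexp _ _) (proj₂ (cauchy r ε 0<ε) m n m≥ n≥)

    map₁-cong : Congruent _≈_ _≈_ map₁
    map₁-cong (null p) = null λ ε 0<ε → proj₁ (p ε 0<ε) , λ n le →
      ≤-<-trans (h-nonexp _ _) (proj₂ (p ε 0<ε) n le)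

    map₁-Dist< : ∀ {r s ε} → Dist< r s ε → Dist< (map₁ r) (map₁ s) ε
    map₁-Dist< (dist< δ δ<ε (N , b)) = dist< δ δ<ε $ N , λ n le → ≤-trans (h-nonexp _ _) (b n le)

  module Nonexpansive₂ (h : Op₂ UnitIntervalℚ)
      (h-nonexp : ∀ x y x′ y′ → distQ (h x y) (h x′ y′) ≤ distQ x x′ + distQ y y′) where

    map₂ : Op₂ UnitInterval
    seq    (map₂ r s) n     = h (seq r n) (seq s n)
    cauchy (map₂ r s) ε 0<ε =
      let (M , p) = cauchy r (½ Rat.* ε) (½*-pos 0<ε)
          (N , q) = cauchy s (½ Rat.* ε) (½*-pos 0<ε)
      in M ℕ.⊔ N , λ m n m≥ n≥ → ≤-<-trans (h-nonexp _ _ _ _) (subst (_ <_) (½*+½* ε) (+-mono-<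
           (p m n (ℕₚ.≤-trans (ℕₚ.m≤m⊔n M N) m≥) (ℕₚ.≤-trans (ℕₚ.m≤m⊔n M N) n≥))
           (q m n (ℕₚ.≤-trans (ℕₚ.m≤n⊔m M N) m≥) (ℕₚ.≤-trans (ℕₚ.m≤n⊔m M N) n≥))))

    map₂-cong : ∀ {r r′ s s′} → r ≈ r′ → s ≈ s′ → map₂ r s ≈ map₂ r′ s′
    map₂-cong (null p) (null q) = null λ ε 0<ε → Eventually-zip
      (λ n a b → ≤-<-trans (h-nonexp _ _ _ _) (subst (_ <_) (½*+½* ε) (+-mono-< a b)))
      (p (½ Rat.* ε) (½*-pos 0<ε)) (q (½ Rat.* ε) (½*-pos 0<ε))

    map₂-Dist< : ∀ {r r′ s s′ ε} → Dist< r r′ (½ Rat.* ε) → Dist< s s′ (½ Rat.* ε) →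
                 Dist< (map₂ r s) (map₂ r′ s′) ε
    map₂-Dist< {ε = ε} (dist< δ δ< ev) (dist< δ′ δ′< ev′) =
      dist< (δ + δ′) (subst (δ + δ′ <_) (½*+½* ε) (+-mono-< δ< δ′<)) $
      Eventually-zip (λ n a b → ≤-trans (h-nonexp _ _ _ _) (+-mono-≤ a b)) ev ev′

  module ⊕-Map     = Nonexpansive₂ Q._⊕_ Q.⊕-nonexpansive
  module ⋆-Map     = Nonexpansive₁ Q._⋆ Q.⋆-nonexpansive
  module /1+-Map m = Nonexpansive₁ (Q._/1+ m) (Q./1+-nonexpansive m)

  _⊕_ : Op₂ UnitInterval
  _⊕_ = ⊕-Map.map₂

  _⋆ : Op₁ UnitInterval
  _⋆ = ⋆-Map.map₁

  _/1+_ : UnitInterval → ℕ → UnitInterval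
  r /1+ m = /1+-Map.map₁ m r

  0# : UnitInterval
  seq    0# _       = Q.0#
  cauchy 0# ε 0<ε   = 0 , λ m n _ _ → 0<ε

-- Points form a setoid, so that quotient spaces are included.
record Space (p o : Level) : Set (lsuc (p ⊔ o)) where
  field
    points : Setoid p p
  open Setoid points public using () renaming (Carrier to Point; _≈_ to _≈ₚ_)
  field
    Open            : Pred Point p → Set o
    open-resp-≐     : ∀ {U V} → U ≐ V → Open U → Open V
    open-respects-≈ : ∀ {U} → Open U → U Respects _≈ₚ_
    open-whole      : Open (λ _ → ⊤)
    open-∩          : ∀ {U V} → Open U → Open V → Open (U ∩ V)
    open-⋃          : ∀ {I : Set p} (U : I → Pred Point p) → (∀ i → Open (U i)) → Open (⋃ I U)

  Compact : Set (lsuc p ⊔ o)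
  Compact = ∀ {I : Set p} (U : I → Pred Point p) → (∀ i → Open (U i)) →
            (∀ x → x ∈ ⋃ I U) → ∃ λ (is : List I) → ∀ x → Any (λ i → x ∈ U i) is

  Hausdorff : Set (lsuc p ⊔ o)
  Hausdorff = ∀ x y → ¬ (x ≈ₚ y) →
              ∃ λ U → ∃ λ V → Open U × Open V × x ∈ U × y ∈ V × Empty (U ∩ V)

module _ {p o : Level} (X : Space p o) where
  open Space X
  private
    module I = UnitInterval-Operations
    module Q = UnitIntervalℚ-Operations

  Continuous : (Point → UnitInterval) → Set (lsuc p ⊔ o)
  Continuous f = (V : Pred UnitInterval p) → I.IsOpen V → Open (λ x → f x ∈ V)

  record ContinuousMap : Set (lsuc p ⊔ o) where
    no-eta-equality
    field
      func       : Func points I.setoid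
      continuous : Continuous (Func.to func)
    open Func func public using () renaming (to to ⟦_⟧; cong to ⟦⟧-cong)

  open ContinuousMap

  infix 4 _≈ᶜ_

  record _≈ᶜ_ (f g : ContinuousMap) : Set p where
    constructor pointwise
    field ≈-at : ∀ x → ⟦ f ⟧ x I.≈ ⟦ g ⟧ x

  open _≈ᶜ_ public

  private
    ball : UnitInterval → ℚ → Pred UnitInterval p
    ball r ε s = Lift p (I.Dist< r s ε)

    ball-open : ∀ {f} → Continuous f → ∀ r ε → Open (λ x → f x ∈ ball r ε)
    ball-open f-cont r ε = f-cont (ball r ε) λ s (lift d) →
      let (η , 0<η , b) = I.ball-isOpen r ε s d in η , 0<η , λ t d′ → lift (b t d′)

    local⇒continuous : ∀ f →
      (∀ x ε → 0ℚ Rat.< ε → ∃ λ U → Open U × x ∈ U × (∀ {y} → y ∈ U → I.Dist< (f x) (f y) ε)) →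
      Continuous f
    local⇒continuous f loc V V-open = open-resp-≐
      ( (λ {y} ((x , fx∈V) , y∈U) →
           proj₂ (proj₂ (V-open (f x) fx∈V)) (f y) (proj₂ (proj₂ (proj₂ (nbhd x fx∈V))) y∈U))
      , (λ {y} fy∈V → (y , fy∈V) , proj₁ (proj₂ (proj₂ (nbhd y fy∈V)))))
      (open-⋃ {I = Σ Point (λ x → f x ∈ V)} (λ (x , fx∈V) → proj₁ (nbhd x fx∈V))
              (λ (x , fx∈V) → proj₁ (proj₂ (nbhd x fx∈V))))
      where
      nbhd : ∀ x (fx∈V : f x ∈ V) → _
      nbhd x fx∈V = loc x (proj₁ (V-open (f x) fx∈V)) (proj₁ (proj₂ (V-open (f x) fx∈V)))

    lift₁ : ∀ h (nonexp : ∀ x y → distQ (h x) (h y) Rat.≤ distQ x y) → Op₁ ContinuousMap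
    func       (lift₁ h nonexp f) = record
      { to   = λ x → map₁ (⟦ f ⟧ x)
      ; cong = λ e → map₁-cong (⟦⟧-cong f e)
      }
      where open I.Nonexpansive₁ h nonexp
    continuous (lift₁ h nonexp f) = local⇒continuous _ λ x ε 0<ε →
      (λ y → ⟦ f ⟧ y ∈ ball (⟦ f ⟧ x) ε) , ball-open (continuous f) (⟦ f ⟧ x) ε ,
      lift (I.Dist<-refl (⟦ f ⟧ x) 0<ε) , λ (lift d) → map₁-Dist< d
      where open I.Nonexpansive₁ h nonexp

    lift₂ : ∀ h (nonexp : ∀ x y x′ y′ → distQ (h x y) (h x′ y′) Rat.≤ distQ x x′ Rat.+ distQ y y′) →
            Op₂ ContinuousMap
    func       (lift₂ h nonexp f g) = record
      { to   = λ x → map₂ (⟦ f ⟧ x) (⟦ g ⟧ x)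
      ; cong = λ e → map₂-cong (⟦⟧-cong f e) (⟦⟧-cong g e)
      }
      where open I.Nonexpansive₂ h nonexp
    continuous (lift₂ h nonexp f g) = local⇒continuous _ λ x ε 0<ε →
      ((λ y → ⟦ f ⟧ y ∈ ball (⟦ f ⟧ x) (½ Rat.* ε)) ∩ (λ y → ⟦ g ⟧ y ∈ ball (⟦ g ⟧ x) (½ Rat.* ε))) ,
      open-∩ (ball-open (continuous f) (⟦ f ⟧ x) (½ Rat.* ε))
             (ball-open (continuous g) (⟦ g ⟧ x) (½ Rat.* ε)) ,
      (lift (I.Dist<-refl (⟦ f ⟧ x) (ℚ-Lemmas.½*-pos 0<ε)) ,
       lift (I.Dist<-refl (⟦ g ⟧ x) (ℚ-Lemmas.½*-pos 0<ε))) ,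
      λ (lift d , lift d′) → map₂-Dist< d d′
      where open I.Nonexpansive₂ h nonexp

    const0 : ContinuousMap
    func       const0 = record { to = λ _ → I.0# ; cong = λ _ → Setoid.refl I.setoid {I.0#} }
    continuous const0 = local⇒continuous _ λ x ε 0<ε →
      (λ _ → ⊤) , open-whole , _ , λ _ → I.Dist<-refl I.0# 0<ε

  ev : ContinuousMap → Point → ℕ → UnitIntervalℚ
  ev f x n = seq (⟦ f ⟧ x) n

  termwise : ∀ {f g} → (∀ x n → val (ev f x n) ≡ val (ev g x n)) → f ≈ᶜ g
  termwise {f} {g} e = pointwise λ x → I.termwise (⟦ f ⟧ x) (⟦ g ⟧ x) (e x)

  -- divide f m is f / (m + 1).
  divide : ContinuousMap → ℕ → ContinuousMap
  divide f m = lift₁ (Q._/1+ m) (Q./1+-nonexpansive m) f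

  divide-cong : ∀ {f g} m → f ≈ᶜ g → divide f m ≈ᶜ divide g m
  divide-cong {f} {g} m (pointwise e) =
    pointwise λ x → I./1+-Map.map₁-cong m {⟦ f ⟧ x} {⟦ g ⟧ x} (e x)

  C : MVAlgebra (lsuc p ⊔ o) p
  C = record
    { Carrier = ContinuousMap
    ; _≈_     = _≈ᶜ_
    ; _⊕_     = lift₂ Q._⊕_ Q.⊕-nonexpansive
    ; _⋆      = lift₁ Q._⋆ Q.⋆-nonexpansive
    ; 0#      = const0
    ; ⊕-isCommutativeMonoid = record
      { isMonoid = record
        { isSemigroup = record
          { isMagma = record
            { isEquivalence = record
              { refl  = pointwise λ x → Setoid.refl I.setoid
              ; sym   = λ (pointwise e) → pointwise λ x → Setoid.sym I.setoid (e x)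
              ; trans = λ (pointwise e) (pointwise e′) →
                  pointwise λ x → Setoid.trans I.setoid (e x) (e′ x)
              }
            ; ∙-cong = λ (pointwise e) (pointwise e′) →
                pointwise λ x → I.⊕-Map.map₂-cong (e x) (e′ x)
            }
          ; assoc = λ f g h → termwise λ x n → Q.⊕-assoc (ev f x n) (ev g x n) (ev h x n)
          }
        ; identity = (λ f → termwise λ x n → Q.⊕-identityˡ (ev f x n))
                   , (λ f → termwise λ x n →
                        trans (Q.⊕-comm (ev f x n) Q.0#) (Q.⊕-identityˡ (ev f x n)))
        }
      ; comm = λ f g → termwise λ x n → Q.⊕-comm (ev f x n) (ev g x n)
      }
    ; ⋆-cong       = λ (pointwise e) → pointwise λ x → I.⋆-Map.map₁-cong (e x)
    ; ⋆-involutive = λ f → termwise λ x n → Q.⋆-involutive (ev f x n)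
    ; łukasiewicz  = λ f g → termwise λ x n → Q.łukasiewicz (ev f x n) (ev g x n)
    ; ⊕-zeroˡ      = λ f → termwise λ x n → Q.⊕-zeroˡ (ev f x n)
    }

repeat : ∀ {a : Level} {A : Set a} {n} m → Vec A n → Vec A (n ℕ.* m)
repeat m []       = []
repeat m (x ∷ xs) = replicate m x ++ repeat m xs

module Related {a ℓ₁ b ℓ₂ r : Level} (A : MVAlgebra a ℓ₁) (B : MVAlgebra b ℓ₂)
    (R : MVAlgebra.Carrier A → MVAlgebra.Carrier B → Set r)
    (0-rel : R (MVAlgebra.0# A) (MVAlgebra.0# B))
    (⋆-rel : ∀ {x y} → R x y → R (MVAlgebra._⋆ A x) (MVAlgebra._⋆ B y))
    (⊕-rel : ∀ {x y x′ y′} → R x y → R x′ y′ → R (MVAlgebra._⊕_ A x x′) (MVAlgebra._⊕_ B y y′))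
    where
  private
    module A = MVAlgebra A
    module B = MVAlgebra B
    module AP = MVProperties A
    module BP = MVProperties B

  ⨁-rel : ∀ {n} {xs : Vec A.Carrier n} {ys : Vec B.Carrier n} → Pointwise R xs ys → R (A.⨁ xs) (B.⨁ ys)
  ⨁-rel []       = 0-rel
  ⨁-rel (p ∷ ps) = ⊕-rel p (⨁-rel ps)

  map-⋆-rel : ∀ {n} {xs : Vec A.Carrier n} {ys : Vec B.Carrier n} → Pointwise R xs ys →
              Pointwise R (Vec.map A._⋆ xs) (Vec.map B._⋆ ys)
  map-⋆-rel []       = []
  map-⋆-rel (p ∷ ps) = ⋆-rel p ∷ map-⋆-rel ps

  carry-rel : ∀ {n x y} {xs : Vec A.Carrier n} {ys : Vec B.Carrier n} → Pointwise R xs ys → R x y →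
              Pointwise R (AP.carry xs x) (BP.carry ys y)
  carry-rel []       q = []
  carry-rel (p ∷ ps) q = ⊕-rel p q ∷ carry-rel ps (⋆-rel (⊕-rel (⋆-rel p) (⋆-rel q)))

  carries-rel : ∀ {m n} {xs : Vec A.Carrier m} {ys : Vec B.Carrier m}
                {us : Vec A.Carrier n} {vs : Vec B.Carrier n} →
                Pointwise R xs ys → Pointwise R us vs →
                Pointwise R (AP.carries xs us) (BP.carries ys vs)
  carries-rel ps []       = ps
  carries-rel ps (q ∷ qs) = carries-rel (carry-rel ps q) qs

  repeat-rel : ∀ {n} m {xs : Vec A.Carrier n} {ys : Vec B.Carrier n} → Pointwise R xs ys →
               Pointwise R (repeat m xs) (repeat m ys)
  repeat-rel m []       = []
  repeat-rel m (p ∷ ps) = ++⁺ (replicate-rel m p) (repeat-rel m ps)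
    where
    replicate-rel : ∀ m {x y} → R x y → Pointwise R (replicate m x) (replicate m y)
    replicate-rel zero    p = []
    replicate-rel (suc m) p = p ∷ replicate-rel m p

module ℚ-Sums where
  open Rat using (_+_; _*_; _-_; -_; _≤_)
  open ℚₚ using
    ( ≤-refl; ≤-trans; ≤-total; nonNegative⁻¹
    ; +-identityˡ; +-identityʳ; +-comm; +-assoc; +-mono-≤; +-monoʳ-≤; +-monoˡ-≤; +-inverseʳ
    ; *-zeroˡ; *-zeroʳ; *-identityˡ; *-identityʳ; *-assoc; *-comm; *-distribˡ-+; *-distribʳ-+
    ; *-monoʳ-≤-nonNeg; *-distribʳ-⊓-nonNeg
    ; p≤q⇒p⊓q≡p; p≥q⇒p⊓q≡q; mono-≤-distrib-⊓; normalize-nonNeg )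
  open ℚ-Lemmas
  open UnitIntervalℚ-Operations using (_⊕_; _⋆; _/1+_)
  open MVAlgebra [0,1]ℚ using (⨁; _⊙_)
  open MVProperties [0,1]ℚ using (carry; carries)
  open +-*-Solver

  sum : ∀ {n} → Vec UnitIntervalℚ n → ℚ
  sum []       = 0ℚ
  sum (x ∷ xs) = val x + sum xs

  0≤sum : ∀ {n} (xs : Vec UnitIntervalℚ n) → 0ℚ ≤ sum xs
  0≤sum []       = ≤-refl
  0≤sum (x ∷ xs) = 0≤+ (0≤val x) (0≤sum xs)

  sum≤ : ∀ {n} (xs : Vec UnitIntervalℚ n) → sum xs ≤ fromℕ n
  sum≤ []       = ≤-refl
  sum≤ (x ∷ xs) = +-mono-≤ (val≤1 x) (sum≤ xs)

  val-⨁ : ∀ {n} (xs : Vec UnitIntervalℚ n) → val (⨁ xs) ≡ sum xs ⊓ 1ℚ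
  val-⨁ []       = refl
  val-⨁ (x ∷ xs) = trans (cong (λ s → (val x + s) ⊓ 1ℚ) (val-⨁ xs)) (⊓-absorb-+ (sum xs) 1ℚ (0≤val x))

  sum-/1+ : ∀ m {n} (xs : Vec UnitIntervalℚ n) → sum (Vec.map (_/1+ m) xs) ≡ sum xs * 1/1+ m
  sum-/1+ m []       = sym (*-zeroˡ (1/1+ m))
  sum-/1+ m (x ∷ xs) = trans (cong (val x * 1/1+ m +_) (sum-/1+ m xs))
                             (sym (*-distribʳ-+ (1/1+ m) (val x) (sum xs)))

  val-⨁-/1+ : ∀ m (xs : Vec UnitIntervalℚ (suc m)) → val (⨁ (Vec.map (_/1+ m) xs)) ≡ sum xs * 1/1+ m
  val-⨁-/1+ m xs = trans (val-⨁ (Vec.map (_/1+ m) xs)) (trans (cong (_⊓ 1ℚ) (sum-/1+ m xs))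
    (p≤q⇒p⊓q≡p (subst (sum xs * 1/1+ m ≤_) (fromℕ*1/1+ m)
      (*-monoʳ-≤-nonNeg (1/1+ m) {{normalize-nonNeg 1 (suc m)}} (sum≤ xs)))))

  sum-⋆ : ∀ {n} (xs : Vec UnitIntervalℚ n) → sum (Vec.map _⋆ xs) ≡ fromℕ n - sum xs
  sum-⋆ []               = refl
  sum-⋆ {suc n} (x ∷ xs) = trans (cong (1ℚ - val x +_) (sum-⋆ xs))
    (solve 4 (λ o x n s → (o :+ :- x) :+ (n :+ :- s) := (o :+ n) :+ :- (x :+ s)) refl
       1ℚ (val x) (fromℕ n) (sum xs))

  sum-++ : ∀ {m n} (xs : Vec UnitIntervalℚ m) (ys : Vec UnitIntervalℚ n) →
           sum (xs ++ ys) ≡ sum xs + sum ys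
  sum-++ []       ys = sym (+-identityˡ (sum ys))
  sum-++ (x ∷ xs) ys = trans (cong (val x +_) (sum-++ xs ys)) (sym (+-assoc (val x) (sum xs) (sum ys)))

  sum-replicate : ∀ m x → sum (replicate m x) ≡ fromℕ m * val x
  sum-replicate zero    x = sym (*-zeroˡ (val x))
  sum-replicate (suc m) x = trans (cong₂ _+_ (sym (*-identityˡ (val x))) (sum-replicate m x))
                                  (sym (*-distribʳ-+ (val x) 1ℚ (fromℕ m)))

  sum-repeat : ∀ m {n} (xs : Vec UnitIntervalℚ n) → sum (repeat m xs) ≡ fromℕ m * sum xs
  sum-repeat m []       = sym (*-zeroʳ (fromℕ m))
  sum-repeat m (x ∷ xs) = trans (sum-++ (replicate m x) (repeat m xs))
    (trans (cong₂ _+_ (sum-replicate m x) (sum-repeat m xs)) (sym (*-distribˡ-+ (fromℕ m) (val x) (sum xs))))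

  val-⊕+⊙ : ∀ x y → val (x ⊕ y) + val (x ⊙ y) ≡ val x + val y
  val-⊕+⊙ x y with ≤-total (val x + val y) 1ℚ
  ... | inj₁ h = trans
    (cong₂ _+_ (p≤q⇒p⊓q≡p h) (cong (λ s → 1ℚ - s) (p≥q⇒p⊓q≡q 1≤)))
    (trans (cong (val x + val y +_) (+-inverseʳ 1ℚ)) (+-identityʳ _))
    where
    1≤ : 1ℚ ≤ (1ℚ - val x) + (1ℚ - val y)
    1≤ = subst₂ _≤_
      (solve 3 (λ o x y → (x :+ y) :+ (o :+ :- x :+ :- y) := o) refl 1ℚ (val x) (val y))
      (solve 3 (λ o x y → o :+ (o :+ :- x :+ :- y) := (o :+ :- x) :+ (o :+ :- y)) refl 1ℚ (val x) (val y))
      (+-monoˡ-≤ (1ℚ - val x - val y) h)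
  ... | inj₂ h = trans
    (cong₂ _+_ (p≥q⇒p⊓q≡q h) (cong (λ s → 1ℚ - s) (p≤q⇒p⊓q≡p ≤1)))
    (solve 3 (λ o x y → o :+ (o :+ :- ((o :+ :- x) :+ (o :+ :- y))) := x :+ y) refl 1ℚ (val x) (val y))
    where
    ≤1 : (1ℚ - val x) + (1ℚ - val y) ≤ 1ℚ
    ≤1 = subst₂ _≤_
      (solve 3 (λ o x y → o :+ (o :+ :- x :+ :- y) := (o :+ :- x) :+ (o :+ :- y)) refl 1ℚ (val x) (val y))
      (solve 3 (λ o x y → (x :+ y) :+ (o :+ :- x :+ :- y) := o) refl 1ℚ (val x) (val y))
      (+-monoˡ-≤ (1ℚ - val x - val y) h)

  +-distribˡ-⊓ : ∀ p q r → p + q ⊓ r ≡ (p + q) ⊓ (p + r)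
  +-distribˡ-⊓ p = mono-≤-distrib-⊓ (+-monoʳ-≤ p)

  sum-carry : ∀ {n} (xs : Vec UnitIntervalℚ n) v → sum (carry xs v) ≡ (sum xs + val v) ⊓ fromℕ n
  sum-carry []               v = sym (p≥q⇒p⊓q≡q (0≤+ ≤-refl (0≤val v)))
  sum-carry {suc n} (x ∷ xs) v = begin
    p + sum (carry xs (x ⊙ v))                  ≡⟨ cong (p +_) (sum-carry xs (x ⊙ v)) ⟩
    p + (s + val (x ⊙ v)) ⊓ k                   ≡⟨ +-distribˡ-⊓ p (s + val (x ⊙ v)) k ⟩
    (p + (s + val (x ⊙ v))) ⊓ (p + k)           ≡⟨ cong (_⊓ (p + k)) total ⟩
    t ⊓ (p + k)                                 ≡⟨ final ⟩
    t ⊓ (1ℚ + k)                                ∎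
    where
    open ≡-Reasoning
    p = val (x ⊕ v)
    s = sum xs
    k = fromℕ n
    t = val x + s + val v
    total : p + (s + val (x ⊙ v)) ≡ t
    total = trans (solve 3 (λ p s q → p :+ (s :+ q) := (p :+ q) :+ s) refl p s (val (x ⊙ v)))
      (trans (cong (_+ s) (val-⊕+⊙ x v))
             (solve 3 (λ x v s → (x :+ v) :+ s := (x :+ s) :+ v) refl (val x) (val v) s))
    final : t ⊓ (p + k) ≡ t ⊓ (1ℚ + k)
    final with ≤-total (val x + val v) 1ℚ
    ... | inj₂ h = cong (λ q → t ⊓ (q + k)) (p≥q⇒p⊓q≡q h)
    ... | inj₁ h = trans (p≤q⇒p⊓q≡p t≤p+k)
                     (sym (p≤q⇒p⊓q≡p (≤-trans t≤p+k (+-monoˡ-≤ k (val≤1 (x ⊕ v))))))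
      where
      t≤p+k : t ≤ p + k
      t≤p+k = subst₂ _≤_ (solve 3 (λ x v s → (x :+ v) :+ s := (x :+ s) :+ v) refl (val x) (val v) s)
        (cong (_+ k) (sym (p≤q⇒p⊓q≡p h))) (+-monoʳ-≤ (val x + val v) (sum≤ xs))

  sum-carries : ∀ {m n} (xs : Vec UnitIntervalℚ m) (vs : Vec UnitIntervalℚ n) →
                sum (carries xs vs) ≡ (sum xs + sum vs) ⊓ fromℕ m
  sum-carries xs [] = sym (trans (cong (_⊓ _) (+-identityʳ (sum xs))) (p≤q⇒p⊓q≡p (sum≤ xs)))
  sum-carries {m} xs (v ∷ vs) = begin
    sum (carries (carry xs v) vs)                           ≡⟨ sum-carries (carry xs v) vs ⟩
    (sum (carry xs v) + sum vs) ⊓ fromℕ m                   ≡⟨ cong (λ s → (s + sum vs) ⊓ fromℕ m) (sum-carry xs v) ⟩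
    ((sum xs + val v) ⊓ fromℕ m + sum vs) ⊓ fromℕ m         ≡⟨ cong (_⊓ fromℕ m) (+-comm _ (sum vs)) ⟩
    (sum vs + (sum xs + val v) ⊓ fromℕ m) ⊓ fromℕ m         ≡⟨ ⊓-absorb-+ (sum xs + val v) (fromℕ m) (0≤sum vs) ⟩
    (sum vs + (sum xs + val v)) ⊓ fromℕ m                   ≡⟨ cong (_⊓ fromℕ m) (solve 3 (λ x v s → s :+ (x :+ v) := x :+ (v :+ s)) refl (sum xs) (val v) (sum vs)) ⟩
    (sum xs + (val v + sum vs)) ⊓ fromℕ m                   ∎
    where open ≡-Reasoning

  -- suc m * suc k reduces to suc (k + m * suc k).
  1/1+-* : ∀ m k → fromℕ (suc k) * 1/1+ (k ℕ.+ m ℕ.* suc k) ≡ 1/1+ m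
  1/1+-* m k = begin
    b * c                 ≡⟨ *-identityˡ (b * c) ⟨
    1ℚ * (b * c)          ≡⟨ cong (_* (b * c)) (fromℕ*1/1+ m) ⟨
    (a * d) * (b * c)     ≡⟨ solve 4 (λ a b c d → (a :* d) :* (b :* c) := ((a :* b) :* c) :* d) refl a b c d ⟩
    ((a * b) * c) * d     ≡⟨ cong (λ e → (e * c) * d) (fromℕ-* (suc m) (suc k)) ⟨
    (fromℕ (suc m ℕ.* suc k) * c) * d ≡⟨ cong (_* d) (fromℕ*1/1+ (k ℕ.+ m ℕ.* suc k)) ⟩
    1ℚ * d                ≡⟨ *-identityˡ d ⟩
    d                     ∎
    where
    open ≡-Reasoning
    a = fromℕ (suc m)
    b = fromℕ (suc k)
    c = 1/1+ (k ℕ.+ m ℕ.* suc k)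
    d = 1/1+ m

  mean-⋆ : ∀ m (xs : Vec UnitIntervalℚ (suc m)) →
           val (⨁ (Vec.map (_/1+ m) xs) ⋆) ≡ val (⨁ (Vec.map (_/1+ m) (Vec.map _⋆ xs)))
  mean-⋆ m xs = begin
    1ℚ - val (⨁ (Vec.map (_/1+ m) xs))          ≡⟨ cong (λ s → 1ℚ - s) (val-⨁-/1+ m xs) ⟩
    1ℚ - sum xs * c                             ≡⟨ cong (λ s → s - sum xs * c) (fromℕ*1/1+ m) ⟨
    n * c - sum xs * c                          ≡⟨ solve 3 (λ n s c → n :* c :+ :- (s :* c) := (n :+ :- s) :* c) refl n (sum xs) c ⟩
    (n - sum xs) * c                            ≡⟨ cong (_* c) (sum-⋆ xs) ⟨
    sum (Vec.map _⋆ xs) * c                     ≡⟨ val-⨁-/1+ m (Vec.map _⋆ xs) ⟨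
    val (⨁ (Vec.map (_/1+ m) (Vec.map _⋆ xs)))  ∎
    where
    open ≡-Reasoning
    c = 1/1+ m
    n = fromℕ (suc m)

  mean-⊕ : ∀ m k (xs : Vec UnitIntervalℚ (suc m)) (ys : Vec UnitIntervalℚ (suc k)) →
           val (⨁ (Vec.map (_/1+ m) xs) ⊕ ⨁ (Vec.map (_/1+ k) ys)) ≡
           val (⨁ (Vec.map (_/1+ (k ℕ.+ m ℕ.* suc k)) (carries (repeat (suc k) xs) (repeat (suc m) ys))))
  mean-⊕ m k xs ys = sym (begin
    val (⨁ (Vec.map (_/1+ K) zs))             ≡⟨ val-⨁-/1+ K zs ⟩
    sum zs * c                                ≡⟨ cong (_* c) (sum-carries (repeat (suc k) xs) (repeat (suc m) ys)) ⟩
    ((u + v) ⊓ fromℕ (suc K)) * c             ≡⟨ *-distribʳ-⊓-nonNeg c {{normalize-nonNeg 1 (suc K)}} (u + v) (fromℕ (suc K)) ⟩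
    ((u + v) * c) ⊓ (fromℕ (suc K) * c)       ≡⟨ cong₂ _⊓_ (*-distribʳ-+ c u v) (fromℕ*1/1+ K) ⟩
    (u * c + v * c) ⊓ 1ℚ                      ≡⟨ cong (_⊓ 1ℚ) (cong₂ _+_ eq₁ eq₂) ⟩
    (val (⨁ (Vec.map (_/1+ m) xs)) + val (⨁ (Vec.map (_/1+ k) ys))) ⊓ 1ℚ ∎)
    where
    open ≡-Reasoning
    K = k ℕ.+ m ℕ.* suc k
    c = 1/1+ K
    zs = carries (repeat (suc k) xs) (repeat (suc m) ys)
    u = sum (repeat (suc k) xs)
    v = sum (repeat (suc m) ys)
    move : ∀ a s → (a * s) * c ≡ s * (a * c)
    move a s = solve 3 (λ a s c → (a :* s) :* c := s :* (a :* c)) refl a s c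
    swap : 1/1+ (m ℕ.+ k ℕ.* suc m) ≡ c
    swap = cong (λ j → 1/1+ (ℕ.pred j)) (ℕₚ.*-comm (suc k) (suc m))
    eq₁ : u * c ≡ val (⨁ (Vec.map (_/1+ m) xs))
    eq₁ = trans (cong (_* c) (sum-repeat (suc k) xs)) (trans (move (fromℕ (suc k)) (sum xs))
      (trans (cong (sum xs *_) (1/1+-* m k)) (sym (val-⨁-/1+ m xs))))
    eq₂ : v * c ≡ val (⨁ (Vec.map (_/1+ k) ys))
    eq₂ = trans (cong (_* c) (sum-repeat (suc m) ys)) (trans (move (fromℕ (suc m)) (sum ys))
      (trans (cong (sum ys *_) (trans (cong (fromℕ (suc m) *_) (sym swap)) (1/1+-* k m)))
             (sym (val-⨁-/1+ k ys))))

record IsSubalgebra {c ℓ p : Level} (A : MVAlgebra c ℓ) (S : Pred (MVAlgebra.Carrier A) p) :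
    Set (c ⊔ ℓ ⊔ p) where
  open MVAlgebra A
  field
    0∈       : 0# ∈ S
    ⊕-closed : ∀ {x y} → x ∈ S → y ∈ S → x ⊕ y ∈ S
    ⋆-closed : ∀ {x} → x ∈ S → x ⋆ ∈ S

Subalgebra : ∀ {c ℓ p : Level} (A : MVAlgebra c ℓ) (S : Pred (MVAlgebra.Carrier A) p) →
             IsSubalgebra A S → MVAlgebra (c ⊔ p) ℓ
Subalgebra A S isSubalgebra = record
  { Carrier = Σ Carrier S
  ; _≈_     = λ (x , _) (y , _) → x ≈ y
  ; _⊕_     = λ (x , p) (y , q) → x ⊕ y , ⊕-closed p q
  ; _⋆      = λ (x , p) → x ⋆ , ⋆-closed p
  ; 0#      = 0# , 0∈
  ; ⊕-isCommutativeMonoid = record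
    { isMonoid = record
      { isSemigroup = record
        { isMagma = record
          { isEquivalence = record { refl = ≈-refl ; sym = ≈-sym ; trans = ≈-trans }
          ; ∙-cong = ⊕-cong
          }
        ; assoc = λ (x , _) (y , _) (z , _) → ⊕-assoc x y z
        }
      ; identity = (λ (x , _) → ⊕-identityˡ x) , (λ (x , _) → ⊕-identityʳ x)
      }
    ; comm = λ (x , _) (y , _) → ⊕-comm x y
    }
  ; ⋆-cong       = ⋆-cong
  ; ⋆-involutive = λ (x , _) → ⋆-involutive x
  ; łukasiewicz  = λ (x , _) (y , _) → łukasiewicz x y
  ; ⊕-zeroˡ      = λ (x , _) → ⊕-zeroˡ x
  }
  where
  open MVAlgebra A
  open IsSubalgebra isSubalgebra

module _ {c ℓ p o : Level} (A : MVAlgebra c ℓ) (X : Space p o) (ι : A ↪ C X) where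
  private
    module A  = MVAlgebra A
    module AP = MVProperties A
    module CX = MVAlgebra (C X)
    module CP = MVProperties (C X)
    module Q  = UnitIntervalℚ-Operations
    module I  = UnitInterval-Operations
    open _↪_ ι

  -- f = a₁/n + … + aₙ/n with n = m + 1. Every summand is at most 1/n, so ⊕
  -- never truncates here and ⨁ is the iterated partial sum.
  InDivisibleHull : Pred (ContinuousMap X) (c ⊔ p)
  InDivisibleHull f = ∃ λ m → ∃ λ (as : Vec A.Carrier (suc m)) →
    f CX.≈ CX.⨁ (Vec.map (λ a → divide X (to a) m) as)

  private
    _∕_ : ContinuousMap X → ℕ → ContinuousMap X
    _∕_ = divide X

    Image : A.Carrier → ContinuousMap X → Set p
    Image a f = to a CX.≈ f

    module Im = Related A (C X) Image 0-homo
      (λ {a} e → CX.≈-trans (⋆-homo a) (CX.⋆-cong e))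
      (λ {a} {_} {b} e e′ → CX.≈-trans (⊕-homo a b) (CX.⊕-cong e e′))

    module ≈Rel = Related (C X) (C X) CX._≈_ CX.≈-refl CX.⋆-cong CX.⊕-cong

    images : ∀ {n} (as : Vec A.Carrier n) → Pointwise Image as (Vec.map to as)
    images []       = []
    images (a ∷ as) = CX.≈-refl ∷ images as

    mean-image : ∀ m {n} {as : Vec A.Carrier n} {fs : Vec (ContinuousMap X) n} → Pointwise Image as fs →
                 CX.⨁ (Vec.map (λ a → to a ∕ m) as) CX.≈ CX.⨁ (Vec.map (_∕ m) fs)
    mean-image m ps = ≈Rel.⨁-rel (go ps)
      where
      go : ∀ {n} {as : Vec A.Carrier n} {fs : Vec (ContinuousMap X) n} → Pointwise Image as fs →
           Pointwise CX._≈_ (Vec.map (λ a → to a ∕ m) as) (Vec.map (_∕ m) fs)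
      go []       = []
      go (e ∷ ps) = divide-cong X m e ∷ go ps

    module At (x : Space.Point X) (n : ℕ) where
      Value : ContinuousMap X → UnitIntervalℚ → Set
      Value f q = val (ev X f x n) ≡ val q

      open Related (C X) [0,1]ℚ Value refl
        (cong (λ p → 1ℚ Rat.- p)) (cong₂ (λ p q → (p Rat.+ q) ⊓ 1ℚ)) public

      values : ∀ {k} (fs : Vec (ContinuousMap X) k) → Pointwise Value fs (Vec.map (λ f → ev X f x n) fs)
      values []       = []
      values (f ∷ fs) = refl ∷ values fs

      mean-value : ∀ m {k} {fs : Vec (ContinuousMap X) k} {qs : Vec UnitIntervalℚ k} → Pointwise Value fs qs →
                   Value (CX.⨁ (Vec.map (_∕ m) fs)) (MVAlgebra.⨁ [0,1]ℚ (Vec.map (Q._/1+ m) qs))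
      mean-value m ps = ⨁-rel (go ps)
        where
        go : ∀ {k} {fs : Vec (ContinuousMap X) k} {qs : Vec UnitIntervalℚ k} → Pointwise Value fs qs →
             Pointwise Value (Vec.map (_∕ m) fs) (Vec.map (Q._/1+ m) qs)
        go []       = []
        go (e ∷ ps) = cong (λ p → p Rat.* ℚ-Lemmas.1/1+ m) e ∷ go ps

    mean-⋆ : ∀ m (fs : Vec (ContinuousMap X) (suc m)) →
             (CX.⨁ (Vec.map (_∕ m) fs)) CX.⋆ CX.≈ CX.⨁ (Vec.map (_∕ m) (Vec.map CX._⋆ fs))
    mean-⋆ m fs = termwise X λ x n → let open At x n in
      trans (cong (λ p → 1ℚ Rat.- p) (mean-value m (values fs)))
        (trans (ℚ-Sums.mean-⋆ m (Vec.map (λ f → ev X f x n) fs))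
               (sym (mean-value m (map-⋆-rel (values fs)))))

    mean-⊕ : ∀ m k (fs : Vec (ContinuousMap X) (suc m)) (gs : Vec (ContinuousMap X) (suc k)) →
             CX.⨁ (Vec.map (_∕ m) fs) CX.⊕ CX.⨁ (Vec.map (_∕ k) gs) CX.≈
             CX.⨁ (Vec.map (_∕ (k ℕ.+ m ℕ.* suc k)) (CP.carries (repeat (suc k) fs) (repeat (suc m) gs)))
    mean-⊕ m k fs gs = termwise X λ x n → let open At x n in
      trans (cong₂ (λ p q → (p Rat.+ q) ⊓ 1ℚ) (mean-value m (values fs)) (mean-value k (values gs)))
        (trans (ℚ-Sums.mean-⊕ m k (Vec.map (λ f → ev X f x n) fs) (Vec.map (λ f → ev X f x n) gs))
               (sym (mean-value (k ℕ.+ m ℕ.* suc k)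
                 (carries-rel (repeat-rel (suc k) (values fs)) (repeat-rel (suc m) (values gs))))))

  InDivisibleHull-isSubalgebra : IsSubalgebra (C X) InDivisibleHull
  InDivisibleHull-isSubalgebra = record
    { 0∈       = 0 , (A.0# ∷ []) , CX.≈-trans 0≈mean (CX.≈-sym (mean-image 0 (0-homo ∷ [])))
    ; ⊕-closed = λ (m , as , e) (k , bs , e′) →
        k ℕ.+ m ℕ.* suc k , AP.carries (repeat (suc k) as) (repeat (suc m) bs) ,
        CX.≈-trans (CX.⊕-cong (CX.≈-trans e (mean-image m (images as)))
                              (CX.≈-trans e′ (mean-image k (images bs))))
          (CX.≈-trans (mean-⊕ m k (Vec.map to as) (Vec.map to bs))
            (CX.≈-sym (mean-image (k ℕ.+ m ℕ.* suc k)
              (Im.carries-rel (Im.repeat-rel (suc k) (images as)) (Im.repeat-rel (suc m) (images bs))))))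
    ; ⋆-closed = λ (m , as , e) → m , Vec.map A._⋆ as ,
        CX.≈-trans (CX.⋆-cong (CX.≈-trans e (mean-image m (images as))))
          (CX.≈-trans (mean-⋆ m (Vec.map to as)) (CX.≈-sym (mean-image m (Im.map-⋆-rel (images as)))))
    }
    where
    0≈mean : CX.0# CX.≈ CX.⨁ (Vec.map (_∕ 0) (CX.0# ∷ []))
    0≈mean = termwise X λ x n → refl

  DivisibleHull : MVAlgebra (c ⊔ lsuc p ⊔ o) p
  DivisibleHull = Subalgebra (C X) InDivisibleHull InDivisibleHull-isSubalgebra

{-# OPTIONS --safe #-}
-- Let T be the MV-algebra presented by the universal bimorphism on [0,1]ℚ × A.
-- In T every element equals ⟨1/n, a₁⟩ + … + ⟨1/n, aₙ⟩: such sums are closed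
-- under ⋆, being complementary to the sum of the ⟨1/n, aᵢ⋆⟩, and under ⊕, since
-- carrying v into a₁, …, aₙ preserves the sum and what overflows at the end is
-- disjoint from the complement of the result, hence absorbed.
-- The bimorphism (q, a) ↦ q · ι(a) into C(X) therefore induces a map of T onto
-- the divisible hull. It is injective already before passing to the quotient
-- by Rad: carrying a₁, …, aₙ into zeros yields the staircase whose i-th entry
-- is the part of a₁ + … + aₙ between i - 1 and i; since ι is injective, it is
-- determined by the image of the sum. The map factors through the quotient
-- because evaluation at a point is a homomorphism to [0,1], whose kernel is a
-- maximal ideal.
module Submission where

open import Defs
import Algebra.Properties.Group as GroupProperties
open import Level using (Level; Lift; lift; lower; 0ℓ) renaming (_⊔_ to _⊔ˡ_)
open import Data.Empty using (⊥-elim)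
open import Data.Fin.Base using (zero; suc)
open import Data.Integer.Base as ℤ using ()
import Data.Integer.Properties as ℤₚ
open import Data.Nat.Base as ℕ using (ℕ; zero; suc)
import Data.Nat.Properties as ℕₚ
open import Data.Product.Base using (∃; _×_; _,_; proj₁; proj₂)
open import Data.Rational.Base as Rat using (ℚ; 0ℚ; 1ℚ; ½; _⊓_; _⊔_; mkℚ)
import Data.Rational.Properties as ℚₚ
open import Data.Rational.Solver using (module +-*-Solver)
import Data.Rational.Unnormalised.Base as ℚᵘ
import Data.Rational.Unnormalised.Properties as ℚᵘₚ
open import Data.Sum.Base using (inj₁; inj₂)
open import Data.Vec.Base as Vec using (Vec; []; _∷_; lookup; replicate; _++_)
open import Data.Vec.Relation.Binary.Pointwise.Inductive as Pointwise using (Pointwise; []; _∷_)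
open import Data.Vec.Relation.Unary.All using (All; []; _∷_)
open import Relation.Binary.PropositionalEquality
  using (_≡_; refl; sym; trans; cong; cong₂; subst; module ≡-Reasoning)
import Relation.Binary.Reasoning.Setoid as ≈-Reasoning
open import Relation.Nullary using (¬_; yes; no)
open import Relation.Unary using (Pred; _∈_)

-- Order, partial sums and disjointness in an MV-algebra.

module MVOrder {c ℓ : Level} (A : MVAlgebra c ℓ) where
  open MVAlgebra A
  open MVProperties A
  open ≈-Reasoning setoid

  1⋆≈0 : 1# ⋆ ≈ 0#
  1⋆≈0 = ⋆-involutive 0#

  0≤x : ∀ x → 0# ≤ x
  0≤x = ⊕-zeroˡ

  ≤-antisym : ∀ {x y} → x ≤ y → y ≤ x → x ≈ y
  ≤-antisym {x} {y} p q = begin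
    x                  ≈⟨ ⊕-identityˡ x ⟨
    0# ⊕ x             ≈⟨ ⊕-cong (≈-trans (⋆-cong q) 1⋆≈0) ≈-refl ⟨
    (y ⋆ ⊕ x) ⋆ ⊕ x    ≈⟨ łukasiewicz x y ⟨
    (x ⋆ ⊕ y) ⋆ ⊕ y    ≈⟨ ⊕-cong (≈-trans (⋆-cong p) 1⋆≈0) ≈-refl ⟩
    0# ⊕ y             ≈⟨ ⊕-identityˡ y ⟩
    y                  ∎

  x≤0⇒x≈0 : ∀ {x} → x ≤ 0# → x ≈ 0#
  x≤0⇒x≈0 p = ≤-antisym p (0≤x _)

  ⊙-⋆-zero⇒≈ : ∀ {x y} → x ⊙ y ⋆ ≈ 0# → y ⊙ x ⋆ ≈ 0# → x ≈ y
  ⊙-⋆-zero⇒≈ p q = ≤-antisym (to p) (to q)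
    where
    to : ∀ {x y} → x ⊙ y ⋆ ≈ 0# → x ≤ y
    to {x} {y} p = ≤-resp ≈-refl (⊕-identityʳ y) (⊙-⋆-residual⁻ (≤-reflexive p))

  ⋆-antitone : ∀ {x y} → x ≤ y → y ⋆ ≤ x ⋆
  ⋆-antitone {x} {y} p = ≈-trans (⊕-comm _ _) (≈-trans (⊕-cong ≈-refl (⋆-involutive y)) p)

  ⊕-mono : ∀ {x x′ y y′} → x ≤ x′ → y ≤ y′ → x ⊕ y ≤ x′ ⊕ y′
  ⊕-mono {x′ = x′} {y = y} p q = ≤-trans (⊕-monoˡ y p) (⊕-monoʳ x′ q)

  ⊙-mono : ∀ {x x′ y y′} → x ≤ x′ → y ≤ y′ → x ⊙ y ≤ x′ ⊙ y′
  ⊙-mono p q = ⋆-antitone (⊕-mono (⋆-antitone p) (⋆-antitone q))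

  x⊙y≤x : ∀ x y → x ⊙ y ≤ x
  x⊙y≤x x y = ≤-resp ≈-refl (⋆-involutive x) (⋆-antitone (x≤x⊕y (x ⋆) (y ⋆)))

  x⊙y≤y : ∀ x y → x ⊙ y ≤ y
  x⊙y≤y x y = ≤-resp (⊙-comm y x) ≈-refl (x⊙y≤x y x)

  x⊙y≈0⇒x≤y⋆ : ∀ {x y} → x ⊙ y ≈ 0# → x ≤ y ⋆
  x⊙y≈0⇒x≤y⋆ p = ≈-trans (≈-sym (⋆-involutive _)) (⋆-cong p)

  x≤y⋆⇒x⊙y≈0 : ∀ {x y} → x ≤ y ⋆ → x ⊙ y ≈ 0#
  x≤y⋆⇒x⊙y≈0 p = ≈-trans (⋆-cong p) 1⋆≈0

  ⊙-zero-mono : ∀ {x x′ y y′} → x ≤ x′ → y ≤ y′ → x′ ⊙ y′ ≈ 0# → x ⊙ y ≈ 0#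
  ⊙-zero-mono p q e = x≤0⇒x≈0 (≤-resp ≈-refl e (⊙-mono p q))

  ⊙-⋆-zero : ∀ x → x ⊙ x ⋆ ≈ 0#
  ⊙-⋆-zero x = ⊙-⋆-inverse ≈-refl

  ⋆-⊕ : ∀ x y → (x ⊕ y) ⋆ ≈ x ⋆ ⊙ y ⋆
  ⋆-⊕ x y = ⋆-cong (≈-sym (⊕-cong (⋆-involutive x) (⋆-involutive y)))

  complement-unique : ∀ {x y} → x ⊕ y ≈ 1# → x ⊙ y ≈ 0# → x ⋆ ≈ y
  complement-unique {x} {y} p q = ≤-antisym
    (≈-trans (⊕-cong (⋆-involutive x) ≈-refl) p)
    (x⊙y≈0⇒x≤y⋆ (≈-trans (⊙-comm y x) q))

  -- The left side is `x ∧ y ⋆`, and `x ⊙ y ≈ 0#` says that x lies below `y ⋆`. Thus partial sums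
  -- cancel.
  ⊕-⊙-⋆-cancel : ∀ {x y} → x ⊙ y ≈ 0# → (x ⊕ y) ⊙ y ⋆ ≈ x
  ⊕-⊙-⋆-cancel {x} {y} p = begin
    ((x ⊕ y) ⋆ ⊕ y ⋆ ⋆) ⋆       ≈⟨ ⋆-cong (⊕-cong (⋆-cong (⊕-cong (≈-sym (⋆-involutive x)) ≈-refl)) (⋆-involutive y)) ⟩
    ((x ⋆ ⋆ ⊕ y) ⋆ ⊕ y) ⋆       ≈⟨ ⋆-cong (łukasiewicz (x ⋆) y) ⟩
    ((y ⋆ ⊕ x ⋆) ⋆ ⊕ x ⋆) ⋆     ≈⟨ ⋆-cong (⊕-cong (≈-trans (⊙-comm y x) p) ≈-refl) ⟩
    (0# ⊕ x ⋆) ⋆                ≈⟨ ⋆-cong (⊕-identityˡ (x ⋆)) ⟩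
    x ⋆ ⋆                       ≈⟨ ⋆-involutive x ⟩
    x                           ∎

  -- Subtracting y from `x ⊕ y ≤ z ⋆` leaves `x ≤ (y ⊕ z) ⋆`.
  +-assoc-defined : ∀ {x y z} → x ⊙ y ≈ 0# → (x ⊕ y) ⊙ z ≈ 0# → x ⊙ (y ⊕ z) ≈ 0#
  +-assoc-defined {x} {y} {z} p q = x≤y⋆⇒x⊙y≈0
    (≤-resp (⊕-⊙-⋆-cancel p) (≈-trans (⊙-comm (z ⋆) (y ⋆)) (≈-sym (⋆-⊕ y z)))
      (⊙-mono (x⊙y≈0⇒x≤y⋆ q) (≤-reflexive ≈-refl)))

  ⊕-interchange : ∀ w x y z → (w ⊕ x) ⊕ (y ⊕ z) ≈ (w ⊕ y) ⊕ (x ⊕ z)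
  ⊕-interchange w x y z = begin
    (w ⊕ x) ⊕ (y ⊕ z)   ≈⟨ ⊕-assoc w x (y ⊕ z) ⟩
    w ⊕ (x ⊕ (y ⊕ z))   ≈⟨ ⊕-cong ≈-refl (⊕-assoc x y z) ⟨
    w ⊕ ((x ⊕ y) ⊕ z)   ≈⟨ ⊕-cong ≈-refl (⊕-cong (⊕-comm x y) ≈-refl) ⟩
    w ⊕ ((y ⊕ x) ⊕ z)   ≈⟨ ⊕-cong ≈-refl (⊕-assoc y x z) ⟩
    w ⊕ (y ⊕ (x ⊕ z))   ≈⟨ ⊕-assoc w y (x ⊕ z) ⟨
    (w ⊕ y) ⊕ (x ⊕ z)   ∎

  -- By associativity of partial sums, y is disjoint from `x ⊕ z` because x lies below `w ⊕ x`, and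
  -- w is disjoint from `x ⊕ (y ⊕ z)`; regrouping the latter moves y over to w. This allows
  -- complementary pairs to be summed entry by entry.
  +-interchange-defined : ∀ {w x y z} → w ⊙ x ≈ 0# → y ⊙ z ≈ 0# → (w ⊕ x) ⊙ (y ⊕ z) ≈ 0# →
                          (w ⊕ y) ⊙ (x ⊕ z) ≈ 0#
  +-interchange-defined {w} {x} {y} {z} p q r = ≈-trans (⊙-comm (w ⊕ y) (x ⊕ z))
    (+-swap (≈-trans (⊙-comm (x ⊕ z) y) y⊙[x⊕z])
            (≈-trans (⊙-comm _ w) (≈-trans (⊙-cong ≈-refl regroup) (+-assoc-defined p r))))
    where
    +-swap : ∀ {a b c} → a ⊙ b ≈ 0# → (a ⊕ b) ⊙ c ≈ 0# → a ⊙ (c ⊕ b) ≈ 0#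
    +-swap e f = ≈-trans (⊙-cong ≈-refl (⊕-comm _ _)) (+-assoc-defined e f)

    regroup : (x ⊕ z) ⊕ y ≈ x ⊕ (y ⊕ z)
    regroup = ≈-trans (⊕-assoc x z y) (⊕-cong ≈-refl (⊕-comm z y))

    y⊙[x⊕z] : y ⊙ (x ⊕ z) ≈ 0#
    y⊙[x⊕z] = +-swap q (≈-trans (⊙-comm (y ⊕ z) x)
      (⊙-zero-mono (≤-resp ≈-refl (⊕-comm x w) (x≤x⊕y x w)) (≤-reflexive ≈-refl) r))

  ∧-cong : ∀ {x x′ y y′} → x ≈ x′ → y ≈ y′ → x ∧ y ≈ x′ ∧ y′
  ∧-cong p q = ⊙-cong (⊕-cong p (⋆-cong q)) q

  ∧-comm : ∀ x y → x ∧ y ≈ y ∧ x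
  ∧-comm x y = begin
    ((x ⊕ y ⋆) ⋆ ⊕ y ⋆) ⋆         ≈⟨ ⋆-cong (⊕-cong (⋆-cong (⊕-cong (⋆-involutive x) ≈-refl)) ≈-refl) ⟨
    ((x ⋆ ⋆ ⊕ y ⋆) ⋆ ⊕ y ⋆) ⋆     ≈⟨ ⋆-cong (łukasiewicz (x ⋆) (y ⋆)) ⟩
    ((y ⋆ ⋆ ⊕ x ⋆) ⋆ ⊕ x ⋆) ⋆     ≈⟨ ⋆-cong (⊕-cong (⋆-cong (⊕-cong (⋆-involutive y) ≈-refl)) ≈-refl) ⟩
    ((y ⊕ x ⋆) ⋆ ⊕ x ⋆) ⋆         ∎

  x∧y≤y : ∀ x y → x ∧ y ≤ y
  x∧y≤y x y = x⊙y≤y (x ⊕ y ⋆) y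

  x∧y≤x : ∀ x y → x ∧ y ≤ x
  x∧y≤x x y = ≤-resp (∧-comm y x) ≈-refl (x∧y≤y y x)

  ⊙-identityˡ : ∀ x → 1# ⊙ x ≈ x
  ⊙-identityˡ x = ≈-trans (⋆-cong (≈-trans (⊕-cong 1⋆≈0 ≈-refl) (⊕-identityˡ (x ⋆)))) (⋆-involutive x)

  ∧-glb : ∀ {u x y} → u ≤ x → u ≤ y → u ≤ x ∧ y
  ∧-glb {u} {x} {y} p q = ≤-resp u∧y≈u ≈-refl (⊙-mono (⊕-monoˡ (y ⋆) p) (≤-reflexive ≈-refl))
    where
    u∧y≈u : u ∧ y ≈ u
    u∧y≈u = ≈-trans (∧-comm u y)
      (≈-trans (⊙-cong (≈-trans (⊕-comm y (u ⋆)) q) ≈-refl) (⊙-identityˡ u))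

  -- For u below both `x ⊕ y` and w, the difference `u ⊙ x ⋆` lies below y and w, hence vanishes; so
  -- u lies below x and w.
  ∧-⊕-zero : ∀ {x y w} → x ∧ w ≈ 0# → y ∧ w ≈ 0# → (x ⊕ y) ∧ w ≈ 0#
  ∧-⊕-zero {x} {y} {w} p q = x≤0⇒x≈0 (≤-resp ≈-refl p (∧-glb u≤x (x∧y≤y (x ⊕ y) w)))
    where
    u = (x ⊕ y) ∧ w

    u≤x : u ≤ x
    u≤x = ≤-resp ≈-refl (⊕-identityʳ x) (⊙-⋆-residual⁻ (≤-resp ≈-refl q
      (∧-glb (⊙-⋆-residual (x∧y≤x (x ⊕ y) w))
             (≤-trans (x⊙y≤x u (x ⋆)) (x∧y≤y (x ⊕ y) w)))))

  ≤⇒⊕-difference : ∀ {x y} → x ≤ y → x ⊕ y ⊙ x ⋆ ≈ y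
  ≤⇒⊕-difference {x} {y} p = begin
    x ⊕ (y ⋆ ⊕ x ⋆ ⋆) ⋆   ≈⟨ ⊕-comm _ _ ⟩
    (y ⋆ ⊕ x ⋆ ⋆) ⋆ ⊕ x   ≈⟨ ⊕-cong (⋆-cong (⊕-cong ≈-refl (⋆-involutive x))) ≈-refl ⟩
    (y ⋆ ⊕ x) ⋆ ⊕ x       ≈⟨ łukasiewicz y x ⟩
    (x ⋆ ⊕ y) ⋆ ⊕ y       ≈⟨ ⊕-cong (≈-trans (⋆-cong p) 1⋆≈0) ≈-refl ⟩
    0# ⊕ y                ≈⟨ ⊕-identityˡ y ⟩
    y                     ∎

  -- As reals, `x ⋆ ∧ y` is min(1 - x, y), the portion of y that fits on top of x, and `x ⊙ y` is
  -- the rest of y. The lemmas up to `[x⊙y]⊙[x⋆∧y]≈0` write `x ⊕ y` and y as partial sums with this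
  -- portion as a summand.
  ⊕-⋆∧ : ∀ x y → x ⊕ x ⋆ ∧ y ≈ x ⊕ y
  ⊕-⋆∧ x y = ≈-trans (⊕-cong ≈-refl (≈-trans (∧-comm (x ⋆) y)
                       (⊙-cong (≈-trans (⊕-cong ≈-refl (⋆-involutive x)) (⊕-comm y x)) ≈-refl)))
                     (≤⇒⊕-difference (x≤x⊕y x y))

  ⋆∧≈⊙-⋆ : ∀ x y → x ⋆ ∧ y ≈ y ⊙ (x ⊙ y) ⋆
  ⋆∧≈⊙-⋆ x y = ≈-trans (⊙-comm _ y) (⊙-cong ≈-refl (≈-sym (⋆-involutive _)))

  ⊙-⊕-⋆∧ : ∀ x y → x ⊙ y ⊕ x ⋆ ∧ y ≈ y
  ⊙-⊕-⋆∧ x y = ≈-trans (⊕-cong ≈-refl (⋆∧≈⊙-⋆ x y)) (≤⇒⊕-difference (x⊙y≤y x y))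

  x⊙[x⋆∧y]≈0 : ∀ x y → x ⊙ (x ⋆ ∧ y) ≈ 0#
  x⊙[x⋆∧y]≈0 x y = ⊙-zero-mono (≤-reflexive ≈-refl) (x∧y≤x (x ⋆) y) (⊙-⋆-zero x)

  [x⊙y]⊙[x⋆∧y]≈0 : ∀ x y → (x ⊙ y) ⊙ (x ⋆ ∧ y) ≈ 0#
  [x⊙y]⊙[x⋆∧y]≈0 x y = ⊙-zero-mono (≤-reflexive ≈-refl)
    (≤-resp (≈-sym (⋆∧≈⊙-⋆ x y)) ≈-refl (x⊙y≤y y _)) (⊙-⋆-zero (x ⊙ y))

  ⋆∧-zero⇒⊕-absorb : ∀ {x y} → x ⋆ ∧ y ≈ 0# → x ⊕ y ≈ x
  ⋆∧-zero⇒⊕-absorb {x} {y} p =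
    ≈-trans (≈-sym (⊕-⋆∧ x y)) (≈-trans (⊕-cong ≈-refl p) (⊕-identityʳ x))

  -- With z = y⋆ ∧ x one has x = (x ⊙ y) + z and y⋆ = (x ⊕ y)⋆ + z, so that a
  -- common lower bound u of x ⊙ y and (x ⊕ y)⋆ satisfies u + z ≤ x ∧ y⋆ = z.
  ⊕-⋆-∧-⊙-zero : ∀ x y → (x ⊕ y) ⋆ ∧ (x ⊙ y) ≈ 0#
  ⊕-⋆-∧-⊙-zero x y = x≤0⇒x≈0 (≤-resp (⊕-⊙-⋆-cancel u⊙z≈0) (⊙-⋆-zero z)
      (⊙-mono (∧-glb u⊕z≤y⋆ u⊕z≤x) (≤-reflexive ≈-refl)))
    where
    z = y ⋆ ∧ x
    u = (x ⊕ y) ⋆ ∧ (x ⊙ y)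

    u≤y⊙x : u ≤ y ⊙ x
    u≤y⊙x = ≤-resp ≈-refl (⊙-comm x y) (x∧y≤y _ _)

    u⊙z≈0 : u ⊙ z ≈ 0#
    u⊙z≈0 = ⊙-zero-mono u≤y⊙x (≤-reflexive ≈-refl) ([x⊙y]⊙[x⋆∧y]≈0 y x)

    u⊕z≤x : u ⊕ z ≤ x
    u⊕z≤x = ≤-resp ≈-refl (⊙-⊕-⋆∧ y x) (⊕-monoˡ z u≤y⊙x)

    u⊕z≤y⋆ : u ⊕ z ≤ y ⋆
    u⊕z≤y⋆ = ≤-resp ≈-refl (⊙-⊕-⋆∧ (x ⋆) (y ⋆))
      (⊕-mono (≤-resp ≈-refl (⋆-⊕ x y) (x∧y≤x _ _))
              (≤-reflexive (≈-trans (∧-comm (y ⋆) x) (∧-cong (≈-sym (⋆-involutive x)) ≈-refl))))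

-- Arithmetic of the rational unit interval.

module UnitIntervalℚ-Values where
  open Rat using (_+_; _*_; _-_; _≤_)
  open ℚₚ
  open ℚ-Lemmas
  open ℚ-Sums using (val-⊕+⊙)
  open MVAlgebra [0,1]ℚ using (_≈_; _⊕_; _⋆; _⊙_; _∨_; _∧_; 0#)
  open UnitIntervalℚ-Operations using (val-≡; ≈⇒val-≡; val-∨-≤; val-∨-≥)
  open +-*-Solver

  -- The ordinary sum is the truncated sum plus the overflow `x ⊙ y`, so it is at most 1 once the
  -- overflow vanishes.
  ⊙-zero⇒val-+≤1 : ∀ {x y} → val (x ⊙ y) ≡ 0ℚ → val x + val y ≤ 1ℚ
  ⊙-zero⇒val-+≤1 {x} {y} e = subst (_≤ 1ℚ)
    (trans (sym (+-identityʳ _)) (trans (cong (val (x ⊕ y) +_) (sym e)) (val-⊕+⊙ x y)))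
    (val≤1 (x ⊕ y))

  val-+≤1⇒⊙-zero : ∀ {x y} → val x + val y ≤ 1ℚ → val (x ⊙ y) ≡ 0ℚ
  val-+≤1⇒⊙-zero {x} {y} h = ∙-cancelˡ (val x + val y) _ _ (begin
    (val x + val y) + val (x ⊙ y)   ≡⟨ cong (_+ val (x ⊙ y)) (p≤q⇒p⊓q≡p h) ⟨
    val (x ⊕ y) + val (x ⊙ y)       ≡⟨ val-⊕+⊙ x y ⟩
    val x + val y                   ≡⟨ +-identityʳ _ ⟨
    (val x + val y) + 0ℚ            ∎)
    where
    open ≡-Reasoning
    open GroupProperties +-0-group using (∙-cancelˡ)

  val-⊕ : ∀ {x y} → val x + val y ≤ 1ℚ → val (x ⊕ y) ≡ val x + val y
  val-⊕ = p≤q⇒p⊓q≡p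

  val-⋆⋆ : ∀ x → 1ℚ - (1ℚ - val x) ≡ val x
  val-⋆⋆ x = solve 2 (λ o x → o :+ :- (o :+ :- x) := x) refl 1ℚ (val x)

  val-∨ : ∀ x y → val (x ∨ y) ≡ val x ⊔ val y
  -- `x ∨ y` unfolds with `y ⋆ ⋆` where `val-∨-≤` and `val-∨-≥` have y.
  val-∨ x y = trans (cong (λ s → (1ℚ - (1ℚ - val x + s) ⊓ 1ℚ + val y) ⊓ 1ℚ) (val-⋆⋆ y))
                (cases (≤-total (val x) (val y)))
    where
    cases : _ → val ((x ⋆ ⊕ y) ⋆ ⊕ y) ≡ val x ⊔ val y
    cases (inj₁ x≤y) = trans (val-∨-≤ x y x≤y) (sym (p≤q⇒p⊔q≡q x≤y))
    cases (inj₂ y≤x) = trans (val-∨-≥ x y y≤x) (sym (p≥q⇒p⊔q≡p y≤x))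

  val-∧ : ∀ x y → val (x ∧ y) ≡ val x ⊓ val y
  -- Writing x as `x ⋆ ⋆` turns the meet into the complement of the join of `x ⋆` and `y ⋆`.
  val-∧ x y = trans (cong (λ s → 1ℚ - (1ℚ - (s + (1ℚ - val y)) ⊓ 1ℚ + (1ℚ - val y)) ⊓ 1ℚ) (sym (val-⋆⋆ x)))
                (cases (≤-total (val x) (val y)))
    where
    flip : ∀ {p q} → p ≤ q → 1ℚ - q ≤ 1ℚ - p
    flip p≤q = +-monoʳ-≤ 1ℚ (neg-antimono-≤ p≤q)

    cases : _ → 1ℚ - val ((x ⋆ ⋆ ⊕ y ⋆) ⋆ ⊕ y ⋆) ≡ val x ⊓ val y
    cases (inj₁ x≤y) = trans (cong (λ s → 1ℚ - s) (val-∨-≥ (x ⋆) (y ⋆) (flip x≤y)))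
                         (trans (val-⋆⋆ x) (sym (p≤q⇒p⊓q≡p x≤y)))
    cases (inj₂ y≤x) = trans (cong (λ s → 1ℚ - s) (val-∨-≤ (x ⋆) (y ⋆) (flip y≤x)))
                         (trans (val-⋆⋆ y) (sym (p≥q⇒p⊓q≡q y≤x)))

  -- Opaque, since 1/1+ m unfolds to a gcd computation that conversion checking
  -- would otherwise try to normalise for variable m.
  opaque
    unitFraction : ℕ → UnitIntervalℚ
    unitFraction m = 1/1+ m ,[ 0≤1/1+ m , 1/1+≤1 m ]

    val-unitFraction : ∀ m → val (unitFraction m) ≡ 1/1+ m
    val-unitFraction m = refl

  fromℕ*unitFraction : ∀ m → fromℕ (suc m) * val (unitFraction m) ≡ 1ℚ
  fromℕ*unitFraction m = trans (cong (fromℕ (suc m) *_) (val-unitFraction m)) (fromℕ*1/1+ m)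

  -- The denominator `suc (k ℕ.+ m ℕ.* suc k)` is (m + 1)(k + 1).
  unitFraction-refine : ∀ m k → val (unitFraction m) ≡ fromℕ (suc k) * val (unitFraction (k ℕ.+ m ℕ.* suc k))
  unitFraction-refine m k = trans (val-unitFraction m) (sym (trans
    (cong (fromℕ (suc k) *_) (val-unitFraction (k ℕ.+ m ℕ.* suc k))) (ℚ-Sums.1/1+-* m k)))

  p≤p+q : ∀ {p q} → 0ℚ ≤ q → p ≤ p + q
  p≤p+q {p} {q} h = subst (_≤ p + q) (+-identityʳ p) (+-monoʳ-≤ p h)

  0≤fromℕ* : ∀ j x → 0ℚ ≤ fromℕ j * val x
  0≤fromℕ* j x = subst (_≤ fromℕ j * val x) (*-zeroʳ (fromℕ j))
    (*-monoˡ-≤-nonNeg (fromℕ j) {{Rat.nonNegative (0≤fromℕ j)}} (0≤val x))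

  -- For y = (j + 1)x this splits y into the partial sum of x and jx, the form in which additivity
  -- of a bimorphism applies.
  record Predecessor (j : ℕ) (x y : UnitIntervalℚ) : Set where
    field
      pred      : UnitIntervalℚ
      val-pred  : val pred ≡ fromℕ j * val x
      ⊙-zero    : x ⊙ pred ≈ 0#
      ≈-⊕       : y ≈ x ⊕ pred

  predecessor : ∀ j {x y} → val y ≡ fromℕ (suc j) * val x → Predecessor j x y
  predecessor j {x} {y} e = record
    { pred     = z
    ; val-pred = refl
    ; ⊙-zero   = val-≡ (val-+≤1⇒⊙-zero {x} {z} x+z≤1)
    ; ≈-⊕      = val-≡ (trans y≡x+z (sym (val-⊕ {x} {z} x+z≤1)))
    }
    where
    y≡x+z : val y ≡ val x + fromℕ j * val x
    y≡x+z = trans e (trans (*-distribʳ-+ (val x) 1ℚ (fromℕ j))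
                           (cong (_+ fromℕ j * val x) (*-identityˡ (val x))))

    x+z≤1 : val x + fromℕ j * val x ≤ 1ℚ
    x+z≤1 = subst (_≤ 1ℚ) y≡x+z (val≤1 y)

    z : UnitIntervalℚ
    z = (fromℕ j * val x) ,[ 0≤fromℕ* j x , ≤-trans z≤x+z x+z≤1 ]
      where
      z≤x+z : fromℕ j * val x ≤ val x + fromℕ j * val x
      z≤x+z = subst (_≤ val x + fromℕ j * val x) (+-identityˡ _) (+-monoˡ-≤ (fromℕ j * val x) (0≤val x))

open UnitIntervalℚ-Values using (unitFraction; fromℕ*unitFraction; unitFraction-refine; Predecessor; predecessor)

-- The staircase of `vs`, a canonical form: for rational entries it depends on `vs` only through its
-- sum.
fill : ∀ {c ℓ : Level} (A : MVAlgebra c ℓ) m {n} →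
       Vec (MVAlgebra.Carrier A) n → Vec (MVAlgebra.Carrier A) m
fill A m vs = MVProperties.carries A (replicate m (MVAlgebra.0# A)) vs

-- What carrying loses past the last entry.

module Overflow {c ℓ : Level} (A : MVAlgebra c ℓ) where
  open MVAlgebra A
  open MVProperties A
  open MVOrder A

  -- The remainder of v that `carry` drops at the end of the vector.
  overflow : ∀ {n} → Vec Carrier n → Carrier → Carrier
  overflow []       v = v
  overflow (x ∷ xs) v = overflow xs (x ⊙ v)

  overflow≤ : ∀ {n} (xs : Vec Carrier n) v → overflow xs v ≤ v
  overflow≤ []       v = ≤-reflexive ≈-refl
  overflow≤ (x ∷ xs) v = ≤-trans (overflow≤ xs (x ⊙ v)) (x⊙y≤y x v)

  -- An overflow is only passed on from an entry that has reached 1.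
  carry-⋆∧-overflow : ∀ {n} (xs : Vec Carrier n) v →
                      All (λ y → y ⋆ ∧ overflow xs v ≈ 0#) (carry xs v)
  carry-⋆∧-overflow []       v = []
  carry-⋆∧-overflow (x ∷ xs) v =
    x≤0⇒x≈0 (≤-resp ≈-refl (⊕-⋆-∧-⊙-zero x v)
      (∧-glb (x∧y≤x _ _) (≤-trans (x∧y≤y _ _) (overflow≤ xs (x ⊙ v)))))
    ∷ carry-⋆∧-overflow xs (x ⊙ v)

-- Sums of values of a bimorphism with a common rational argument.

module BimorphismSums {c ℓ t ℓ′ : Level} (A : MVAlgebra c ℓ) (T : MVAlgebra t ℓ′)
    {β : UnitIntervalℚ → MVAlgebra.Carrier A → MVAlgebra.Carrier T}
    (bi : IsBimorphism [0,1]ℚ A T β) where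
  private
    module Q  = MVAlgebra [0,1]ℚ
    module A  = MVAlgebra A
    module AP = MVProperties A
    module AO = MVOrder A
  open MVAlgebra T
  open MVProperties T
  open MVOrder T
  open Overflow A
  open IsBimorphism bi
  open ≈-Reasoning setoid
  open ℚ-Lemmas using (fromℕ)
  open UnitIntervalℚ-Operations using (val-≡; ≈⇒val-≡)


  sums : ∀ {n} → UnitIntervalℚ → Vec A.Carrier n → Carrier
  sums r as = ⨁ (Vec.map (β r) as)

  -- Cancels x from the partial sum x = x + x. Applied to the image of 0 = 0 + 0, it makes β vanish
  -- at zero in either argument.
  self-disjoint-idempotent⇒≈0 : ∀ {x} → x ⊙ x ≈ 0# → x ≈ x ⊕ x → x ≈ 0#
  self-disjoint-idempotent⇒≈0 {x} p q = begin
    x               ≈⟨ ⊕-⊙-⋆-cancel p ⟨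
    (x ⊕ x) ⊙ x ⋆   ≈⟨ ⊙-cong (≈-sym q) ≈-refl ⟩
    x ⊙ x ⋆         ≈⟨ ⊙-⋆-zero x ⟩
    0#              ∎

  β-zeroʳ : ∀ q → β q A.0# ≈ 0#
  β-zeroʳ q = self-disjoint-idempotent⇒≈0 (+-defʳ q 0⊙0≈0)
    (≈-trans (β-cong Q.≈-refl (A.≈-sym (A.⊕-identityˡ A.0#))) (+-homoʳ q 0⊙0≈0))
    where
    0⊙0≈0 : A.0# A.⊙ A.0# A.≈ A.0#
    0⊙0≈0 = AO.x≤y⋆⇒x⊙y≈0 (AO.0≤x _)

  β-zeroˡ : ∀ a → β Q.0# a ≈ 0#
  β-zeroˡ a = self-disjoint-idempotent⇒≈0 (+-defˡ a 0⊙0≈0)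
    (≈-trans (β-cong (Q.≈-sym (Q.⊕-identityˡ Q.0#)) A.≈-refl) (+-homoˡ a 0⊙0≈0))
    where
    0⊙0≈0 : Q.0# Q.⊙ Q.0# Q.≈ Q.0#
    0⊙0≈0 = MVOrder.x≤y⋆⇒x⊙y≈0 [0,1]ℚ {Q.0#} {Q.0#} (MVOrder.0≤x [0,1]ℚ _)

  β-multiple : ∀ j {q r} a → val q ≡ fromℕ j Rat.* val r → β q a ≈ sums r (replicate j a)
  β-multiple zero    {q} {r} a e = ≈-trans
    (β-cong (val-≡ (trans e (ℚₚ.*-zeroˡ (val r)))) A.≈-refl) (β-zeroˡ a)
  β-multiple (suc j) {q} {r} a e = begin
    β q a                           ≈⟨ β-cong ≈-⊕ A.≈-refl ⟩
    β (r Q.⊕ pred) a                ≈⟨ +-homoˡ a ⊙-zero ⟩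
    β r a ⊕ β pred a                ≈⟨ ⊕-cong ≈-refl (β-multiple j a val-pred) ⟩
    β r a ⊕ sums r (replicate j a)  ∎
    where open Predecessor (predecessor j {r} {q} e)

  -- The head pair adds up to `β r 1#` and, by induction, the tail to `β pred 1#`; these two are
  -- disjoint because r and `pred` are. A general total q = nr is allowed so that the induction can
  -- pass to the tail.
  sums-complementary : ∀ {n} r q (as : Vec A.Carrier n) → val q ≡ fromℕ n Rat.* val r →
                       sums r as ⊙ sums r (Vec.map A._⋆ as) ≈ 0# ×
                       sums r as ⊕ sums r (Vec.map A._⋆ as) ≈ β q A.1#
  sums-complementary r q [] e =
    x≤y⋆⇒x⊙y≈0 (0≤x _) ,
    ≈-trans (⊕-identityˡ 0#) (≈-sym (≈-trans
      (β-cong (val-≡ (trans e (ℚₚ.*-zeroˡ (val r)))) A.≈-refl) (β-zeroˡ A.1#)))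
  sums-complementary {suc n} r q (a ∷ as) e =
    +-interchange-defined (+-defʳ r (AO.⊙-⋆-zero a)) (proj₁ rec)
      (≈-trans (⊙-cong head (proj₂ rec)) (+-defˡ A.1# ⊙-zero)) ,
    (begin
      (β r a ⊕ S) ⊕ (β r (a A.⋆) ⊕ S′)  ≈⟨ ⊕-interchange _ _ _ _ ⟩
      (β r a ⊕ β r (a A.⋆)) ⊕ (S ⊕ S′)  ≈⟨ ⊕-cong head (proj₂ rec) ⟩
      β r A.1# ⊕ β pred A.1#            ≈⟨ +-homoˡ A.1# ⊙-zero ⟨
      β (r Q.⊕ pred) A.1#               ≈⟨ β-cong ≈-⊕ A.≈-refl ⟨
      β q A.1#                          ∎)
    where
    open Predecessor (predecessor n {r} {q} e)
    S   = sums r as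
    S′  = sums r (Vec.map A._⋆ as)
    rec = sums-complementary r pred as val-pred

    head : β r a ⊕ β r (a A.⋆) ≈ β r A.1#
    head = ≈-trans (≈-sym (+-homoʳ r (AO.⊙-⋆-zero a)))
      (β-cong Q.≈-refl (A.≈-trans (A.⊕-comm a (a A.⋆)) (AP.⋆-⊕-inverse a)))

  -- With m + 1 entries and r = 1/(m + 1), the total of the complementary sums is β(1, 1) = 1.
  sums-⋆ : ∀ m (as : Vec A.Carrier (suc m)) →
           sums (unitFraction m) as ⋆ ≈ sums (unitFraction m) (Vec.map A._⋆ as)
  sums-⋆ m as = complement-unique (≈-trans (proj₂ sc) β-1) (proj₁ sc)
    where
    sc : sums (unitFraction m) as ⊙ sums (unitFraction m) (Vec.map A._⋆ as) ≈ 0# ×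
         sums (unitFraction m) as ⊕ sums (unitFraction m) (Vec.map A._⋆ as) ≈ β Q.1# A.1#
    sc = sums-complementary (unitFraction m) Q.1# as (sym (fromℕ*unitFraction m))

  -- With d = `x ⋆ ∧ y`, both sides are the sum of the images of x, d and `x ⊙ y`: y is the partial
  -- sum of `x ⊙ y` and d, and `x ⊕ y` that of x and d.
  β-⊕-⊙ : ∀ r x y → β r x ⊕ β r y ≈ β r (x A.⊕ y) ⊕ β r (x A.⊙ y)
  β-⊕-⊙ r x y = begin
    β r x ⊕ β r y                                 ≈⟨ ⊕-cong ≈-refl (β-cong Q.≈-refl (AO.⊙-⊕-⋆∧ x y)) ⟨
    β r x ⊕ β r (x A.⊙ y A.⊕ d)                   ≈⟨ ⊕-cong ≈-refl (+-homoʳ r (AO.[x⊙y]⊙[x⋆∧y]≈0 x y)) ⟩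
    β r x ⊕ (β r (x A.⊙ y) ⊕ β r d)               ≈⟨ ⊕-cong ≈-refl (⊕-comm _ _) ⟩
    β r x ⊕ (β r d ⊕ β r (x A.⊙ y))               ≈⟨ ⊕-assoc _ _ _ ⟨
    (β r x ⊕ β r d) ⊕ β r (x A.⊙ y)               ≈⟨ ⊕-cong (+-homoʳ r (AO.x⊙[x⋆∧y]≈0 x y)) ≈-refl ⟨
    β r (x A.⊕ d) ⊕ β r (x A.⊙ y)                 ≈⟨ ⊕-cong (β-cong Q.≈-refl (AO.⊕-⋆∧ x y)) ≈-refl ⟩
    β r (x A.⊕ y) ⊕ β r (x A.⊙ y)                 ∎
    where d = x A.⋆ A.∧ y

  -- Each carrying step conserves the total by `β-⊕-⊙`, so only the final overflow is left outside
  -- the vector.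
  sums-carry-overflow : ∀ {n} r (xs : Vec A.Carrier n) v →
                        sums r xs ⊕ β r v ≈ sums r (AP.carry xs v) ⊕ β r (overflow xs v)
  sums-carry-overflow r []       v = ≈-refl
  sums-carry-overflow r (x ∷ xs) v = begin
    (β r x ⊕ sums r xs) ⊕ β r v                  ≈⟨ ⊕-assoc _ _ _ ⟩
    β r x ⊕ (sums r xs ⊕ β r v)                  ≈⟨ ⊕-cong ≈-refl (⊕-comm _ _) ⟩
    β r x ⊕ (β r v ⊕ sums r xs)                  ≈⟨ ⊕-assoc _ _ _ ⟨
    (β r x ⊕ β r v) ⊕ sums r xs                  ≈⟨ ⊕-cong (β-⊕-⊙ r x v) ≈-refl ⟩
    (β r (x A.⊕ v) ⊕ β r (x A.⊙ v)) ⊕ sums r xs  ≈⟨ ⊕-assoc _ _ _ ⟩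
    β r (x A.⊕ v) ⊕ (β r (x A.⊙ v) ⊕ sums r xs)  ≈⟨ ⊕-cong ≈-refl (⊕-comm _ _) ⟩
    β r (x A.⊕ v) ⊕ (sums r xs ⊕ β r (x A.⊙ v))  ≈⟨ ⊕-cong ≈-refl (sums-carry-overflow r xs (x A.⊙ v)) ⟩
    β r (x A.⊕ v) ⊕ (sums r (AP.carry xs (x A.⊙ v)) ⊕ β r (overflow xs (x A.⊙ v)))
                                                 ≈⟨ ⊕-assoc _ _ _ ⟨
    (β r (x A.⊕ v) ⊕ sums r (AP.carry xs (x A.⊙ v))) ⊕ β r (overflow xs (x A.⊙ v)) ∎

  -- Meeting in zero passes through β because β preserves meets, and through sums by `∧-⊕-zero`.
  sums-⋆-∧-zero : ∀ {n} r {w} {as : Vec A.Carrier n} → All (λ a → a A.⋆ A.∧ w A.≈ A.0#) as →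
                  sums r (Vec.map A._⋆ as) ∧ β r w ≈ 0#
  sums-⋆-∧-zero r []       = x≤0⇒x≈0 (x∧y≤x 0# _)
  sums-⋆-∧-zero r (e ∷ es) = ∧-⊕-zero
    (≈-trans (≈-sym (∧-homoʳ r _ _)) (≈-trans (β-cong Q.≈-refl e) (β-zeroʳ r)))
    (sums-⋆-∧-zero r es)

  -- The overflow meets the complement of the carried sum in zero, since that complement is the sum
  -- of the complemented entries; hence adding the overflow changes nothing.
  sums-carry : ∀ m (xs : Vec A.Carrier (suc m)) v →
               sums (unitFraction m) (AP.carry xs v) ≈ sums (unitFraction m) xs ⊕ β (unitFraction m) v
  sums-carry m xs v = ≈-sym (≈-trans (sums-carry-overflow (unitFraction m) xs v)
    (⋆∧-zero⇒⊕-absorb (≈-trans (∧-cong (sums-⋆ m (AP.carry xs v)) ≈-refl)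
      (sums-⋆-∧-zero (unitFraction m) (carry-⋆∧-overflow xs v)))))

  sums-carries : ∀ m {n} (xs : Vec A.Carrier (suc m)) (vs : Vec A.Carrier n) →
                 sums (unitFraction m) (AP.carries xs vs) ≈
                 sums (unitFraction m) xs ⊕ sums (unitFraction m) vs
  sums-carries m xs []       = ≈-sym (⊕-identityʳ _)
  sums-carries m xs (v ∷ vs) = ≈-trans (sums-carries m (AP.carry xs v) vs)
    (≈-trans (⊕-cong (sums-carry m xs v) ≈-refl) (⊕-assoc _ _ _))

  sums-zeros : ∀ n r → sums r (replicate n A.0#) ≈ 0#
  sums-zeros zero    r = ≈-refl
  sums-zeros (suc n) r = ≈-trans (⊕-cong (β-zeroʳ r) (sums-zeros n r)) (⊕-identityˡ 0#)

  sums-fill : ∀ m {n} (vs : Vec A.Carrier n) →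
              sums (unitFraction m) (fill A (suc m) vs) ≈ sums (unitFraction m) vs
  sums-fill m vs = ≈-trans (sums-carries m (replicate (suc m) A.0#) vs)
    (≈-trans (⊕-cong (sums-zeros (suc m) (unitFraction m)) ≈-refl) (⊕-identityˡ _))

  sums-++ : ∀ {m n} r (xs : Vec A.Carrier m) (ys : Vec A.Carrier n) →
            sums r (xs ++ ys) ≈ sums r xs ⊕ sums r ys
  sums-++ r []       ys = ≈-sym (⊕-identityˡ _)
  sums-++ r (x ∷ xs) ys = ≈-trans (⊕-cong ≈-refl (sums-++ r xs ys)) (≈-sym (⊕-assoc _ _ _))

  sums-repeat : ∀ j {q r n} → val q ≡ fromℕ j Rat.* val r → (xs : Vec A.Carrier n) →
                sums q xs ≈ sums r (repeat j xs)
  sums-repeat j e []       = ≈-refl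
  sums-repeat j {q} {r} e (x ∷ xs) = ≈-sym (≈-trans (sums-++ r (replicate j x) (repeat j xs))
    (⊕-cong (≈-sym (β-multiple j x e)) (≈-sym (sums-repeat j e xs))))

  -- The predecessor of (m + 1)(k + 1), as `unitFraction m` stands for 1/(m + 1).
  common : ℕ → ℕ → ℕ
  common m k = k ℕ.+ m ℕ.* suc k

  sums-refineˡ : ∀ m k {n} (xs : Vec A.Carrier n) →
                 sums (unitFraction m) xs ≈ sums (unitFraction (common m k)) (repeat (suc k) xs)
  sums-refineˡ m k = sums-repeat (suc k) (unitFraction-refine m k)

  sums-refineʳ : ∀ m k {n} (xs : Vec A.Carrier n) →
                 sums (unitFraction k) xs ≈ sums (unitFraction (common m k)) (repeat (suc m) xs)
  -- `unitFraction-refine k m` yields the denominator (k + 1)(m + 1), which has to be commuted to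
  -- match `common m k`.
  sums-refineʳ m k = sums-repeat (suc m) (trans (unitFraction-refine k m)
    (cong (λ j → fromℕ (suc m) Rat.* val (unitFraction (ℕ.pred j))) (ℕₚ.*-comm (suc k) (suc m))))

-- Rationals as quotients of natural numbers, and the Archimedean property.

module Fractions where
  open Rat using (_+_; _*_; _≤_; _<_)
  open ℚₚ
  open ℚ-Lemmas

  toℚᵘ-fromℕ : ∀ n → Rat.toℚᵘ (fromℕ n) ℚᵘ.≃ ℚᵘ.mkℚᵘ (ℤ.+ n) 0
  toℚᵘ-fromℕ zero    = ℚᵘₚ.≃-refl
  toℚᵘ-fromℕ (suc n) = ℚᵘₚ.≃-trans (toℚᵘ-homo-+ 1ℚ (fromℕ n))
    (ℚᵘₚ.≃-trans (ℚᵘₚ.+-congʳ (Rat.toℚᵘ 1ℚ) (toℚᵘ-fromℕ n))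
      (ℚᵘ.*≡* (cong (ℤ._* ℤ.+ 1) (cong (λ k → ℤ.+ 1 ℤ.+ k) (ℤₚ.*-identityʳ (ℤ.+ n))))))

  numerator : ℚ → ℕ
  numerator p = ℤ.∣ Rat.↥ p ∣

  fraction : ∀ p → 0ℚ ≤ p → p ≡ fromℕ (numerator p) * 1/1+ (ℚ.denominator-1 p)
  fraction (mkℚ (ℤ.+ j) d c) _ = toℚᵘ-injective (ℚᵘₚ.≃-sym (ℚᵘₚ.≃-trans
    (toℚᵘ-homo-* (fromℕ j) (1/1+ d))
    (ℚᵘₚ.≃-trans (ℚᵘₚ.*-cong (toℚᵘ-fromℕ j) (toℚᵘ-fromℚᵘ (ℚᵘ.mkℚᵘ (ℤ.+ 1) d)))
      (ℚᵘ.*≡* (cong₂ ℤ._*_ (ℤₚ.*-identityʳ (ℤ.+ j)) (cong (λ k → ℤ.+ suc k) (sym (ℕₚ.+-identityʳ d))))))))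
  fraction (mkℚ (ℤ.-[1+ j ]) d c) h with Rat.nonNegative h
  ... | ()

  -- Multiplying p by its denominator gives its numerator, a positive integer.
  archimedean : ∀ {p} → 0ℚ < p → ∃ λ k → 1ℚ ≤ fromℕ k * p
  archimedean {p} 0<p = suc d , 1≤ (numerator p) (fraction p (<⇒≤ 0<p))
    where
    d = ℚ.denominator-1 p

    1≤ : ∀ j → p ≡ fromℕ j * 1/1+ d → 1ℚ ≤ fromℕ (suc d) * p
    1≤ zero    e = ⊥-elim (<-irrefl (sym (trans e (*-zeroˡ (1/1+ d)))) 0<p)
    1≤ (suc j) e = subst (1ℚ ≤_) (sym (begin
        fromℕ (suc d) * p                          ≡⟨ cong (fromℕ (suc d) *_) (trans e (*-comm (fromℕ (suc j)) (1/1+ d))) ⟩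
        fromℕ (suc d) * (1/1+ d * fromℕ (suc j))   ≡⟨ *-assoc (fromℕ (suc d)) (1/1+ d) (fromℕ (suc j)) ⟨
        fromℕ (suc d) * 1/1+ d * fromℕ (suc j)     ≡⟨ cong (_* fromℕ (suc j)) (fromℕ*1/1+ d) ⟩
        1ℚ * fromℕ (suc j)                         ≡⟨ *-identityˡ (fromℕ (suc j)) ⟩
        1ℚ + fromℕ j                               ∎))
      (UnitIntervalℚ-Values.p≤p+q (0≤fromℕ j))
      where open ≡-Reasoning

  val-⨁-replicate : ∀ k x → val (MVAlgebra.⨁ [0,1]ℚ (replicate k x)) ≡ (fromℕ k * val x) ⊓ 1ℚ
  val-⨁-replicate k x = trans (ℚ-Sums.val-⨁ (replicate k x)) (cong (_⊓ 1ℚ) (ℚ-Sums.sum-replicate k x))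

open Fractions using (numerator; fraction; archimedean; val-⨁-replicate)

-- The real unit interval as an MV-algebra, and homomorphisms.

module UnitIntervalAlgebra where
  open UnitInterval-Operations renaming (termwise to ≈-termwise)

  [0,1] : MVAlgebra 0ℓ 0ℓ
  [0,1] = record
    { Carrier = UnitInterval
    ; _≈_     = _≈_
    ; _⊕_     = _⊕_
    ; _⋆      = _⋆
    ; 0#      = 0#
    ; ⊕-isCommutativeMonoid = record
      { isMonoid = record
        { isSemigroup = record
          { isMagma = record
            { isEquivalence = ≈-isEquivalence
            ; ∙-cong = ⊕-Map.map₂-cong
            }
          ; assoc = λ r s t → ≈-termwise _ _ λ n → Q.⊕-assoc (seq r n) (seq s n) (seq t n)
          }
        ; identity = (λ r → ≈-termwise _ _ λ n → Q.⊕-identityˡ (seq r n))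
                   , (λ r → ≈-termwise _ _ λ n →
                        trans (Q.⊕-comm (seq r n) Q.0#) (Q.⊕-identityˡ (seq r n)))
        }
      ; comm = λ r s → ≈-termwise _ _ λ n → Q.⊕-comm (seq r n) (seq s n)
      }
    ; ⋆-cong       = ⋆-Map.map₁-cong
    ; ⋆-involutive = λ r → ≈-termwise _ _ λ n → Q.⋆-involutive (seq r n)
    ; łukasiewicz  = λ r s → ≈-termwise _ _ λ n → Q.łukasiewicz (seq r n) (seq s n)
    ; ⊕-zeroˡ      = λ r → ≈-termwise _ _ λ n → Q.⊕-zeroˡ (seq r n)
    }

open UnitIntervalAlgebra using ([0,1])

eval : ∀ {p o : Level} (X : Space p o) → Space.Point X → C X ⟶ [0,1]
eval X x = record
  { to = λ f → ContinuousMap.⟦_⟧ f x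
  ; isHomomorphism = record
    { f-cong = λ e → ≈-at e x
    ; 0-homo = I.≈-refl
    ; ⊕-homo = λ _ _ → I.≈-refl
    ; ⋆-homo = λ _ → I.≈-refl
    }
  }
  where module I = MVAlgebra [0,1]

infixr 9 _∘ʰ_

_∘ʰ_ : ∀ {a ℓ₁ b ℓ₂ c ℓ₃ : Level} {A : MVAlgebra a ℓ₁} {B : MVAlgebra b ℓ₂} {C : MVAlgebra c ℓ₃} →
       B ⟶ C → A ⟶ B → A ⟶ C
_∘ʰ_ {C = C} g f = record
  { to = λ x → g.to (f.to x)
  ; isHomomorphism = record
    { f-cong = λ e → g.f-cong (f.f-cong e)
    ; 0-homo = ≈-trans (g.f-cong f.0-homo) g.0-homo
    ; ⊕-homo = λ x y → ≈-trans (g.f-cong (f.⊕-homo x y)) (g.⊕-homo _ _)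
    ; ⋆-homo = λ x → ≈-trans (g.f-cong (f.⋆-homo x)) (g.⋆-homo _)
    }
  }
  where
  module g = _⟶_ g
  module f = _⟶_ f
  open MVAlgebra C using (≈-trans)

module HomProperties {a ℓ₁ b ℓ₂ : Level} {A : MVAlgebra a ℓ₁} {B : MVAlgebra b ℓ₂} (h : A ⟶ B) where
  private
    module A = MVAlgebra A
  open MVAlgebra B
  open _⟶_ h

  1-homo : to A.1# ≈ 1#
  1-homo = ≈-trans (⋆-homo A.0#) (⋆-cong 0-homo)

  ⊙-homo : ∀ x y → to (x A.⊙ y) ≈ to x ⊙ to y
  ⊙-homo x y = ≈-trans (⋆-homo _) (⋆-cong (≈-trans (⊕-homo _ _) (⊕-cong (⋆-homo x) (⋆-homo y))))

  ∨-homo : ∀ x y → to (x A.∨ y) ≈ to x ∨ to y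
  ∨-homo x y = ≈-trans (⊕-homo _ _) (⊕-cong (≈-trans (⊙-homo _ _)
    (MVProperties.⊙-cong B ≈-refl (⋆-homo y))) ≈-refl)

  ∧-homo : ∀ x y → to (x A.∧ y) ≈ to x ∧ to y
  ∧-homo x y = ≈-trans (⊙-homo _ _) (MVProperties.⊙-cong B
    (≈-trans (⊕-homo _ _) (⊕-cong ≈-refl (⋆-homo y))) ≈-refl)

  ≤-homo : ∀ {x y} → x A.≤ y → to x ≤ to y
  ≤-homo {x} {y} p = ≈-trans (≈-sym (≈-trans (⊕-homo _ _) (⊕-cong (⋆-homo x) ≈-refl)))
    (≈-trans (f-cong p) 1-homo)

  ⨁-replicate-homo : ∀ k x → to (A.⨁ (replicate k x)) ≈ ⨁ (replicate k (to x))
  ⨁-replicate-homo zero    x = 0-homo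
  ⨁-replicate-homo (suc k) x = ≈-trans (⊕-homo _ _) (⊕-cong ≈-refl (⨁-replicate-homo k x))

-- Maximality of kernels of homomorphisms to the real unit interval.

module RealKernel {c ℓ : Level} {T : MVAlgebra c ℓ} (h : T ⟶ [0,1]) where
  private
    module T = MVAlgebra T
    module I = MVAlgebra [0,1]
    module Q = UnitIntervalℚ-Operations
    module O = MVOrder [0,1]
  open _⟶_ h
  open HomProperties h
  open UnitInterval-Operations using (_≈_; null; difference-null)
  open UnitIntervalℚ-Operations using (distQ)
  open Rat using (_+_; _*_; _-_; _≤_; _<_)
  open ℚₚ
  open ℚ-Lemmas

  -- Lifted to the level of the predicates over which `Rad` quantifies.
  kernel : Pred T.Carrier (c ⊔ˡ ℓ)
  kernel t = Lift (c ⊔ˡ ℓ) (to t ≈ I.0#)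

  kernel-isIdeal : IsIdeal T kernel
  kernel-isIdeal = record
    { 0∈       = lift 0-homo
    ; ⊕-closed = λ (lift p) (lift q) → lift (I.≈-trans (⊕-homo _ _)
        (I.≈-trans (I.⊕-cong p q) (I.⊕-identityˡ I.0#)))
    ; ≤-closed = λ s≤t (lift q) → lift (O.x≤0⇒x≈0 (MVProperties.≤-resp [0,1] I.≈-refl q (≤-homo s≤t)))
    }

  dist-0 : ∀ x → distQ x Q.0# ≡ val x
  dist-0 x = trans (cong Rat.∣_∣ (+-identityʳ (val x))) (0≤p⇒∣p∣≡p (0≤val x))

  1∉kernel : ¬ (T.1# ∈ kernel)
  1∉kernel (lift e) = <-irrefl refl (proj₂ null-1 (proj₁ null-1) ℕₚ.≤-refl)
    where
    null-1 : Eventually λ n → 1ℚ < 1ℚ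
    null-1 = difference-null (I.≈-trans (I.≈-sym 1-homo) e) 1ℚ (positive⁻¹ 1ℚ)

  seq-⨁-replicate : ∀ k r n → val (seq (I.⨁ (replicate k r)) n) ≡ (fromℕ k * val (seq r n)) ⊓ 1ℚ
  seq-⨁-replicate k r n = trans (go k) (val-⨁-replicate k (seq r n))
    where
    go : ∀ k → val (seq (I.⨁ (replicate k r)) n) ≡ val (MVAlgebra.⨁ [0,1]ℚ (replicate k (seq r n)))
    go zero    = refl
    go (suc k) = cong (λ s → (val (seq r n) + s) ⊓ 1ℚ) (go k)

  -- Once kδ is at least 1, the k-fold truncated sum is eventually exactly 1.
  bounded-away⇒multiple-1 : ∀ {r δ} → 0ℚ < δ → Eventually (λ n → δ ≤ val (seq r n)) →
                            ∃ λ k → I.⨁ (replicate k r) I.⋆ ≈ I.0#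
  bounded-away⇒multiple-1 {r} {δ} 0<δ (N , b) = k , null λ ε 0<ε → N , λ n N≤n →
      subst (_< ε) (sym (trans (dist-0 (seq (I.⨁ (replicate k r) I.⋆) n)) (vanishes n N≤n))) 0<ε
    where
    k = proj₁ (archimedean 0<δ)

    vanishes : ∀ n → N ℕ.≤ n → 1ℚ - val (seq (I.⨁ (replicate k r)) n) ≡ 0ℚ
    vanishes n N≤n = cong (λ s → 1ℚ - s) (trans (seq-⨁-replicate k r n) (p≥q⇒p⊓q≡q
      (≤-trans (proj₂ (archimedean 0<δ))
        (*-monoˡ-≤-nonNeg (fromℕ k) {{Rat.nonNegative (0≤fromℕ k)}} (b n N≤n)))))

  -- A Cauchy sequence is null as soon as it is not bounded away from 0, so
  -- maximality needs no excluded middle.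
  not-bounded-away⇒null : ∀ r → ¬ (∃ λ δ → 0ℚ < δ × Eventually (λ n → δ ≤ val (seq r n))) → r ≈ I.0#
  not-bounded-away⇒null r ¬away = null λ ε 0<ε → null-at ε 0<ε
    where
    null-at : ∀ ε → 0ℚ < ε → Eventually λ n → distQ (seq r n) Q.0# < ε
    -- One decidable comparison of rationals, at the Cauchy index N for δ, separates the two cases.
    null-at ε 0<ε = close (val (seq r N) <? δ + δ)
      where
      -- A quarter of ε: the small case gives a bound of δ + 2δ, at most 4δ.
      δ = ½ * (½ * ε)

      0<δ : 0ℚ < δ
      0<δ = ½*-pos (½*-pos 0<ε)

      N = proj₁ (cauchy r δ 0<δ)
      b = proj₂ (cauchy r δ 0<δ)

      close : _ → Eventually λ n → distQ (seq r n) Q.0# < ε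
      close (yes small) = N , λ n N≤n → begin-strict
        distQ (seq r n) Q.0#                               ≤⟨ dist-triangle (val (seq r n)) (val (seq r N)) 0ℚ ⟩
        distQ (seq r n) (seq r N) + distQ (seq r N) Q.0#   <⟨ +-mono-< (b n N N≤n ℕₚ.≤-refl) 0-close ⟩
        δ + (δ + δ)                                        ≤⟨ +-monoˡ-≤ (δ + δ) (UnitIntervalℚ-Values.p≤p+q {δ} {δ} (<⇒≤ 0<δ)) ⟩
        (δ + δ) + (δ + δ)                                  ≡⟨ cong₂ _+_ (½*+½* (½ * ε)) (½*+½* (½ * ε)) ⟩
        ½ * ε + ½ * ε                                      ≡⟨ ½*+½* ε ⟩
        ε                                                  ∎
        where
        open ≤-Reasoning
        0-close : distQ (seq r N) Q.0# < δ + δ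
        0-close = subst (_< δ + δ) (sym (dist-0 (seq r N))) small
      -- A term at N of at least 2δ keeps every later term at least δ.
      close (no ¬small) = ⊥-elim (¬away (δ , 0<δ , N , λ n N≤n → ≮⇒≥ λ r<δ → ¬small (begin-strict
        val (seq r N)                                ≤⟨ dist-upper (val (seq r N)) (val (seq r n)) ⟩
        val (seq r n) + distQ (seq r N) (seq r n)    <⟨ +-mono-< r<δ (b N n ℕₚ.≤-refl N≤n) ⟩
        δ + δ                                        ∎)))
        where open ≤-Reasoning

  -- If t in J had image bounded away from 0, some multiple s of t would have image 1. Then s lies
  -- in J and `s ⋆` in the kernel, hence in J, so J would contain 1.
  kernel-isMaximal : IsMaximalIdeal T kernel
  kernel-isMaximal = record
    { isIdeal = kernel-isIdeal
    ; proper  = 1∉kernel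
    ; maximal = λ J J-isIdeal 1∉J ker⊆J {t} t∈J →
        let open IsIdeal J-isIdeal in
        lift (not-bounded-away⇒null (to t) λ (δ , 0<δ , away) →
          let (k , e) = bounded-away⇒multiple-1 0<δ away
              s       = T.⨁ (replicate k t)
              s⋆∈J    = ker⊆J (lift (I.≈-trans (⋆-homo s)
                          (I.≈-trans (I.⋆-cong (⨁-replicate-homo k t)) e)))
          in 1∉J (≤-closed (MVProperties.≤-reflexive T (T.≈-sym (MVProperties.⋆-⊕-inverse T s)))
               (⊕-closed s⋆∈J (replicate∈ J-isIdeal t∈J k))))
    }
    where
    replicate∈ : ∀ {J : Pred T.Carrier (c ⊔ˡ ℓ)} → IsIdeal T J → ∀ {t} → t ∈ J →
                  ∀ k → T.⨁ (replicate k t) ∈ J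
    replicate∈ J-isIdeal t∈J zero    = IsIdeal.0∈ J-isIdeal
    replicate∈ J-isIdeal t∈J (suc k) = IsIdeal.⊕-closed J-isIdeal t∈J (replicate∈ J-isIdeal t∈J k)

  Rad⊆kernel : ∀ {t} → t ∈ Rad T → to t ≈ I.0#
  Rad⊆kernel t∈Rad = lower (t∈Rad kernel kernel-isMaximal)

-- Multiplication by rationals as a bimorphism into C(X).

module Scaling {p o : Level} (X : Space p o) where
  private
    module Q  = MVAlgebra [0,1]ℚ
    module QV = UnitIntervalℚ-Values
  open MVAlgebra (C X) hiding (_≤_)
  open MVProperties (C X) using (⊙-cong)
  open MVOrder (C X) using (⊕-⊙-⋆-cancel)
  open UnitIntervalℚ-Operations using (val-≡; ≈⇒val-≡)
  open Rat using (_+_; _*_; _-_; _≤_)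
  open ℚₚ using
    ( *-assoc; *-comm; *-identityʳ; *-distribˡ-+; *-distribʳ-+; p≤q⇒p⊓q≡p; *-monoˡ-≤-nonNeg
    ; *-distribʳ-⊔-nonNeg; *-distribˡ-⊔-nonNeg; *-distribʳ-⊓-nonNeg; *-distribˡ-⊓-nonNeg )
  open ℚ-Lemmas
  open Fractions using (numerator; fraction; val-⨁-replicate)

  -- For q = j/(d + 1), the function qf is built as j copies of f/(d + 1), so its continuity is
  -- inherited from the operations of `C X`. The sum never truncates, as qf is at most 1.
  scale : UnitIntervalℚ → Carrier → Carrier
  scale q f = ⨁ (replicate (numerator (val q)) (divide X f (ℚ.denominator-1 (val q))))

  multiply : ∀ p a j d → p ≡ fromℕ j * 1/1+ d → p * a ≤ 1ℚ → (fromℕ j * (a * 1/1+ d)) ⊓ 1ℚ ≡ p * a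
  multiply p a j d e p*a≤1 = begin
    (fromℕ j * (a * 1/1+ d)) ⊓ 1ℚ   ≡⟨ cong (λ s → (fromℕ j * s) ⊓ 1ℚ) (*-comm a (1/1+ d)) ⟩
    (fromℕ j * (1/1+ d * a)) ⊓ 1ℚ   ≡⟨ cong (_⊓ 1ℚ) (*-assoc (fromℕ j) (1/1+ d) a) ⟨
    (fromℕ j * 1/1+ d * a) ⊓ 1ℚ     ≡⟨ cong (λ s → (s * a) ⊓ 1ℚ) e ⟨
    (p * a) ⊓ 1ℚ                    ≡⟨ p≤q⇒p⊓q≡p p*a≤1 ⟩
    p * a                           ∎
    where open ≡-Reasoning

  module _ (x : Space.Point X) (n : ℕ) where
    at : Carrier → ℚ
    at f = val (ev X f x n)

    ev-⨁-replicate : ∀ k f → at (⨁ (replicate k f)) ≡ (fromℕ k * at f) ⊓ 1ℚ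
    ev-⨁-replicate k f = trans (go k) (val-⨁-replicate k (ev X f x n))
      where
      go : ∀ k → at (⨁ (replicate k f)) ≡ val (Q.⨁ (replicate k (ev X f x n)))
      go zero    = refl
      go (suc k) = cong (λ s → (at f + s) ⊓ 1ℚ) (go k)

    *≤1 : ∀ q {r} → r ≤ 1ℚ → val q * r ≤ 1ℚ
    *≤1 q {r} r≤1 = ℚₚ.≤-trans (*-monoˡ-≤-nonNeg (val q) {{Rat.nonNegative (0≤val q)}} r≤1)
      (subst (_≤ 1ℚ) (sym (*-identityʳ (val q))) (val≤1 q))

    ev-scale : ∀ q f → at (scale q f) ≡ val q * at f
    ev-scale q f = trans
      (ev-⨁-replicate (numerator (val q)) (divide X f (ℚ.denominator-1 (val q))))
      (multiply (val q) (at f) (numerator (val q)) (ℚ.denominator-1 (val q))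
        (fraction (val q) (0≤val q)) (*≤1 q (val≤1 (ev X f x n))))

  ⨁-replicate-cong : ∀ k {f g} → f ≈ g → ⨁ (replicate k f) ≈ ⨁ (replicate k g)
  ⨁-replicate-cong zero    e = ≈-refl
  ⨁-replicate-cong (suc k) e = ⊕-cong e (⨁-replicate-cong k e)

  scale-cong : ∀ {q q′ f f′} → q Q.≈ q′ → f ≈ f′ → scale q f ≈ scale q′ f′
  -- Equality of f and f′ holds only in the limit, so it is used by congruence with q fixed; q and
  -- q′ have equal values, so the second change is exact at every term.
  scale-cong {q} {q′} {f} {f′} (val-≡ e) e′ = ≈-trans
    (⨁-replicate-cong (numerator (val q)) (divide-cong X _ e′))
    (termwise X {scale q f′} {scale q′ f′} λ x n →
      trans (ev-scale x n q f′) (trans (cong (_* at x n f′) e) (sym (ev-scale x n q′ f′))))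

  -- Multiplication by a nonnegative rational distributes over maxima and minima, so the four
  -- lattice laws hold termwise.
  scale-∨ˡ : ∀ q q′ f → scale (q Q.∨ q′) f ≈ scale q f ∨ scale q′ f
  scale-∨ˡ q q′ f = termwise X λ x n → trans (ev-scale x n (q Q.∨ q′) f)
    (trans (cong (_* at x n f) (QV.val-∨ q q′))
    (trans (*-distribʳ-⊔-nonNeg (at x n f) {{Rat.nonNegative (0≤val (ev X f x n))}} (val q) (val q′))
    (trans (cong₂ _⊔_ (sym (ev-scale x n q f)) (sym (ev-scale x n q′ f)))
           (sym (QV.val-∨ (ev X (scale q f) x n) (ev X (scale q′ f) x n))))))

  scale-∧ˡ : ∀ q q′ f → scale (q Q.∧ q′) f ≈ scale q f ∧ scale q′ f
  scale-∧ˡ q q′ f = termwise X λ x n → trans (ev-scale x n (q Q.∧ q′) f)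
    (trans (cong (_* at x n f) (QV.val-∧ q q′))
    (trans (*-distribʳ-⊓-nonNeg (at x n f) {{Rat.nonNegative (0≤val (ev X f x n))}} (val q) (val q′))
    (trans (cong₂ _⊓_ (sym (ev-scale x n q f)) (sym (ev-scale x n q′ f)))
           (sym (QV.val-∧ (ev X (scale q f) x n) (ev X (scale q′ f) x n))))))

  scale-∨ʳ : ∀ q f g → scale q (f ∨ g) ≈ scale q f ∨ scale q g
  scale-∨ʳ q f g = termwise X λ x n → trans (ev-scale x n q (f ∨ g))
    (trans (cong (val q *_) (QV.val-∨ (ev X f x n) (ev X g x n)))
    (trans (*-distribˡ-⊔-nonNeg (val q) {{Rat.nonNegative (0≤val q)}} (at x n f) (at x n g))
    (trans (cong₂ _⊔_ (sym (ev-scale x n q f)) (sym (ev-scale x n q g)))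
           (sym (QV.val-∨ (ev X (scale q f) x n) (ev X (scale q g) x n))))))

  scale-∧ʳ : ∀ q f g → scale q (f ∧ g) ≈ scale q f ∧ scale q g
  scale-∧ʳ q f g = termwise X λ x n → trans (ev-scale x n q (f ∧ g))
    (trans (cong (val q *_) (QV.val-∧ (ev X f x n) (ev X g x n)))
    (trans (*-distribˡ-⊓-nonNeg (val q) {{Rat.nonNegative (0≤val q)}} (at x n f) (at x n g))
    (trans (cong₂ _⊓_ (sym (ev-scale x n q f)) (sym (ev-scale x n q g)))
           (sym (QV.val-∧ (ev X (scale q f) x n) (ev X (scale q g) x n))))))

  scale-sumˡ : ∀ q q′ f x n →
               at x n (scale q f) + at x n (scale q′ f) ≡ (val q + val q′) * at x n f
  scale-sumˡ q q′ f x n = trans (cong₂ _+_ (ev-scale x n q f) (ev-scale x n q′ f))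
    (sym (*-distribʳ-+ (at x n f) (val q) (val q′)))

  scale-sumˡ≤1 : ∀ {q q′} → q Q.⊙ q′ Q.≈ Q.0# → ∀ f x n →
                 at x n (scale q f) + at x n (scale q′ f) ≤ 1ℚ
  scale-sumˡ≤1 {q} {q′} d f x n = subst (_≤ 1ℚ)
    (trans (*-comm (at x n f) (val q + val q′)) (sym (scale-sumˡ q q′ f x n)))
    (*≤1 x n (ev X f x n) (QV.⊙-zero⇒val-+≤1 {q} {q′} (≈⇒val-≡ d)))

  scale-+-defˡ : ∀ {q q′} f → q Q.⊙ q′ Q.≈ Q.0# → scale q f ⊙ scale q′ f ≈ 0#
  scale-+-defˡ {q} {q′} f d = termwise X λ x n →
    QV.val-+≤1⇒⊙-zero {ev X (scale q f) x n} {ev X (scale q′ f) x n} (scale-sumˡ≤1 {q} {q′} d f x n)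

  scale-+-homoˡ : ∀ {q q′} f → q Q.⊙ q′ Q.≈ Q.0# → scale (q Q.⊕ q′) f ≈ scale q f ⊕ scale q′ f
  scale-+-homoˡ {q} {q′} f d = termwise X λ x n →
    trans (ev-scale x n (q Q.⊕ q′) f)
    (trans (cong (_* at x n f) (QV.val-⊕ {q} {q′} (QV.⊙-zero⇒val-+≤1 {q} {q′} (≈⇒val-≡ d))))
    (trans (sym (scale-sumˡ q q′ f x n))
      (sym (QV.val-⊕ {ev X (scale q f) x n} {ev X (scale q′ f) x n} (scale-sumˡ≤1 {q} {q′} d f x n)))))

  module _ (f g : Carrier) where
    -- Equal to f when f ⊙ g ≈ 0, a relation that holds only in the limit;
    -- the partial sum of this truncation and g is defined termwise.
    truncated : Carrier
    truncated = (f ⊕ g) ⊙ g ⋆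

    -- Each term of `truncated` lies below the corresponding term of `g ⋆`.
    truncated-+≤1 : ∀ x n → at x n truncated + at x n g ≤ 1ℚ
    truncated-+≤1 x n = QV.⊙-zero⇒val-+≤1 {ev X truncated x n} {ev X g x n}
      (≈⇒val-≡ (QO.⊙-zero-mono {_} {b Q.⋆} {b} {b} (QO.x⊙y≤y (a Q.⊕ b) (b Q.⋆)) (QP.≤-reflexive {b} {b} Q.≈-refl)
        (Q.≈-trans {b Q.⋆ Q.⊙ b} {b Q.⊙ b Q.⋆} (QP.⊙-comm (b Q.⋆) b) (QO.⊙-⋆-zero b))))
      where
      module QO = MVOrder [0,1]ℚ
      module QP = MVProperties [0,1]ℚ
      a = ev X f x n
      b = ev X g x n

    module _ (q : UnitIntervalℚ) (x : Space.Point X) (n : ℕ) where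
      scale-sumʳ : at x n (scale q truncated) + at x n (scale q g) ≡ val q * (at x n truncated + at x n g)
      scale-sumʳ = trans (cong₂ _+_ (ev-scale x n q truncated) (ev-scale x n q g))
        (sym (*-distribˡ-+ (val q) (at x n truncated) (at x n g)))

      scale-sumʳ≤1 : at x n (scale q truncated) + at x n (scale q g) ≤ 1ℚ
      scale-sumʳ≤1 = subst (_≤ 1ℚ) (sym scale-sumʳ) (*≤1 x n q (truncated-+≤1 x n))

    scale-+-defʳ : ∀ q → f ⊙ g ≈ 0# → scale q f ⊙ scale q g ≈ 0#
    scale-+-defʳ q d = ≈-trans
      (⊙-cong (scale-cong {q} Q.≈-refl (≈-sym (⊕-⊙-⋆-cancel d))) ≈-refl)
      (termwise X λ x n → QV.val-+≤1⇒⊙-zero {ev X (scale q truncated) x n} {ev X (scale q g) x n} (scale-sumʳ≤1 q x n))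

    scale-+-homoʳ : ∀ q → f ⊙ g ≈ 0# → scale q (f ⊕ g) ≈ scale q f ⊕ scale q g
    scale-+-homoʳ q d = ≈-trans (scale-cong {q} Q.≈-refl (⊕-cong f≈ ≈-refl))
      (≈-trans (termwise X λ x n →
          trans (ev-scale x n q (truncated ⊕ g))
          (trans (cong (val q *_) (QV.val-⊕ {ev X truncated x n} {ev X g x n} (truncated-+≤1 x n)))
          (trans (sym (scale-sumʳ q x n))
            (sym (QV.val-⊕ {ev X (scale q truncated) x n} {ev X (scale q g) x n} (scale-sumʳ≤1 q x n))))))
        (⊕-cong (scale-cong {q} Q.≈-refl (≈-sym f≈)) ≈-refl))
      where
      f≈ : f ≈ truncated
      f≈ = ≈-sym (⊕-⊙-⋆-cancel d)

  scale-isBimorphism : ∀ {c ℓ : Level} {A : MVAlgebra c ℓ} (ι : A ⟶ C X) →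
                       IsBimorphism [0,1]ℚ A (C X) (λ q a → scale q (_⟶_.to ι a))
  scale-isBimorphism {A = A} ι = record
    { β-cong  = λ {q} {q′} e e′ → scale-cong {q} {q′} e (f-cong e′)
    ; β-1     = ≈-trans (scale-cong {Q.1#} Q.≈-refl 1-homo)
        (termwise X λ x n → trans (ev-scale x n Q.1# 1#) refl)
    ; ∨-homoˡ = λ q q′ a → scale-∨ˡ q q′ (to a)
    ; ∨-homoʳ = λ q a b → ≈-trans (scale-cong {q} Q.≈-refl (∨-homo a b)) (scale-∨ʳ q (to a) (to b))
    ; ∧-homoˡ = λ q q′ a → scale-∧ˡ q q′ (to a)
    ; ∧-homoʳ = λ q a b → ≈-trans (scale-cong {q} Q.≈-refl (∧-homo a b)) (scale-∧ʳ q (to a) (to b))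
    ; +-defˡ  = λ {q} {q′} a → scale-+-defˡ {q} {q′} (to a)
    ; +-homoˡ = λ {q} {q′} a → scale-+-homoˡ {q} {q′} (to a)
    ; +-defʳ  = λ q {a} {b} d → scale-+-defʳ (to a) (to b) q (zero-image a b d)
    ; +-homoʳ = λ q {a} {b} d → ≈-trans (scale-cong {q} Q.≈-refl (⊕-homo a b))
        (scale-+-homoʳ (to a) (to b) q (zero-image a b d))
    }
    where
    open _⟶_ ι
    open HomProperties ι
    module A = MVAlgebra A

    zero-image : ∀ a b → a A.⊙ b A.≈ A.0# → to a ⊙ to b ≈ 0#
    zero-image a b d = ≈-trans (≈-sym (⊙-homo a b)) (≈-trans (f-cong d) 0-homo)

-- Staircases of rationals and their dependence on the sum.

module Staircases where
  open Rat using (_+_; _*_; _-_; -_; _≤_)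
  open ℚₚ
  open ℚ-Lemmas
  open ℚ-Sums
  open MVAlgebra [0,1]ℚ using (_⊕_; _⊙_; 0#)
  open MVProperties [0,1]ℚ using (carry; carries)
  open UnitIntervalℚ-Operations using (distQ)
  open +-*-Solver

  -- The index s is the amount still to be distributed: each entry takes what fits below 1 and hands
  -- the excess on. So s and the length determine the vector up to values.
  data Staircase : ∀ {n} → ℚ → Vec UnitIntervalℚ n → Set where
    []   : ∀ {s} → Staircase s []
    _∷_  : ∀ {s n x} {xs : Vec UnitIntervalℚ n} → val x ≡ s ⊓ 1ℚ → Staircase (s - s ⊓ 1ℚ) xs →
           Staircase s (x ∷ xs)

  0≤excess : ∀ s → 0ℚ ≤ s - s ⊓ 1ℚ
  0≤excess s = subst (_≤ s - s ⊓ 1ℚ) (+-inverseʳ (s ⊓ 1ℚ)) (+-monoˡ-≤ (- (s ⊓ 1ℚ)) (p⊓q≤p s 1ℚ))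

  -- The first entry absorbs v up to 1; by `val-⊕+⊙` the old excess of s plus the overflow `x ⊙ v`
  -- is exactly the excess of `s + val v`, as the tail requires.
  staircase-carry : ∀ {s n} {xs : Vec UnitIntervalℚ n} → 0ℚ ≤ s → Staircase s xs → ∀ v →
                    Staircase (s + val v) (carry xs v)
  staircase-carry         0≤s []                        v = []
  staircase-carry {s} 0≤s (_∷_ {x = x} {xs} e st) v =
    head ∷ subst (λ r → Staircase r (carry xs (x ⊙ v))) excess (staircase-carry (0≤excess s) st (x ⊙ v))
    where
    head : val (x ⊕ v) ≡ (s + val v) ⊓ 1ℚ
    head = begin
      (val x + val v) ⊓ 1ℚ       ≡⟨ cong (λ r → (r + val v) ⊓ 1ℚ) e ⟩
      (s ⊓ 1ℚ + val v) ⊓ 1ℚ      ≡⟨ cong (_⊓ 1ℚ) (+-comm (s ⊓ 1ℚ) (val v)) ⟩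
      (val v + s ⊓ 1ℚ) ⊓ 1ℚ      ≡⟨ ⊓-absorb-+ s 1ℚ (0≤val v) ⟩
      (val v + s) ⊓ 1ℚ           ≡⟨ cong (_⊓ 1ℚ) (+-comm (val v) s) ⟩
      (s + val v) ⊓ 1ℚ           ∎
      where open ≡-Reasoning

    excess : s - s ⊓ 1ℚ + val (x ⊙ v) ≡ (s + val v) - (s + val v) ⊓ 1ℚ
    excess = begin
      s - s ⊓ 1ℚ + val (x ⊙ v)                                 ≡⟨ cong (λ r → s - r + val (x ⊙ v)) e ⟨
      s - val x + val (x ⊙ v)                                  ≡⟨ solve 4 (λ s x a o → (s :+ :- x) :+ o := ((s :+ :- x) :+ (a :+ o)) :+ :- a)
                                                                         refl s (val x) (val (x ⊕ v)) (val (x ⊙ v)) ⟩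
      s - val x + (val (x ⊕ v) + val (x ⊙ v)) - val (x ⊕ v)    ≡⟨ cong₂ (λ r t → s - val x + r - t) (val-⊕+⊙ x v) head ⟩
      s - val x + (val x + val v) - (s + val v) ⊓ 1ℚ           ≡⟨ cong (_- (s + val v) ⊓ 1ℚ)
                                                                    (solve 3 (λ s x v → (s :+ :- x) :+ (x :+ v) := s :+ v) refl s (val x) (val v)) ⟩
      (s + val v) - (s + val v) ⊓ 1ℚ                           ∎
      where open ≡-Reasoning

  staircase-carries : ∀ {s m n} {xs : Vec UnitIntervalℚ m} → 0ℚ ≤ s → Staircase s xs →
                      (vs : Vec UnitIntervalℚ n) → Staircase (s + sum vs) (carries xs vs)
  staircase-carries {s} 0≤s st []       = subst (λ r → Staircase r _) (sym (+-identityʳ s)) st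
  staircase-carries {s} {xs = xs} 0≤s st (v ∷ vs) =
    subst (λ r → Staircase r (carries (carry xs v) vs)) (+-assoc s (val v) (sum vs))
      (staircase-carries (0≤+ 0≤s (0≤val v)) (staircase-carry 0≤s st v) vs)

  staircase-zeros : ∀ n → Staircase 0ℚ (replicate n 0#)
  staircase-zeros zero    = []
  staircase-zeros (suc n) = refl ∷ staircase-zeros n

  staircase-fill : ∀ {n} (vs : Vec UnitIntervalℚ n) → Staircase (sum vs) (fill [0,1]ℚ n vs)
  staircase-fill {n} vs = subst (λ r → Staircase r (fill [0,1]ℚ n vs)) (+-identityˡ (sum vs))
    (staircase-carries ≤-refl (staircase-zeros n) vs)

  -- `s - s ⊓ 1ℚ` is max(s - 1, 0), which increases no faster than s.
  excess-≤ : ∀ {s t r} → 0ℚ ≤ r → s ≤ t + r → s - s ⊓ 1ℚ ≤ t - t ⊓ 1ℚ + r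
  excess-≤ {s} {t} {r} 0≤r s≤t+r with ≤-total s 1ℚ
  ... | inj₁ s≤1 = subst (_≤ t - t ⊓ 1ℚ + r)
    (sym (trans (cong (λ u → s - u) (p≤q⇒p⊓q≡p s≤1)) (+-inverseʳ s))) (0≤+ (0≤excess t) 0≤r)
  ... | inj₂ 1≤s = subst (λ u → s - u ≤ t - t ⊓ 1ℚ + r) (sym (p≥q⇒p⊓q≡q 1≤s)) (begin
    s - 1ℚ              ≤⟨ +-mono-≤ s≤t+r (neg-antimono-≤ (p⊓q≤q t 1ℚ)) ⟩
    t + r - t ⊓ 1ℚ      ≡⟨ solve 3 (λ t r u → (t :+ r) :+ :- u := (t :+ :- u) :+ r) refl t r (t ⊓ 1ℚ) ⟩
    t - t ⊓ 1ℚ + r      ∎)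
    where open ≤-Reasoning

  dist-excess : ∀ s t → dist (s - s ⊓ 1ℚ) (t - t ⊓ 1ℚ) ≤ dist s t
  dist-excess s t = dist-intro
    (excess-≤ {s} {t} (0≤∣p∣ (s - t)) (dist-upper s t))
    (excess-≤ {t} {s} (0≤∣p∣ (s - t)) (subst (λ u → t ≤ s + u) (dist-comm t s) (dist-upper t s)))

  -- Quantitative uniqueness of the staircase: equal reals may have merely close rational terms, so
  -- an estimate is required rather than an equality.
  staircase-nonexpansive : ∀ {s t n} {xs ys : Vec UnitIntervalℚ n} → Staircase s xs → Staircase t ys →
                           ∀ i → distQ (lookup xs i) (lookup ys i) ≤ dist s t
  staircase-nonexpansive {s} {t} (e ∷ _)  (e′ ∷ _)   zero    =
    subst (_≤ dist s t) (sym (cong₂ dist e e′)) (dist-⊓ s t)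
  staircase-nonexpansive {s} {t} (_ ∷ st) (_ ∷ st′) (suc i) =
    ≤-trans (staircase-nonexpansive st st′ i) (dist-excess s t)

-- Means of continuous functions.

module Means {p o : Level} (X : Space p o) where
  private module Q = UnitIntervalℚ-Operations
  open MVAlgebra (C X) using (Carrier; _≈_; ⨁; 0#)
  open Rat using (_+_; _*_; _-_; -_; _≤_; _<_)
  open ℚₚ
  open ℚ-Lemmas
  open ℚ-Sums using (sum; val-⨁-/1+)
  open Staircases using (staircase-fill; staircase-nonexpansive)
  open UnitIntervalℚ-Operations using (distQ)
  open UnitInterval-Operations using (null; difference-null)

  mean : ∀ m {n} → Vec Carrier n → Carrier
  mean m fs = ⨁ (Vec.map (λ f → divide X f m) fs)

  module At (x : Space.Point X) (n : ℕ) where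
    Value : Carrier → UnitIntervalℚ → Set
    Value f q = val (ev X f x n) ≡ val q

    open Related (C X) [0,1]ℚ Value refl
      (cong (λ p → 1ℚ - p)) (cong₂ (λ p q → (p + q) ⊓ 1ℚ)) using (⨁-rel; carries-rel)

    values : ∀ {k} → Vec Carrier k → Vec UnitIntervalℚ k
    values = Vec.map (λ f → ev X f x n)

    value-values : ∀ {k} (fs : Vec Carrier k) → Pointwise Value fs (values fs)
    value-values []       = []
    value-values (f ∷ fs) = refl ∷ value-values fs

    value-zeros : ∀ k → Pointwise Value (replicate k 0#) (replicate k Q.0#)
    value-zeros zero    = []
    value-zeros (suc k) = refl ∷ value-zeros k

    value-fill : ∀ {k} (fs : Vec Carrier k) i →
                 val (ev X (lookup (fill (C X) k fs) i) x n) ≡ val (lookup (fill [0,1]ℚ k (values fs)) i)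
    value-fill {k} fs = Pointwise.lookup (carries-rel (value-zeros k) (value-values fs))

    value-mean : ∀ m (fs : Vec Carrier (suc m)) → val (ev X (mean m fs) x n) ≡ sum (values fs) * 1/1+ m
    value-mean m fs = trans (⨁-rel (go fs)) (val-⨁-/1+ m (values fs))
      where
      go : ∀ {k} (fs : Vec Carrier k) →
           Pointwise Value (Vec.map (λ f → divide X f m) fs) (Vec.map (Q._/1+ m) (values fs))
      go []       = []
      go (f ∷ fs) = refl ∷ go fs

  dist-*ʳ : ∀ p q {r} → 0ℚ ≤ r → dist (p * r) (q * r) ≡ dist p q * r
  dist-*ʳ p q {r} 0≤r = begin
    Rat.∣ p * r - q * r ∣      ≡⟨ cong Rat.∣_∣ (solve 3 (λ p q r → p :* r :+ :- (q :* r) := (p :+ :- q) :* r) refl p q r) ⟩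
    Rat.∣ (p - q) * r ∣        ≡⟨ ∣p*q∣≡∣p∣*∣q∣ (p - q) r ⟩
    dist p q * Rat.∣ r ∣       ≡⟨ cong (dist p q *_) (0≤p⇒∣p∣≡p 0≤r) ⟩
    dist p q * r               ∎
    where
    open ≡-Reasoning
    open +-*-Solver

  -- At each point and index the terms of the two fills are staircases of the respective sums, so
  -- entries are as close as the sums are.
  fill-determined-by-mean : ∀ m (fs gs : Vec Carrier (suc m)) → mean m fs ≈ mean m gs →
                            ∀ i → lookup (fill (C X) (suc m) fs) i ≈ lookup (fill (C X) (suc m) gs) i
  fill-determined-by-mean m fs gs e i = pointwise λ x → null λ ε 0<ε →
    -- The mean is the sum divided by m + 1, so ε/(m + 1) for means is ε for sums.
    let (N , close) = difference-null (≈-at e x) (ε * 1/1+ m) (0<ε/ ε 0<ε)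
    in N , λ n N≤n → near x n ε (close n N≤n)
    where
    0<ε/ : ∀ ε → 0ℚ < ε → 0ℚ < ε * 1/1+ m
    0<ε/ ε 0<ε = subst (_< ε * 1/1+ m) (*-zeroˡ (1/1+ m))
      (*-monoˡ-<-pos (1/1+ m) {{normalize-pos 1 (suc m)}} 0<ε)

    near : ∀ x n ε → distQ (ev X (mean m fs) x n) (ev X (mean m gs) x n) < ε * 1/1+ m →
           distQ (ev X (lookup (fill (C X) (suc m) fs) i) x n) (ev X (lookup (fill (C X) (suc m) gs) i) x n) < ε
    near x n ε h = subst (_< ε) (sym (cong₂ dist (value-fill fs i) (value-fill gs i)))
      (≤-<-trans (staircase-nonexpansive (staircase-fill (values fs)) (staircase-fill (values gs)) i)
        (*-cancelʳ-<-nonNeg (1/1+ m) {{normalize-nonNeg 1 (suc m)}}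
          (subst (_< ε * 1/1+ m)
            (trans (cong₂ dist (value-mean m fs) (value-mean m gs))
                   (dist-*ʳ (sum (values fs)) (sum (values gs)) (0≤1/1+ m))) h)))
      where open At x n

open UnitIntervalℚ-Values using (unitFraction; val-unitFraction)

-- The isomorphism between the tensor product and the divisible hull.

module RationalTensor {c ℓ p o : Level} (A : MVAlgebra c ℓ) (X : Space p o) (ι : A ↪ C X) where
  private
    module A  = MVAlgebra A
    module AP = MVProperties A
    module CX = MVAlgebra (C X)
    module Quot = MVAlgebra ([0,1]ℚ ⊗ A)
  open _↪_ ι
  open Scaling X using (scale; ev-scale; scale-isBimorphism)
  open Means X using (mean; fill-determined-by-mean)
  open Tensor [0,1]ℚ A
  open Universal (C X) (scale-isBimorphism hom) using (factor; lift-to; lift-cong)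
  open BimorphismSums A algebra isBimorphism

  NormalForm : Term → Set _
  NormalForm t = ∃ λ m → ∃ λ (as : Vec A.Carrier (suc m)) → t ∼ sums (unitFraction m) as

  normalForm-⟨⟩ : ∀ q a → NormalForm ⟨ q , a ⟩
  -- With q = j/(d + 1), the generator is a sum of j terms; `fill` brings the length to d + 1.
  normalForm-⟨⟩ q a = d , fill A (suc d) (replicate j a) ,
    ∼-trans (β-multiple j {q} {unitFraction d} a (trans (Fractions.fraction (val q) (0≤val q))
      (cong (ℚ-Lemmas.fromℕ j Rat.*_) (sym (val-unitFraction d)))))
            (∼-sym (sums-fill d (replicate j a)))
    where
    j = Fractions.numerator (val q)
    d = ℚ.denominator-1 (val q)

  normalForm-∔ : ∀ {s t} → NormalForm s → NormalForm t → NormalForm (s ∔ t)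
  normalForm-∔ (m , as , e) (k , bs , e′) = common m k , AP.carries (repeat (suc k) as) (repeat (suc m) bs) ,
    ∼-trans (∔-cong (∼-trans e (sums-refineˡ m k as)) (∼-trans e′ (sums-refineʳ m k bs)))
            (∼-sym (sums-carries (common m k) (repeat (suc k) as) (repeat (suc m) bs)))

  normalForm-⁎ : ∀ {s} → NormalForm s → NormalForm (s ⁎)
  normalForm-⁎ (m , as , e) = m , Vec.map A._⋆ as , ∼-trans (⁎-cong e) (sums-⋆ m as)

  normalForm : ∀ t → NormalForm t
  normalForm ⟨ q , a ⟩ = normalForm-⟨⟩ q a
  normalForm (s ∔ t)   = normalForm-∔ (normalForm s) (normalForm t)
  normalForm (t ⁎)     = normalForm-⁎ (normalForm t)
  normalForm 𝟎         = 0 , replicate 1 A.0# , ∼-sym (sums-zeros 1 (unitFraction 0))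

  scale-unitFraction : ∀ m f → scale (unitFraction m) f CX.≈ divide X f m
  scale-unitFraction m f = termwise X λ x n →
    trans (ev-scale x n (unitFraction m) f)
    (trans (cong (Rat._* val (ev X f x n)) (val-unitFraction m)) (ℚₚ.*-comm (ℚ-Lemmas.1/1+ m) (val (ev X f x n))))

  factor-sums : ∀ m {n} (as : Vec A.Carrier n) →
                lift-to (sums (unitFraction m) as) CX.≈ CX.⨁ (Vec.map (λ a → divide X (to a) m) as)
  factor-sums m []       = CX.≈-refl
  factor-sums m (a ∷ as) = CX.⊕-cong (scale-unitFraction m (to a)) (factor-sums m as)

  mean-image : ∀ m {n} (as : Vec A.Carrier n) →
               CX.⨁ (Vec.map (λ a → divide X (to a) m) as) CX.≈ mean m (Vec.map to as)
  mean-image m []       = CX.≈-refl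
  mean-image m (a ∷ as) = CX.⊕-cong CX.≈-refl (mean-image m as)

  open Related A (C X) (λ a f → to a CX.≈ f) 0-homo
    (λ {a} e → CX.≈-trans (⋆-homo a) (CX.⋆-cong e))
    (λ {a} {_} {b} e e′ → CX.≈-trans (⊕-homo a b) (CX.⊕-cong e e′)) using (carries-rel)

  -- Carrying is expressed by the MV-operations, so homomorphisms commute with it.
  image-fill : ∀ {n} (as : Vec A.Carrier n) i →
               to (lookup (fill A n as) i) CX.≈ lookup (fill (C X) n (Vec.map to as)) i
  image-fill {n} as = Pointwise.lookup (carries-rel (zeros n) (images as))
    where
    images : ∀ {k} (as : Vec A.Carrier k) → Pointwise (λ a f → to a CX.≈ f) as (Vec.map to as)
    images []       = []
    images (a ∷ as) = CX.≈-refl ∷ images as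

    zeros : ∀ k → Pointwise (λ a f → to a CX.≈ f) (replicate k A.0#) (replicate k CX.0#)
    zeros zero    = []
    zeros (suc k) = 0-homo ∷ zeros k

  sums-cong : ∀ {n} r (as bs : Vec A.Carrier n) → (∀ i → lookup as i A.≈ lookup bs i) →
              sums r as ∼ sums r bs
  sums-cong r []       []       e = ∼-refl
  sums-cong r (a ∷ as) (b ∷ bs) e =
    ∔-cong (⟨⟩-cong (MVAlgebra.≈-refl [0,1]ℚ) (e zero)) (sums-cong r as bs λ i → e (suc i))

  factor-sums-mean : ∀ m {n} (as : Vec A.Carrier n) →
                     lift-to (sums (unitFraction m) as) CX.≈ mean m (Vec.map to as)
  factor-sums-mean m as = CX.≈-trans (factor-sums m as) (mean-image m as)

  image-fill-injective : ∀ {n} (as bs : Vec A.Carrier n) →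
    (∀ i → lookup (fill (C X) n (Vec.map to as)) i CX.≈ lookup (fill (C X) n (Vec.map to bs)) i) →
    ∀ i → lookup (fill A n as) i A.≈ lookup (fill A n bs) i
  image-fill-injective as bs e i =
    injective (CX.≈-trans (image-fill as i) (CX.≈-trans (e i) (CX.≈-sym (image-fill bs i))))

  -- Both sums equal those of their staircases, whose images in `C X` agree by the equality of
  -- means; injectivity of ι pulls this back to A.
  sums-determined-by-mean : ∀ m (as bs : Vec A.Carrier (suc m)) →
                            mean m (Vec.map to as) CX.≈ mean m (Vec.map to bs) →
                            sums (unitFraction m) as ∼ sums (unitFraction m) bs
  sums-determined-by-mean m as bs e = ∼-trans (∼-sym (sums-fill m as))
    (∼-trans (sums-cong (unitFraction m) (fill A (suc m) as) (fill A (suc m) bs)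
                (image-fill-injective as bs (fill-determined-by-mean m (Vec.map to as) (Vec.map to bs) e)))
             (sums-fill m bs))

  sums-injective : ∀ m (as bs : Vec A.Carrier (suc m)) →
                   lift-to (sums (unitFraction m) as) CX.≈ lift-to (sums (unitFraction m) bs) →
                   sums (unitFraction m) as ∼ sums (unitFraction m) bs
  sums-injective m as bs e = sums-determined-by-mean m as bs
    (CX.≈-trans (CX.≈-sym (factor-sums-mean m as)) (CX.≈-trans e (factor-sums-mean m bs)))

  normalForm-injective : ∀ {s t} → NormalForm s → NormalForm t → lift-to s CX.≈ lift-to t → s ∼ t
  normalForm-injective {s} {t} (m , as , es) (k , bs , et) e = ∼-trans s∼ (∼-trans
      (sums-injective K (repeat (suc k) as) (fill A (suc K) (repeat (suc m) bs))
        (CX.≈-trans (lift-cong (∼-sym s∼)) (CX.≈-trans e (lift-cong t∼))))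
      (∼-sym t∼))
    where
    K = common m k

    s∼ : s ∼ sums (unitFraction K) (repeat (suc k) as)
    s∼ = ∼-trans es (sums-refineˡ m k as)

    -- `repeat (suc m) bs` has length `suc k ℕ.* suc m`, whereas the other vector has length
    -- `suc K`; `fill` makes the lengths agree.
    t∼ : t ∼ sums (unitFraction K) (fill A (suc K) (repeat (suc m) bs))
    t∼ = ∼-trans (∼-trans et (sums-refineʳ m k bs)) (∼-sym (sums-fill K (repeat (suc m) bs)))

  factor-injective : ∀ {s t} → lift-to s CX.≈ lift-to t → s ∼ t
  factor-injective {s} {t} = normalForm-injective (normalForm s) (normalForm t)

  normalForm-inHull : ∀ {t} → NormalForm t → InDivisibleHull A X ι (lift-to t)
  normalForm-inHull (m , as , e) = m , as , CX.≈-trans (lift-cong e) (factor-sums m as)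

  factor-Rad : ∀ {t} → Rad algebra t → lift-to t CX.≈ CX.0#
  factor-Rad r = pointwise λ x → RealKernel.Rad⊆kernel (eval X x ∘ʰ factor) r

  quotient-cong : ∀ {s t} → s Quot.≈ t → lift-to s CX.≈ lift-to t
  quotient-cong {s} {t} (r , r′) = MVOrder.⊙-⋆-zero⇒≈ (C X) (factor-Rad r) (factor-Rad r′)

  -- `factor` is already injective on terms modulo `∼`, and related terms differ by elements equal
  -- to zero, which lie in the radical.
  quotient-injective : ∀ {s t} → lift-to s CX.≈ lift-to t → s Quot.≈ t
  quotient-injective e = ∼⇒∈Rad (factor-injective e) , ∼⇒∈Rad (∼-sym (factor-injective e))
    where
    open MVProperties algebra using (≤-reflexive; ⊙-⋆-inverse)
    open IsIdeal (Rad-isIdeal algebra) using (0∈; ≤-closed)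

    ∼⇒∈Rad : ∀ {s t} → s ∼ t → Rad algebra (MVAlgebra._⊙_ algebra s (t ⁎))
    ∼⇒∈Rad e′ = ≤-closed (≤-reflexive (⊙-⋆-inverse e′)) 0∈

  isomorphism : [0,1]ℚ ⊗ A ≅ DivisibleHull A X ι
  isomorphism = record
    { hom = record
      { to = λ t → lift-to t , normalForm-inHull (normalForm t)
      ; isHomomorphism = record
        { f-cong = quotient-cong
        ; 0-homo = CX.≈-refl
        ; ⊕-homo = λ _ _ → CX.≈-refl
        ; ⋆-homo = λ _ → CX.≈-refl
        }
      }
    ; bijective = quotient-injective , λ (f , m , as , e) →
        sums (unitFraction m) as , λ z≈ →
          CX.≈-trans (quotient-cong z≈) (CX.≈-trans (factor-sums m as) (CX.≈-sym e))
    }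

corollary3p2 : ∀ {c ℓ p o : Level} (A : MVAlgebra c ℓ) → Semisimple A →
    (X : Space p o) → Space.Compact X → Space.Hausdorff X →
    (ι : A ↪ C X) →
    [0,1]ℚ ⊗ A ≅ DivisibleHull A X ι
corollary3p2 A _ X _ _ ι = RationalTensor.isomorphism A X ι
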